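{- Let $\vec c=(c_1,\dots,c_k)$ be a composition of $n$ with $c_k>0$, and let $B$ be the border strip of $\vec c$. Then the top homology group $\widetilde H_{k-2}(\Delta(\Pi^\bullet_{\vec c}-\{\hat 1\}))$ is isomorphic to the Specht module $S^B$ as $\mathfrak S_n$-modules.
   Context: A pointed set partition of $[n]$ is $\{B_1,\dots,B_k,\underline Z\}$ where $Z\subseteq[n]$ (possibly empty, the pointed block) and $B_1,\dots,B_k$ are nonempty blocks partitioning $[n]\setminus Z$. $\Pi^\bullet_n$ is the poset of these with $\pi\le\pi'$ iff each non-pointed block of $\pi$ lies in some block of $\pi'$ and the pointed block of $\pi$ lies in the pointed block of $\pi'$; its type is the multiset $\{|B_1|,\dots,|B_k|\}$ with pointed number $|Z|$. A pointed composition of $n$ is $(c_1,\dots,c_k)$ with $c_1,\dots,c_{k-1}\ge1$, $c_k\ge0$, sum $n$, ordered by $\vec c\le\vec d$ iff $\vec d$ is obtained from $\vec c$ by replacing runs of consecutive entries by their sums; its type is the multiset $\{c_1,\dots,c_{k-1}\}$ with pointed number $c_k$. $\Pi^\bullet_{\vec c}$ is the induced subposet of $\Pi^\bullet_n$ of all $\pi$ with $\operatorname{type}(\pi)=\operatorname{type}(\vec d)$ for some $\vec d\ge\vec c$; $\hat 1=\{\underline{[n]}\}$; $\Delta(P)$ is the order complex; $\mathfrak S_n$ acts by relabeling; homology is reduced with coefficients in a fixed field. The border strip $B$ of $\vec c$ is the connected skew shape with no $2\times2$ square having $k$ rows, the $i$-th row from the bottom having $c_i$ boxes. A tableau of shape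 $B$ is a bijective filling of its boxes by $[n]$; a tabloid is an equivalence class of tableaux modulo permuting entries within rows; $M^B$ is spanned by tabloids; for a tableau $t$ with column stabilizer $C_t$, ${\bf e}_t=\sum_{\gamma\in C_t}\operatorname{sign}(\gamma)\gamma\{t\}$; the Specht module $S^B$ is the span of all ${\bf e}_t$. -}

module Defs where

open import Level using (Level; _⊔_) renaming (suc to lsuc)
open import Data.Bool using (Bool; true; false; _∧_; _∨_; not; if_then_else_; T)
open import Data.Nat using (ℕ; zero; suc; _∸_; _<ᵇ_; _≡ᵇ_)
open import Data.Nat.Properties using (≤-decTotalOrder)
import Data.Nat as ℕ
open import Data.Fin using (Fin; toℕ) renaming (zero to fzero; suc to fsuc)
import Data.Fin as Fin
open import Data.List using (List; []; _∷_; map; concatMap; filterᵇ; allFin; length; upTo; foldr)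
import Data.List.Properties as LP
open import Data.Vec using (Vec; []; _∷_; lookup; tabulate; removeAt)
import Data.Vec.Properties as VP
import Data.Bool.Properties as BP
open import Data.Product using (Σ; _×_; _,_; proj₁; proj₂; ∃)
open import Data.Unit using (⊤)
open import Relation.Nullary using (¬_)
open import Relation.Nullary.Decidable using (⌊_⌋)
open import Relation.Binary.PropositionalEquality using (_≡_)
open import Data.Fin.Permutation using (Permutation′; _⟨$⟩ʳ_; _⟨$⟩ˡ_)
open import Algebra.Bundles using (CommutativeRing)
import Data.List.Sort.InsertionSort.Base ≤-decTotalOrder as Sort

record IsField {a ℓ} (K : CommutativeRing a ℓ) : Set (a ⊔ ℓ) where
  open CommutativeRing K
  field
    0≉1     : ¬ (0# ≈ 1#)
    inverse : ∀ x → ¬ (x ≈ 0#) → Σ Carrier λ y → (x * y) ≈ 1#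

allVec : ∀ {A : Set} → List A → (m : ℕ) → List (Vec A m)
allVec xs zero    = [] ∷ []
allVec xs (suc m) = concatMap (λ x → map (x ∷_) (allVec xs m)) xs

all : ∀ {A : Set} → (A → Bool) → List A → Bool
all p = foldr (λ x b → p x ∧ b) true

any : ∀ {A : Set} → (A → Bool) → List A → Bool
any p = foldr (λ x b → p x ∨ b) false

allB : ∀ {m} → (Fin m → Bool) → Bool
allB {m} p = all p (allFin m)

anyB : ∀ {m} → (Fin m → Bool) → Bool
anyB {m} p = any p (allFin m)

countB : ∀ {m} → (Fin m → Bool) → ℕ
countB {m} p = length (filterᵇ p (allFin m))

_⇒ᵇ_ : Bool → Bool → Bool
x ⇒ᵇ y = not x ∨ y

finEqᵇ : ∀ {m} → Fin m → Fin m → Bool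
finEqᵇ i j = toℕ i ≡ᵇ toℕ j

listℕEqᵇ : List ℕ → List ℕ → Bool
listℕEqᵇ xs ys = ⌊ LP.≡-dec ℕ._≟_ xs ys ⌋

nthD : ∀ {A : Set} → A → List A → ℕ → A
nthD d []       _       = d
nthD d (x ∷ xs) zero    = x
nthD d (x ∷ xs) (suc i) = nthD d xs i

sortℕ : List ℕ → List ℕ
sortℕ = Sort.sort

-- Pointed set partitions of [n].
-- A pointed set partition {B₁,…,B_k, Z} of [n] is encoded as an
-- equivalence relation on Fin (suc n) = {∗} ⊎ [n]: the element
-- fzero plays the role of an extra point ∗, element fsuc i is i ∈ [n];
-- the block of ∗ (minus ∗) is the pointed block Z, the other blocks
-- are B₁,…,B_k.  Relations are stored as Boolean matrices (canonical data).

Rel : ℕ → Set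
Rel m = Vec (Vec Bool m) m

rel : ∀ {m} → Rel m → Fin m → Fin m → Bool
rel E i j = lookup (lookup E i) j

isEquivRel : ∀ {m} → Rel m → Bool
isEquivRel E =
  allB (λ i → rel E i i) ∧
  allB (λ i → allB (λ j → rel E i j ⇒ᵇ rel E j i)) ∧
  allB (λ i → allB (λ j → allB (λ l → (rel E i j ∧ rel E j l) ⇒ᵇ rel E i l)))

relEqᵇ : ∀ {m} → Rel m → Rel m → Bool
relEqᵇ E F = ⌊ VP.≡-dec (VP.≡-dec BP._≟_) E F ⌋

_≤ᵣ_ : ∀ {m} → Rel m → Rel m → Bool
E ≤ᵣ F = allB (λ i → allB (λ j → rel E i j ⇒ᵇ rel F i j))

_<ᵣ_ : ∀ {m} → Rel m → Rel m → Bool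
E <ᵣ F = (E ≤ᵣ F) ∧ not (F ≤ᵣ E)

isTop : ∀ {m} → Rel m → Bool
isTop E = allB (λ i → allB (λ j → rel E i j))

blockSize : ∀ {m} → Rel m → Fin m → ℕ
blockSize E i = countB (λ j → rel E i j)

isRep : ∀ {m} → Rel m → Fin m → Bool
isRep E i = allB (λ j → rel E j i ⇒ᵇ not (toℕ j <ᵇ toℕ i))

ptype : ∀ {n} → Rel (suc n) → List ℕ × ℕ
ptype E =
  sortℕ (map (blockSize E)
     (filterᵇ (λ i → isRep E i ∧ not (rel E fzero i)) (allFin _)))
  , blockSize E fzero ∸ 1

ctype′ : List ℕ → List ℕ × ℕ
ctype′ []           = [] , 0
ctype′ (x ∷ [])     = [] , x
ctype′ (x ∷ y ∷ ds) = (x ∷ proj₁ (ctype′ (y ∷ ds))) , proj₂ (ctype′ (y ∷ ds))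

ctype : List ℕ → List ℕ × ℕ
ctype d = sortℕ (proj₁ (ctype′ d)) , proj₂ (ctype′ d)

coarsenings : List ℕ → List (List ℕ)
coarsenings []           = [] ∷ []
coarsenings (x ∷ [])     = (x ∷ []) ∷ []
coarsenings (x ∷ y ∷ cs) =
  concatMap (λ d → (x ∷ d) ∷ mergeHead x d ∷ []) (coarsenings (y ∷ cs))
  where
  mergeHead : ℕ → List ℕ → List ℕ
  mergeHead x []       = x ∷ []
  mergeHead x (z ∷ zs) = (x ℕ.+ z) ∷ zs

typeEqᵇ : List ℕ × ℕ → List ℕ × ℕ → Bool
typeEqᵇ (l , p) (l′ , p′) = listℕEqᵇ l l′ ∧ (p ≡ᵇ p′)

inΠc : ∀ {n} → List ℕ → Rel (suc n) → Bool
inΠc c E = any (λ d → typeEqᵇ (ptype E) (ctype d)) (coarsenings c)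

elemsΠc- : (n : ℕ) → List ℕ → List (Rel (suc n))
elemsΠc- n c =
  filterᵇ (λ E → isEquivRel E ∧ inΠc c E ∧ not (isTop E))
          (allVec (allVec (true ∷ false ∷ []) (suc n)) (suc n))

-- Order complex Δ(Π•_c − {1̂}).  A simplex with r vertices is a strictly
-- increasing chain x₁ < … < x_r; r = 0 is the empty simplex (reduced
-- homology), so homological degree = r − 1.

isChain : ∀ {m r} → Vec (Rel m) r → Bool
isChain []           = true
isChain (x ∷ [])     = true
isChain (x ∷ y ∷ xs) = (x <ᵣ y) ∧ isChain (y ∷ xs)

simplices : (n : ℕ) → List ℕ → (r : ℕ) → List (Vec (Rel (suc n)) r)
simplices n c r = filterᵇ isChain (allVec (elemsΠc- n c) r)

chainEqᵇ : ∀ {m r} → Vec (Rel m) r → Vec (Rel m) r → Bool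
chainEqᵇ {r = r} σ τ = allB {r} (λ p → relEqᵇ (lookup σ p) (lookup τ p))

liftPerm : ∀ {n} → Permutation′ n → Fin (suc n) → Fin (suc n)
liftPerm g fzero    = fzero
liftPerm g (fsuc i) = fsuc (g ⟨$⟩ʳ i)

liftPermInv : ∀ {n} → Permutation′ n → Fin (suc n) → Fin (suc n)
liftPermInv g fzero    = fzero
liftPermInv g (fsuc i) = fsuc (g ⟨$⟩ˡ i)

actRel : ∀ {n} → Permutation′ n → Rel (suc n) → Rel (suc n)
actRel g E = tabulate λ i → tabulate λ j → rel E (liftPermInv g i) (liftPermInv g j)

actChain : ∀ {n r} → Permutation′ n → Vec (Rel (suc n)) r → Vec (Rel (suc n)) r
actChain g = Data.Vec.map (actRel g)

-- Border strip B of c, tableaux, tabloids.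
-- Rows are numbered 0,…,k−1 from the bottom, row i has cᵢ boxes, and
-- row i+1 starts in the column where row i ends (so consecutive rows
-- share exactly one column: a connected skew shape with no 2×2 square).
-- Boxes are numbered 0,…,n−1 row by row starting with the bottom row;
-- box b has coordinates (row , column) = boxCoord c b.

boxList : List ℕ → List (ℕ × ℕ)
boxList c = go 0 0 c
  where
  go : ℕ → ℕ → List ℕ → List (ℕ × ℕ)
  go row start []       = []
  go row start (x ∷ xs) =
    map (λ p → row , start ℕ.+ p) (upTo x) ++ go (suc row) (start ℕ.+ x ∸ 1) xs
    where open Data.List using (_++_)

boxCoord : ∀ {n} → List ℕ → Fin n → ℕ × ℕ
boxCoord c b = nthD (0 , 0) (boxList c) (toℕ b)

boxRow boxCol : ∀ {n} → List ℕ → Fin n → ℕ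
boxRow c b = proj₁ (boxCoord c b)
boxCol c b = proj₂ (boxCoord c b)

-- A tabloid of shape B is recorded by the function sending each entry
-- e ∈ [n] to the row containing it; row i must contain cᵢ entries.
Tabloid : ℕ → Set
Tabloid n = Vec ℕ n

isTabloid : ∀ {n} → List ℕ → Tabloid n → Bool
isTabloid {n} c T =
  all (λ i → countB {n} (λ e → lookup T e ≡ᵇ i) ≡ᵇ nthD 0 c i) (upTo (length c))

tabloids : (n : ℕ) → List ℕ → List (Tabloid n)
tabloids n c = filterᵇ (isTabloid c) (allVec (upTo (length c)) n)

tabloidEqᵇ : ∀ {n} → Tabloid n → Tabloid n → Bool
tabloidEqᵇ {n} T U = allB {n} (λ e → lookup T e ≡ᵇ lookup U e)

-- A tableau of shape B is a bijection t : boxes → [n]  (box b ↦ entry t b).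
-- Its tabloid {t}: entry e lies in the row of box t⁻¹ e.
tabloidOf : ∀ {n} → List ℕ → Permutation′ n → Tabloid n
tabloidOf c t = tabulate λ e → boxRow c (t ⟨$⟩ˡ e)

actTabloid : ∀ {n} → Permutation′ n → Tabloid n → Tabloid n
actTabloid g T = tabulate λ e → lookup T (g ⟨$⟩ˡ e)

-- permutations of [n] as explicit data (for finite sums over subgroups)
isPermVec : ∀ {n} → Vec (Fin n) n → Bool
isPermVec {n} γ = allB {n} (λ i → allB {n} (λ j → finEqᵇ (lookup γ i) (lookup γ j) ⇒ᵇ finEqᵇ i j))

permVecs : (n : ℕ) → List (Vec (Fin n) n)
permVecs n = filterᵇ isPermVec (allVec (allFin n) n)

inversions : ∀ {n} → Vec (Fin n) n → ℕ
inversions {n} γ =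
  length (filterᵇ (λ ij → (toℕ (proj₁ ij) <ᵇ toℕ (proj₂ ij)) ∧
                           (toℕ (lookup γ (proj₂ ij)) <ᵇ toℕ (lookup γ (proj₁ ij))))
                  (concatMap (λ i → map (i ,_) (allFin n)) (allFin n)))

isEvenᵇ : ℕ → Bool
isEvenᵇ zero          = true
isEvenᵇ (suc zero)    = false
isEvenᵇ (suc (suc k)) = isEvenᵇ k

inColStab : ∀ {n} → List ℕ → Permutation′ n → Vec (Fin n) n → Bool
inColStab {n} c t γ =
  allB {n} (λ e → boxCol c (t ⟨$⟩ˡ lookup γ e) ≡ᵇ boxCol c (t ⟨$⟩ˡ e))

isImageTabloid : ∀ {n} → Vec (Fin n) n → Tabloid n → Tabloid n → Bool
isImageTabloid {n} γ T U = allB {n} (λ e → lookup U (lookup γ e) ≡ᵇ lookup T e)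

module Hom {a ℓ} (K : CommutativeRing a ℓ) (n : ℕ) (c : List ℕ) where
  open CommutativeRing K

  sumL : ∀ {b} {A : Set b} → List A → (A → Carrier) → Carrier
  sumL xs f = foldr (λ x s → f x + s) 0# xs

  sumFin : ∀ {m} → (Fin m → Carrier) → Carrier
  sumFin {m} f = sumL (allFin m) f

  [_]ᵇ : Bool → Carrier
  [ b ]ᵇ = if b then 1# else 0#

  sgnℕ : ℕ → Carrier
  sgnℕ k = if isEvenᵇ k then 1# else - 1#

  Free : ∀ {A : Set} → List A → Set a
  Free L = Fin (length L) → Carrier

  EqF : ∀ {A : Set} (L : List A) → Free L → Free L → Set ℓ
  EqF L x y = ∀ i → x i ≈ y i

  -- chain group C_{r-1} of Δ(Π•_c − {1̂}) (simplices with r vertices)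
  Chains : ℕ → Set a
  Chains r = Free (simplices n c r)

  EqC : ∀ r → Chains r → Chains r → Set ℓ
  EqC r = EqF (simplices n c r)

  simplex : ∀ r → Fin (length (simplices n c r)) → Vec (Rel (suc n)) r
  simplex r = Data.List.lookup (simplices n c r)

  incidence : ∀ {r} → Vec (Rel (suc n)) (suc r) → Vec (Rel (suc n)) r → Carrier
  incidence {r} σ τ = sumFin {suc r} (λ p → sgnℕ (toℕ p) * [ chainEqᵇ (removeAt σ p) τ ]ᵇ)

  ∂ : ∀ r → Chains (suc r) → Chains r
  ∂ r x j = sumFin (λ i → x i * incidence (simplex (suc r) i) (simplex r j))

  -- cycles and boundaries in C_{r-1} (reduced: C_{-2} = 0)
  IsCycle : ∀ r → Chains r → Set ℓ
  IsCycle zero    x = Level.Lift ℓ ⊤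
  IsCycle (suc r) x = ∀ j → ∂ r x j ≈ 0#

  IsBoundary : ∀ r → Chains r → Set (a ⊔ ℓ)
  IsBoundary r x = Σ (Chains (suc r)) λ y → EqC r (∂ r y) x

  actC : ∀ r → Permutation′ n → Chains r → Chains r
  actC r g x j = sumFin (λ i → x i * [ chainEqᵇ (actChain g (simplex r i)) (simplex r j) ]ᵇ)

  Mᴮ : Set a
  Mᴮ = Free (tabloids n c)

  EqM : Mᴮ → Mᴮ → Set ℓ
  EqM = EqF (tabloids n c)

  tabloid : Fin (length (tabloids n c)) → Tabloid n
  tabloid = Data.List.lookup (tabloids n c)

  actM : Permutation′ n → Mᴮ → Mᴮ
  actM g y j = sumFin (λ i → y i * [ tabloidEqᵇ (actTabloid g (tabloid i)) (tabloid j) ]ᵇ)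

  polytabloid : Permutation′ n → Mᴮ
  polytabloid t j =
    sumL (filterᵇ (inColStab c t) (permVecs n)) λ γ →
      sgnℕ (inversions γ) * [ isImageTabloid γ (tabloidOf c t) (tabloid j) ]ᵇ

  InSpecht : Mᴮ → Set (a ⊔ ℓ)
  InSpecht y = Σ (List (Carrier × Permutation′ n)) λ ts →
    ∀ j → y j ≈ sumL ts (λ at → proj₁ at * polytabloid (proj₂ at) j)

  -- An isomorphism of 𝔖ₙ-modules  H̃_{r-1} = Z_{r-1}/B_{r-1} ≅ S^B, given by a
  -- K-linear, 𝔖ₙ-equivariant map f on the chains whose restriction to the
  -- cycles maps onto S^B with kernel exactly the boundaries.
  record TopHomologyIsoSpecht (r : ℕ) : Set (a ⊔ ℓ) where
    field
      f          : Chains r → Mᴮ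
      f-cong     : ∀ x y → EqC r x y → EqM (f x) (f y)
      f-+        : ∀ x y → EqM (f (λ i → x i + y i)) (λ j → f x j + f y j)
      f-*        : ∀ s x → EqM (f (λ i → s * x i)) (λ j → s * f x j)
      f-equivar  : ∀ g x → IsCycle r x → EqM (f (actC r g x)) (actM g (f x))
      f-into     : ∀ x → IsCycle r x → InSpecht (f x)
      f-onto     : ∀ y → InSpecht y → Σ (Chains r) λ x → IsCycle r x × EqM (f x) y
      f-kernel   : ∀ x → IsCycle r x → EqM (f x) (λ _ → 0#) → IsBoundary r x
      f-boundary : ∀ x → IsBoundary r x → EqM (f x) (λ _ → 0#)

{-# OPTIONS --safe #-}
-- The map π ↦ [n] ∖ Z(π), Z(π) being the pointed block, is order-reversing from
-- Π•_c − {1̂} to the Boolean lattice rank-selected at the proper partial sums of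
-- c, whose maximal chains are the tabloids of shape B.  Let f be the induced map
-- from the top chains of Δ(Π•_c − {1̂}) to M^B.
--
-- On cycles f is injective: a maximal chain whose pointed block grows at every
-- step is determined by its image; on any other chain, the cycle condition at
-- the last stall of the pointed block expresses the coefficient through those of
-- chains with larger pointed blocks.  Barycentric subdivision followed by
-- forgetting the order of the blocks is a right inverse of f on cycles.  Hence
-- f identifies the top homology with the top cycles of the rank-selected
-- Boolean lattice, i.e. with the elements of M^B that die when any two adjacent
-- rows are merged (there are no boundaries in the top degree).
--
-- These elements are exactly S^B.  Each e_t is one of them, because adjacent rows
-- share a column, whose two entries in these rows may be exchanged.  Conversely,
-- compare tabloids at the largest entry in which they differ: the smallest
-- tabloid occurring in such an element has a descent between any two adjacent
-- rows, and then it is the smallest tabloid of e_t for the tableau t with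
-- increasing rows, which can be subtracted.
module Submission where

open import Defs
open import Data.Nat using (ℕ; _<_; _∸_)
open import Data.List using (List; []; length)
open import Data.Nat.ListAction using (sum)
open import Data.List.Relation.Unary.All using (All)
open import Algebra.Bundles using (CommutativeRing)
open import Relation.Binary.PropositionalEquality using (_≡_; _≢_)

open import Data.Nat using (zero; suc; _≤_; _^_; z≤n; s≤s; s≤s⁻¹; _≡ᵇ_; _<ᵇ_; _≟_; _≤?_; _<?_) renaming (_+_ to _+ℕ_; _*_ to _*ℕ_)
import Data.Nat.Properties as ℕₚ
open import Data.Bool using (Bool; true; false; _∧_; not; _xor_; if_then_else_)
import Data.Bool.Properties as Boolₚ
open import Data.Fin using (Fin; toℕ; fromℕ; fromℕ<; inject₁; punchIn; punchOut) renaming (zero to fzero; suc to fsuc; _≟_ to _≟ᶠ_)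
import Data.Fin.Properties as Finₚ
open import Data.Fin.Permutation using (Permutation′; _⟨$⟩ʳ_; _⟨$⟩ˡ_; inverseʳ; inverseˡ; permutation; flip)
open import Data.List using (_∷_; _++_; map; concatMap; filterᵇ; allFin; upTo; applyUpTo; tabulate; foldr) renaming (lookup to lookupL)
open import Data.List.Properties using (map-upTo; length-map; length-applyUpTo)
open import Data.List.Membership.Propositional using (_∈_)
import Data.List.Membership.Propositional.Properties as ∈ₚ
open import Data.List.Relation.Unary.Any using (index)
import Data.List.Relation.Unary.Any.Properties as Anyₚ
open import Data.List.Relation.Unary.Unique.Propositional using (Unique)
import Data.List.Relation.Unary.Unique.Propositional.Properties as Uniqueₚ
open import Data.Vec using (Vec; []; _∷_; lookup; removeAt)
import Data.Vec as Vec
import Data.Vec.Properties as Vecₚ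
open import Data.Product using (∃; ∃₂; _×_; _,_; proj₁; proj₂)
open import Data.Sum using (_⊎_; inj₁; inj₂; [_,_]′; map₂)
open import Data.Empty using (⊥; ⊥-elim)
open import Function using (_∘_; id)
open import Relation.Binary using (DecidableEquality; tri<; tri≈; tri>)
open import Relation.Nullary using (¬_; Dec; yes; no; contradiction)
open import Relation.Nullary.Decidable using (_×-dec_)
open import Relation.Binary.PropositionalEquality as ≡ using (cong; cong₂; subst; subst₂; module ≡-Reasoning)
import Algebra.Properties.CommutativeMonoid.Sum as CMSum
import Algebra.Properties.Semiring.Sum as SSum

-- No homotopy equivalence between the two order complexes is built: injectivity of `f` on cycles
-- and a right inverse that takes values in cycles suffice, and equivariance is then needed for `f`
-- alone. The induction behind injectivity runs on the sum of the sizes of the pointed blocks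
-- (`total`). It works because a chain of top dimension has the forced ranks `r, ..., 1`, so that
-- two such chains can share a face only by omitting the same position. Linear identities are mostly
-- proved by transposition: an element is paired with an arbitrary function on simplices or
-- tabloids, and the operator is moved to the other side by `sum-exchange`. Boundaries then become
-- coboundaries `δ`, subdivision becomes the functional `sd`, and bases of the merged shapes never
-- have to be listed. Positivity of all parts, the last one included, enters as nonemptiness of
-- every row. A chain whose pointed block stalls leaves a row empty and so gives no tabloid of shape
-- `B`; the entries of two adjacent rows in the shared column exist; and merging two rows is a
-- strict step in the poset.

module Combinatorics where

  open import Data.Nat using (_+_; _*_)
  open import Data.Nat.Induction using (<-wellFounded)
  open import Induction.WellFounded using (Acc; acc)
  open import Data.Bool using (T)
  open import Data.List using (cartesianProductWith; drop)
  open import Data.List.Membership.Propositional using (find)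
  open import Data.List.Membership.Propositional.Properties.WithK using (unique∧set⇒bag)
  open import Data.List.Relation.Binary.BagAndSetEquality using (∼bag⇒↭)
  open import Data.List.Relation.Binary.Permutation.Propositional using (_↭_; ↭-sym; ↭-trans; ↭⇒↭ₛ)
  import Data.List.Relation.Binary.Permutation.Propositional.Properties as ↭ₚ
  open import Data.List.Relation.Binary.Pointwise using (Pointwise-≡⇒≡)
  open import Data.List.Relation.Unary.All using ([]; _∷_)
  import Data.List.Relation.Unary.All as AllL
  open import Data.List.Relation.Unary.AllPairs using ([]; _∷_)
  open import Data.List.Relation.Unary.Any using (here; there)
  import Data.List.Relation.Unary.Any as Any
  import Data.List.Relation.Unary.Sorted.TotalOrder.Properties as Sortedₚ
  import Data.List.Sort.InsertionSort.Properties ℕₚ.≤-decTotalOrder as Sortₚ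
  open import Function using (mk⇔)
  open import Function.Bundles using (Equivalence)
  open import Relation.Nullary.Decidable using (T?; ⌊_⌋; does)
  open import Relation.Binary.PropositionalEquality using (refl; sym; trans)

  -- Boolean tests, counting, and enumeration of lists and vectors

  module Σℕ = CMSum ℕₚ.+-0-commutativeMonoid

  ∧-true⁻ : ∀ x {y} → x ∧ y ≡ true → x ≡ true × y ≡ true
  ∧-true⁻ true p = refl , p

  ∧-true⁺ : ∀ {x y} → x ≡ true → y ≡ true → x ∧ y ≡ true
  ∧-true⁺ refl p = p

  ⇒ᵇ⁻ : ∀ x {y} → x ⇒ᵇ y ≡ true → x ≡ true → y ≡ true
  ⇒ᵇ⁻ .true p refl = p

  ⇒ᵇ⁺ : ∀ x {y} → (x ≡ true → y ≡ true) → x ⇒ᵇ y ≡ true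
  ⇒ᵇ⁺ true  f = f refl
  ⇒ᵇ⁺ false f = refl

  true≢false : ∀ {x} → x ≡ true → x ≡ false → ⊥
  true≢false refl ()

  not-true⁻ : ∀ {x} → not x ≡ true → x ≡ false
  not-true⁻ {false} _ = refl

  not-true⁺ : ∀ {x} → x ≡ false → not x ≡ true
  not-true⁺ refl = refl

  ≢true⇒false : ∀ {x} → ¬ (x ≡ true) → x ≡ false
  ≢true⇒false = Boolₚ.¬-not

  bool-ext : ∀ {x y} → (x ≡ true → y ≡ true) → (y ≡ true → x ≡ true) → x ≡ y
  bool-ext {true}  {y}     f g = sym (f refl)
  bool-ext {false} {true}  f g = g refl
  bool-ext {false} {false} f g = refl

  bool-cases : ∀ {a} {C : Set a} b → (b ≡ true → C) → (b ≡ false → C) → C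
  bool-cases true  t f = t refl
  bool-cases false t f = f refl

  T⇒true : ∀ {x} → T x → x ≡ true
  T⇒true = Equivalence.to Boolₚ.T-≡

  true⇒T : ∀ {x} → x ≡ true → T x
  true⇒T = Equivalence.from Boolₚ.T-≡

  ≡ᵇ-true⁻ : ∀ {m n} → (m ≡ᵇ n) ≡ true → m ≡ n
  ≡ᵇ-true⁻ = ℕₚ.≡ᵇ⇒≡ _ _ ∘ true⇒T

  ≡ᵇ-true⁺ : ∀ {m n} → m ≡ n → (m ≡ᵇ n) ≡ true
  ≡ᵇ-true⁺ = T⇒true ∘ ℕₚ.≡⇒≡ᵇ _ _

  ≡ᵇ-false⁺ : ∀ {m n} → m ≢ n → (m ≡ᵇ n) ≡ false
  ≡ᵇ-false⁺ m≢n = ≢true⇒false (m≢n ∘ ≡ᵇ-true⁻)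

  <ᵇ-true⁻ : ∀ {m n} → (m <ᵇ n) ≡ true → m < n
  <ᵇ-true⁻ = ℕₚ.<ᵇ⇒< _ _ ∘ true⇒T

  <ᵇ-true⁺ : ∀ {m n} → m < n → (m <ᵇ n) ≡ true
  <ᵇ-true⁺ = T⇒true ∘ ℕₚ.<⇒<ᵇ

  <ᵇ-false⁻ : ∀ {m n} → (m <ᵇ n) ≡ false → n ≤ m
  <ᵇ-false⁻ p = ℕₚ.≮⇒≥ λ m<n → true≢false (<ᵇ-true⁺ m<n) p

  <ᵇ-false⁺ : ∀ {m n} → n ≤ m → (m <ᵇ n) ≡ false
  <ᵇ-false⁺ n≤m = ≢true⇒false λ p → ℕₚ.<⇒≱ (<ᵇ-true⁻ p) n≤m

  all⁻ : ∀ {A : Set} (p : A → Bool) xs → all p xs ≡ true → ∀ {x} → x ∈ xs → p x ≡ true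
  all⁻ p (x ∷ xs) h (here refl) = proj₁ (∧-true⁻ (p x) h)
  all⁻ p (x ∷ xs) h (there x∈)  = all⁻ p xs (proj₂ (∧-true⁻ (p x) h)) x∈

  all⁺ : ∀ {A : Set} (p : A → Bool) xs → (∀ {x} → x ∈ xs → p x ≡ true) → all p xs ≡ true
  all⁺ p []       h = refl
  all⁺ p (x ∷ xs) h = ∧-true⁺ (h (here refl)) (all⁺ p xs (h ∘ there))

  all-false⁻ : ∀ {A : Set} (p : A → Bool) xs → all p xs ≡ false → ∃ λ x → p x ≡ false
  all-false⁻ p (x ∷ xs) h with p x in eq
  ... | true  = all-false⁻ p xs h
  ... | false = x , eq

  any⁻ : ∀ {A : Set} (p : A → Bool) xs → any p xs ≡ true → ∃ λ x → x ∈ xs × p x ≡ true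
  any⁻ p (x ∷ xs) h with p x in eq
  ... | true = x , here refl , eq
  ... | false with y , y∈ , py ← any⁻ p xs h = y , there y∈ , py

  any⁺ : ∀ {A : Set} (p : A → Bool) xs {x} → x ∈ xs → p x ≡ true → any p xs ≡ true
  any⁺ p (x ∷ xs) (here refl) px rewrite px = refl
  any⁺ p (x ∷ xs) (there x∈) px with p x
  ... | true  = refl
  ... | false = any⁺ p xs x∈ px

  allB⁻ : ∀ {m} (p : Fin m → Bool) → allB p ≡ true → ∀ i → p i ≡ true
  allB⁻ p h i = all⁻ p (allFin _) h (∈ₚ.∈-allFin i)

  allB⁺ : ∀ {m} (p : Fin m → Bool) → (∀ i → p i ≡ true) → allB p ≡ true
  allB⁺ p h = all⁺ p (allFin _) λ {x} _ → h x

  allB-false⁻ : ∀ {m} (p : Fin m → Bool) → allB p ≡ false → ∃ λ i → p i ≡ false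
  allB-false⁻ p = all-false⁻ p (allFin _)

  b2n : Bool → ℕ
  b2n true  = 1
  b2n false = 0

  count : ∀ {m} → (Fin m → Bool) → ℕ
  count {zero}  p = 0
  count {suc m} p = b2n (p fzero) + count (p ∘ fsuc)

  count≡sum : ∀ {m} (p : Fin m → Bool) → count p ≡ Σℕ.sum (λ i → b2n (p i))
  count≡sum {zero}  p = refl
  count≡sum {suc m} p = cong (b2n (p fzero) +_) (count≡sum (p ∘ fsuc))

  length-filterᵇ-tabulate : ∀ {A : Set} {m} (p : A → Bool) (g : Fin m → A) →
    length (filterᵇ p (tabulate g)) ≡ count (p ∘ g)
  length-filterᵇ-tabulate {m = zero}  p g = refl
  length-filterᵇ-tabulate {m = suc m} p g with p (g fzero)
  ... | true  = cong suc (length-filterᵇ-tabulate p (g ∘ fsuc))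
  ... | false = length-filterᵇ-tabulate p (g ∘ fsuc)

  countB≡count : ∀ {m} (p : Fin m → Bool) → countB p ≡ count p
  countB≡count p = length-filterᵇ-tabulate p (λ i → i)

  count-cong : ∀ {m} {p q : Fin m → Bool} → (∀ i → p i ≡ q i) → count p ≡ count q
  count-cong {zero}  h = refl
  count-cong {suc m} h = cong₂ _+_ (cong b2n (h fzero)) (count-cong (h ∘ fsuc))

  b2n-mono : ∀ {x y} → (x ≡ true → y ≡ true) → b2n x ≤ b2n y
  b2n-mono {true}  {y} h rewrite h refl = ℕₚ.≤-refl
  b2n-mono {false} {y} h = z≤n

  count-mono : ∀ {m} {p q : Fin m → Bool} → (∀ i → p i ≡ true → q i ≡ true) → count p ≤ count q
  count-mono {zero}  h = z≤n
  count-mono {suc m} h = ℕₚ.+-mono-≤ (b2n-mono (h fzero)) (count-mono (h ∘ fsuc))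

  count-strict : ∀ {m} {p q : Fin m → Bool} → (∀ i → p i ≡ true → q i ≡ true) →
    ∀ i → p i ≡ false → q i ≡ true → count p < count q
  count-strict h fzero pi qi rewrite pi | qi = s≤s (count-mono (h ∘ fsuc))
  count-strict h (fsuc i) pi qi = ℕₚ.+-mono-≤-< (b2n-mono (h fzero)) (count-strict (h ∘ fsuc) i pi qi)

  count-⊆-≥ : ∀ {m} {p q : Fin m → Bool} → (∀ i → p i ≡ true → q i ≡ true) →
    count q ≤ count p → ∀ i → q i ≡ true → p i ≡ true
  count-⊆-≥ {p = p} h c i qi with p i in eq
  ... | true  = refl
  ... | false = contradiction c (ℕₚ.<⇒≱ (count-strict h i eq qi))

  count-permute : ∀ {m} (p : Fin m → Bool) (π : Permutation′ m) → count p ≡ count (λ i → p (π ⟨$⟩ʳ i))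
  count-permute p π = trans (count≡sum p)
    (trans (Σℕ.sum-permute (λ i → b2n (p i)) π) (sym (count≡sum (λ i → p (π ⟨$⟩ʳ i)))))

  count-all : ∀ {m} {p : Fin m → Bool} → (∀ i → p i ≡ true) → count p ≡ m
  count-all {zero}  h = refl
  count-all {suc m} h rewrite h fzero = cong suc (count-all (h ∘ fsuc))

  count-none : ∀ {m} {p : Fin m → Bool} → (∀ i → p i ≡ false) → count p ≡ 0
  count-none {zero}  h = refl
  count-none {suc m} h rewrite h fzero = count-none (h ∘ fsuc)

  count≤ : ∀ {m} (p : Fin m → Bool) → count p ≤ m
  count≤ {m} p = subst (count p ≤_) (count-all {m} {λ _ → true} (λ _ → refl)) (count-mono {m} (λ _ _ → refl))

  count-pos⁻ : ∀ {m} {p : Fin m → Bool} → 0 < count p → ∃ λ i → p i ≡ true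
  count-pos⁻ {suc m} {p} h with p fzero in eq
  ... | true  = fzero , eq
  ... | false with i , pi ← count-pos⁻ h = fsuc i , pi

  count-+ : ∀ {m} {p q s : Fin m → Bool} → (∀ i → b2n (s i) ≡ b2n (p i) + b2n (q i)) →
    count s ≡ count p + count q
  count-+ {p = p} {q} {s} h = begin
    count s                                              ≡⟨ count≡sum s ⟩
    Σℕ.sum (λ i → b2n (s i))                             ≡⟨ Σℕ.sum-cong-≗ h ⟩
    Σℕ.sum (λ i → b2n (p i) + b2n (q i))                 ≡⟨ Σℕ.∑-distrib-+ (λ i → b2n (p i)) (λ i → b2n (q i)) ⟩
    Σℕ.sum (λ i → b2n (p i)) + Σℕ.sum (λ i → b2n (q i))  ≡⟨ cong₂ _+_ (count≡sum p) (count≡sum q) ⟨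
    count p + count q                                    ∎
    where open ≡-Reasoning

  lookup-injective : ∀ {A : Set} {xs : List A} → Unique xs → ∀ i j → lookupL xs i ≡ lookupL xs j → i ≡ j
  lookup-injective (x∉ ∷ u) fzero    fzero    h = refl
  lookup-injective (x∉ ∷ u) fzero    (fsuc j) h = contradiction h (AllL.lookup x∉ (∈ₚ.∈-lookup j))
  lookup-injective (x∉ ∷ u) (fsuc i) fzero    h = contradiction (sym h) (AllL.lookup x∉ (∈ₚ.∈-lookup i))
  lookup-injective (x∉ ∷ u) (fsuc i) (fsuc j) h = cong fsuc (lookup-injective u i j h)

  ∈-filterᵇ⁺ : ∀ {A : Set} (p : A → Bool) {x xs} → x ∈ xs → p x ≡ true → x ∈ filterᵇ p xs
  ∈-filterᵇ⁺ p x∈ px = ∈ₚ.∈-filter⁺ (T? ∘ p) x∈ (true⇒T px)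

  ∈-filterᵇ⁻ : ∀ {A : Set} (p : A → Bool) {x xs} → x ∈ filterᵇ p xs → x ∈ xs × p x ≡ true
  ∈-filterᵇ⁻ p x∈ with x∈xs , px ← ∈ₚ.∈-filter⁻ (T? ∘ p) x∈ = x∈xs , T⇒true px

  filterᵇ-unique : ∀ {A : Set} (p : A → Bool) {xs} → Unique xs → Unique (filterᵇ p xs)
  filterᵇ-unique p = Uniqueₚ.filter⁺ (T? ∘ p)

  allVec-suc : ∀ {A : Set} (xs : List A) m → allVec xs (suc m) ≡ cartesianProductWith _∷_ xs (allVec xs m)
  allVec-suc {A} xs m = go xs
    where
    go : ∀ (zs : List A) →
      concatMap (λ x → map (x ∷_) (allVec xs m)) zs ≡ cartesianProductWith _∷_ zs (allVec xs m)
    go []       = refl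
    go (z ∷ zs) = cong (map (z ∷_) (allVec xs m) ++_) (go zs)

  ∈-allVec⁺ : ∀ {A : Set} {xs : List A} {m} (v : Vec A m) → (∀ i → Vec.lookup v i ∈ xs) → v ∈ allVec xs m
  ∈-allVec⁺ []      h = here refl
  ∈-allVec⁺ {xs = xs} {suc m} (x ∷ v) h rewrite allVec-suc xs m =
    ∈ₚ.∈-cartesianProductWith⁺ _∷_ (h fzero) (∈-allVec⁺ v (h ∘ fsuc))

  ∈-allVec⁻ : ∀ {A : Set} {xs : List A} {m} {v : Vec A m} → v ∈ allVec xs m → ∀ i → Vec.lookup v i ∈ xs
  ∈-allVec⁻ {xs = xs} {suc m} {x ∷ v} v∈ i
    rewrite allVec-suc xs m with ∈ₚ.∈-cartesianProductWith⁻ _∷_ xs (allVec xs m) v∈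
  ∈-allVec⁻ {xs = xs} {suc m} {x ∷ v} v∈ fzero    | a , b , a∈ , b∈ , refl = a∈
  ∈-allVec⁻ {xs = xs} {suc m} {x ∷ v} v∈ (fsuc i) | a , b , a∈ , b∈ , refl = ∈-allVec⁻ b∈ i

  allVec-unique : ∀ {A : Set} {xs : List A} → Unique xs → ∀ m → Unique (allVec xs m)
  allVec-unique u zero    = [] ∷ []
  allVec-unique {xs = xs} u (suc m) rewrite allVec-suc xs m =
    Uniqueₚ.cartesianProductWith⁺ _∷_ Vecₚ.∷-injective u (allVec-unique u m)

  lookup-ext : ∀ {A : Set} {m} {v w : Vec A m} → (∀ i → Vec.lookup v i ≡ Vec.lookup w i) → v ≡ w
  lookup-ext {v = v} {w} h =
    trans (sym (Vecₚ.tabulate∘lookup v)) (trans (Vecₚ.tabulate-cong h) (Vecₚ.tabulate∘lookup w))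

  -- Equivalence relations and their blocks

  infix 4 _≃[_]_

  record _≃[_]_ {m} (i : Fin m) (E : Rel m) (j : Fin m) : Set where
    constructor hold
    field holds : rel E i j ≡ true

  open _≃[_]_

  ≃-dec : ∀ {m} (E : Rel m) i j → Dec (i ≃[ E ] j)
  ≃-dec E i j with rel E i j in h
  ... | true  = yes (hold h)
  ... | false = no λ p → true≢false (holds p) h

  ≄⇒false : ∀ {m} {E : Rel m} {i j} → ¬ (i ≃[ E ] j) → rel E i j ≡ false
  ≄⇒false h = ≢true⇒false (h ∘ hold)

  record Equiv {m} (E : Rel m) : Set where
    field
      rfl : ∀ i → i ≃[ E ] i
      smm : ∀ {i j} → i ≃[ E ] j → j ≃[ E ] i
      trn : ∀ {i j l} → i ≃[ E ] j → j ≃[ E ] l → i ≃[ E ] l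

  isEquivRel⁻ : ∀ {m} (E : Rel m) → isEquivRel E ≡ true → Equiv E
  isEquivRel⁻ E h
    with h₁ , h₂₃ ← ∧-true⁻ (allB λ i → rel E i i) h
    with h₂ , h₃ ← ∧-true⁻ (allB λ i → allB λ j → rel E i j ⇒ᵇ rel E j i) h₂₃ = record
    { rfl = λ i → hold (allB⁻ (λ i → rel E i i) h₁ i)
    ; smm = λ {i} {j} p → hold (⇒ᵇ⁻ (rel E i j) (allB⁻ (λ j → rel E i j ⇒ᵇ rel E j i)
              (allB⁻ (λ i → allB λ j → rel E i j ⇒ᵇ rel E j i) h₂ i) j) (holds p))
    ; trn = λ {i} {j} {l} p q → hold (⇒ᵇ⁻ (rel E i j ∧ rel E j l)
              (allB⁻ (λ l → (rel E i j ∧ rel E j l) ⇒ᵇ rel E i l)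
              (allB⁻ (λ j → allB λ l → (rel E i j ∧ rel E j l) ⇒ᵇ rel E i l)
              (allB⁻ (λ i → allB λ j → allB λ l → (rel E i j ∧ rel E j l) ⇒ᵇ rel E i l) h₃ i) j) l)
              (∧-true⁺ (holds p) (holds q)))
    }

  isEquivRel⁺ : ∀ {m} {E : Rel m} → Equiv E → isEquivRel E ≡ true
  isEquivRel⁺ {E = E} eq = ∧-true⁺ (allB⁺ _ λ i → holds (rfl i))
    (∧-true⁺ (allB⁺ _ λ i → allB⁺ _ λ j → ⇒ᵇ⁺ (rel E i j) λ p → holds (smm (hold p)))
    (allB⁺ _ λ i → allB⁺ _ λ j → allB⁺ _ λ l → ⇒ᵇ⁺ (rel E i j ∧ rel E j l) λ h →
      let p , q = ∧-true⁻ (rel E i j) h in holds (trn (hold p) (hold q))))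
    where open Equiv eq

  rel-ext : ∀ {m} {E F : Rel m} → (∀ i j → rel E i j ≡ rel F i j) → E ≡ F
  rel-ext h = lookup-ext λ i → lookup-ext λ j → h i j

  tabRel : ∀ {m} → (Fin m → Fin m → Bool) → Rel m
  tabRel f = Vec.tabulate λ i → Vec.tabulate λ j → f i j

  rel-tabRel : ∀ {m} (f : Fin m → Fin m → Bool) i j → rel (tabRel f) i j ≡ f i j
  rel-tabRel f i j = trans (cong (λ v → Vec.lookup v j) (Vecₚ.lookup∘tabulate (λ i → Vec.tabulate (f i)) i))
    (Vecₚ.lookup∘tabulate (f i) j)

  infix 4 _⊑_ _⊏_

  _⊑_ : ∀ {m} → Rel m → Rel m → Set
  E ⊑ F = ∀ i j → i ≃[ E ] j → i ≃[ F ] j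

  ≤ᵣ⁻ : ∀ {m} (E F : Rel m) → E ≤ᵣ F ≡ true → E ⊑ F
  ≤ᵣ⁻ E F h i j p = hold (⇒ᵇ⁻ (rel E i j) (allB⁻ (λ j → rel E i j ⇒ᵇ rel F i j)
    (allB⁻ (λ i → allB λ j → rel E i j ⇒ᵇ rel F i j) h i) j) (holds p))

  ≤ᵣ⁺ : ∀ {m} {E F : Rel m} → E ⊑ F → E ≤ᵣ F ≡ true
  ≤ᵣ⁺ {E = E} h = allB⁺ _ λ i → allB⁺ _ λ j → ⇒ᵇ⁺ (rel E i j) λ p → holds (h i j (hold p))

  ⊑-antisym : ∀ {m} {E F : Rel m} → E ⊑ F → F ⊑ E → E ≡ F
  ⊑-antisym p q = rel-ext λ i j → bool-ext (λ h → holds (p i j (hold h))) (λ h → holds (q i j (hold h)))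

  ⊑-trans : ∀ {m} {E F G : Rel m} → E ⊑ F → F ⊑ G → E ⊑ G
  ⊑-trans p q i j = q i j ∘ p i j

  _⊏_ : ∀ {m} → Rel m → Rel m → Set
  E ⊏ F = (E ⊑ F) × ¬ (F ⊑ E)

  <ᵣ⁻ : ∀ {m} (E F : Rel m) → E <ᵣ F ≡ true → E ⊏ F
  <ᵣ⁻ E F h with p , q ← ∧-true⁻ (E ≤ᵣ F) h = ≤ᵣ⁻ E F p , λ r → true≢false (≤ᵣ⁺ r) (not-true⁻ q)

  <ᵣ⁺ : ∀ {m} {E F : Rel m} → E ⊏ F → E <ᵣ F ≡ true
  <ᵣ⁺ {E = E} {F} (p , q) = ∧-true⁺ (≤ᵣ⁺ p) (not-true⁺ (≢true⇒false (q ∘ ≤ᵣ⁻ F E)))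

  IsRep : ∀ {m} → Rel m → Fin m → Set
  IsRep E i = ∀ j → j ≃[ E ] i → toℕ i ≤ toℕ j

  isRep⁻ : ∀ {m} (E : Rel m) i → isRep E i ≡ true → IsRep E i
  isRep⁻ E i h j p = <ᵇ-false⁻ (not-true⁻ (⇒ᵇ⁻ (rel E j i)
    (allB⁻ (λ j → rel E j i ⇒ᵇ not (toℕ j <ᵇ toℕ i)) h j) (holds p)))

  isRep⁺ : ∀ {m} {E : Rel m} {i} → IsRep E i → isRep E i ≡ true
  isRep⁺ {E = E} {i} h = allB⁺ _ λ j → ⇒ᵇ⁺ (rel E j i) λ p → not-true⁺ (<ᵇ-false⁺ (h j (hold p)))

  reps-equal : ∀ {m} {E : Rel m} → Equiv E → ∀ {i j} → IsRep E i → IsRep E j → i ≃[ E ] j → i ≡ j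
  reps-equal eq p q ij = Finₚ.toℕ-injective (ℕₚ.≤-antisym (p _ (Equiv.smm eq ij)) (q _ ij))

  rep : ∀ {m} {E : Rel m} → Equiv E → ∀ i → ∃ λ r → IsRep E r × r ≃[ E ] i
  rep {E = E} eq i = go i (<-wellFounded (toℕ i))
    where
    open Equiv eq
    go : ∀ i → Acc _<_ (toℕ i) → ∃ λ r → IsRep E r × r ≃[ E ] i
    go i (acc below) with isRep E i in h
    ... | true = i , isRep⁻ E i h , rfl i
    ... | false with j , p ← allB-false⁻ (λ j → rel E j i ⇒ᵇ not (toℕ j <ᵇ toℕ i)) h
      with rel E j i in ji | toℕ j <ᵇ toℕ i in j<i
    ... | true | true with r , rr , rj ← go j (below (<ᵇ-true⁻ j<i)) = r , rr , trn rj (hold ji)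

  freeRep : ∀ {n} → Rel (suc n) → Fin (suc n) → Bool
  freeRep E i = isRep E i ∧ not (rel E fzero i)

  FreeRep : ∀ {n} → Rel (suc n) → Fin (suc n) → Set
  FreeRep E i = IsRep E i × ¬ (fzero ≃[ E ] i)

  freeRep⁻ : ∀ {n} (E : Rel (suc n)) i → freeRep E i ≡ true → FreeRep E i
  freeRep⁻ E i h with p , q ← ∧-true⁻ (isRep E i) h =
    isRep⁻ E i p , λ z → true≢false (holds z) (not-true⁻ q)

  freeRep⁺ : ∀ {n} {E : Rel (suc n)} {i} → FreeRep E i → freeRep E i ≡ true
  freeRep⁺ (p , q) = ∧-true⁺ (isRep⁺ p) (not-true⁺ (≄⇒false q))

  rank : ∀ {n} → Rel (suc n) → ℕ
  rank E = count (freeRep E)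

  freeRep-anti : ∀ {n} {E F : Rel (suc n)} → E ⊑ F → ∀ i → freeRep F i ≡ true → freeRep E i ≡ true
  freeRep-anti {E = E} {F} le i h with p , q ← freeRep⁻ F i h =
    freeRep⁺ ((λ j ji → p j (le j i ji)) , q ∘ le fzero i)

  -- The least element of a non-pointed block of `F` is also the least element of a non-pointed
  -- block of `E`. Equal ranks make the two sets of representatives coincide, so no block of `E` is
  -- merged with another or absorbed by the pointed one.
  ⊑-rank-reflects : ∀ {n} {E F : Rel (suc n)} → Equiv E → Equiv F → E ⊑ F → rank E ≤ rank F → F ⊑ E
  ⊑-rank-reflects {n} {E} {F} eqE eqF le rk i j ij = result
    where
    module E = Equiv eqE
    module F = Equiv eqF
    free : ∀ i → FreeRep E i → FreeRep F i
    free i h = freeRep⁻ F i (count-⊆-≥ (freeRep-anti le) rk i (freeRep⁺ h))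
    pointed : ∀ i → fzero ≃[ F ] i → fzero ≃[ E ] i
    pointed i z with r , rr , ri ← rep eqE i with ≃-dec E fzero i
    ... | yes p = p
    ... | no ¬p = ⊥-elim (proj₂ (free r (rr , λ p → ¬p (E.trn p ri))) (F.trn z (F.smm (le r i ri))))
    result : i ≃[ E ] j
    result with ≃-dec E fzero i
    ... | yes p = E.trn (E.smm p) (pointed j (F.trn (le _ _ p) ij))
    ... | no ¬p with r , rr , ri ← rep eqE i | s , ss , sj ← rep eqE j =
      E.trn (subst (i ≃[ E ]_) (reps-equal eqF
          (proj₁ (free r (rr , λ q → ¬p (E.trn q ri))))
          (proj₁ (free s (ss , λ q → ¬p (pointed i (F.trn (le _ _ (E.trn q sj)) (F.smm ij))))))
          (F.trn (le _ _ ri) (F.trn ij (F.smm (le _ _ sj)))))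
        (E.smm ri)) sj

  rank-strict : ∀ {n} {E F : Rel (suc n)} → Equiv E → Equiv F → E ⊏ F → rank F < rank E
  rank-strict eqE eqF (le , ¬ge) = ℕₚ.≰⇒> (¬ge ∘ ⊑-rank-reflects eqE eqF le)

  RelChain : ℕ → ℕ → Set
  RelChain n m = Vec (Rel (suc n)) m

  -- The pointed block and its size.
  Z : ∀ {n} → Rel (suc n) → Fin n → Bool
  Z E e = rel E fzero (fsuc e)

  zs : ∀ {n} → Rel (suc n) → ℕ
  zs E = count (Z E)

  Z-mono : ∀ {n} {E F : Rel (suc n)} → E ⊑ F → ∀ e → Z E e ≡ true → Z F e ≡ true
  Z-mono le e p = holds (le fzero (fsuc e) (hold p))

  zs-mono : ∀ {n} {E F : Rel (suc n)} → E ⊑ F → zs E ≤ zs F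
  zs-mono le = count-mono (Z-mono le)

  Z-ext : ∀ {n} {E F : Rel (suc n)} → E ⊑ F → zs F ≤ zs E → ∀ e → Z E e ≡ Z F e
  Z-ext le c e = bool-ext (Z-mono le e) (count-⊆-≥ (Z-mono le) c e)

  topRel : ∀ {m} → Rel m
  topRel = tabRel λ _ _ → true

  ≃-top : ∀ {m} (i j : Fin m) → i ≃[ topRel ] j
  ≃-top i j = hold (rel-tabRel (λ _ _ → true) i j)

  top-Equiv : ∀ {m} → Equiv (topRel {m})
  top-Equiv = record { rfl = λ i → ≃-top i i ; smm = λ _ → ≃-top _ _ ; trn = λ _ _ → ≃-top _ _ }

  rank-top : ∀ {n} → rank (topRel {suc n}) ≡ 0
  rank-top {n} = count-none {suc n} λ i → ≢true⇒false λ h → proj₂ (freeRep⁻ topRel i h) (≃-top fzero i)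

  zs-top : ∀ {n} → zs (topRel {suc n}) ≡ n
  zs-top {n} = count-all {n} λ e → holds (≃-top fzero (fsuc e))

  zs≡n⇒top : ∀ {n} {E : Rel (suc n)} → Equiv E → n ≤ zs E → topRel ⊑ E
  zs≡n⇒top {n} {E} eq h i j _ = trn (smm (z i)) (z j)
    where
    open Equiv eq
    z : ∀ i → fzero ≃[ E ] i
    z fzero = rfl fzero
    z (fsuc e) = hold (count-⊆-≥ {n} {Z E} {λ _ → true} (λ _ _ → refl)
      (subst (_≤ zs E) (sym (count-all {n} (λ _ → refl))) h) e refl)

  xnor-true⁻ : ∀ x y → not (x xor y) ≡ true → x ≡ y
  xnor-true⁻ true  true  _ = refl
  xnor-true⁻ false false _ = refl

  xnor-true⁺ : ∀ {x y} → x ≡ y → not (x xor y) ≡ true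
  xnor-true⁺ {true}  refl = refl
  xnor-true⁺ {false} refl = refl

  cut : ∀ {m} → (Fin m → Bool) → Rel m → Rel m
  cut z ρ = tabRel λ i j → rel ρ i j ∧ not (z i xor z j)

  cut⁻ : ∀ {m} (z : Fin m → Bool) (ρ : Rel m) {i j} → i ≃[ cut z ρ ] j → i ≃[ ρ ] j × z i ≡ z j
  cut⁻ z ρ {i} {j} h with p , q ← ∧-true⁻ (rel ρ i j)
      (trans (sym (rel-tabRel (λ i j → rel ρ i j ∧ not (z i xor z j)) i j)) (holds h)) =
    hold p , xnor-true⁻ (z i) (z j) q

  cut⁺ : ∀ {m} (z : Fin m → Bool) (ρ : Rel m) {i j} → i ≃[ ρ ] j → z i ≡ z j → i ≃[ cut z ρ ] j
  cut⁺ z ρ {i} {j} p q = hold (trans (rel-tabRel (λ i j → rel ρ i j ∧ not (z i xor z j)) i j)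
    (∧-true⁺ (holds p) (xnor-true⁺ q)))

  cut-Equiv : ∀ {m} (z : Fin m → Bool) {ρ : Rel m} → Equiv ρ → Equiv (cut z ρ)
  cut-Equiv z {ρ} eq = record
    { rfl = λ i → cut⁺ z ρ (rfl i) refl
    ; smm = λ h → let p , q = cut⁻ z ρ h in cut⁺ z ρ (smm p) (sym q)
    ; trn = λ h h′ → let p , q = cut⁻ z ρ h ; p′ , q′ = cut⁻ z ρ h′ in cut⁺ z ρ (trn p p′) (trans q q′)
    }
    where open Equiv eq

  -- If π ⊑ ρ has exactly one more block than ρ and ρ has the bigger pointed
  -- block, then π is ρ with its pointed block cut along the one of π.
  cover≡cut : ∀ {n} {π ρ : Rel (suc n)} → Equiv π → Equiv ρ → π ⊑ ρ → rank π ≤ suc (rank ρ) → zs π < zs ρ →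
    π ≡ cut (rel π fzero) ρ
  cover≡cut {n} {π} {ρ} eqπ eqρ π⊑ρ rk z< = ⊑-antisym π⊑cut
    (⊑-rank-reflects eqπ eqc π⊑cut (ℕₚ.≤-trans rk (rank-strict eqc eqρ cut⊏ρ)))
    where
    open Equiv eqπ
    z = rel π fzero
    eqc = cut-Equiv z eqρ
    π⊑cut : π ⊑ cut z ρ
    π⊑cut i j h = cut⁺ z ρ (π⊑ρ i j h)
      (bool-ext (λ p → holds (trn (hold p) h)) (λ p → holds (trn (hold p) (smm h))))
    cut⊏ρ : cut z ρ ⊏ ρ
    cut⊏ρ = (λ i j h → proj₁ (cut⁻ z ρ h)) , λ ρ⊑cut → ℕₚ.<⇒≱ z<
      (count-mono λ e h → trans (sym (proj₂ (cut⁻ z ρ (ρ⊑cut fzero (fsuc e) (hold h))))) (holds (rfl fzero)))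

  -- By `cover≡cut` both partitions are the cut of `ρ` along the same pointed block.
  cover-unique : ∀ {n} {π π′ ρ : Rel (suc n)} → Equiv π → Equiv π′ → Equiv ρ → π ⊑ ρ → π′ ⊑ ρ →
    rank π ≤ suc (rank ρ) → rank π′ ≤ suc (rank ρ) → (∀ e → Z π e ≡ Z π′ e) → zs π < zs ρ → π ≡ π′
  cover-unique {π = π} {π′} {ρ} eqπ eqπ′ eqρ le le′ rk rk′ zz z< = trans (cover≡cut eqπ eqρ le rk z<)
    (trans cut-cong (sym (cover≡cut eqπ′ eqρ le′ rk′ (subst (_< zs ρ) (count-cong zz) z<))))
    where
    same : ∀ i → rel π fzero i ≡ rel π′ fzero i
    same fzero    = trans (holds (Equiv.rfl eqπ fzero)) (sym (holds (Equiv.rfl eqπ′ fzero)))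
    same (fsuc e) = zz e
    cut-cong : cut (rel π fzero) ρ ≡ cut (rel π′ fzero) ρ
    cut-cong = Vecₚ.tabulate-cong λ i → Vecₚ.tabulate-cong λ j →
      cong₂ (λ x y → rel ρ i j ∧ not (x xor y)) (same i) (same j)

  sort-cong-↭ : ∀ {xs ys} → xs ↭ ys → sortℕ xs ≡ sortℕ ys
  sort-cong-↭ {xs} {ys} p = Pointwise-≡⇒≡ (Sortedₚ.↗↭↗⇒≋ ℕₚ.≤-totalOrder (Sortₚ.sort-↗ xs) (Sortₚ.sort-↗ ys)
    (↭⇒↭ₛ (↭-trans (Sortₚ.sort-↭ xs) (↭-trans p (↭-sym (Sortₚ.sort-↭ ys))))))

  length-sort : ∀ xs → length (sortℕ xs) ≡ length xs
  length-sort xs = ↭ₚ.↭-length (Sortₚ.sort-↭ xs)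

  freeReps : ∀ {n} → Rel (suc n) → List (Fin (suc n))
  freeReps E = filterᵇ (freeRep E) (allFin _)

  ptype-rank : ∀ {n} (E : Rel (suc n)) → length (proj₁ (ptype E)) ≡ rank E
  ptype-rank E = trans (length-sort (map (blockSize E) (freeReps E)))
    (trans (length-map (blockSize E) (freeReps E)) (countB≡count (freeRep E)))

  blockSize≡count : ∀ {m} (E : Rel m) i → blockSize E i ≡ count (rel E i)
  blockSize≡count E i = countB≡count (rel E i)

  ptype-zs : ∀ {n} {E : Rel (suc n)} → Equiv E → proj₂ (ptype E) ≡ zs E
  ptype-zs {E = E} eq = trans (cong (_∸ 1) (blockSize≡count E fzero))
    (cong (λ x → b2n x + zs E ∸ 1) (holds (Equiv.rfl eq fzero)))

  -- The block sizes may be read off any labelling κ of the non-pointed blocks.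
  freeReps-label : ∀ {n} {A : Set} (E : Rel (suc n)) (κ : Fin (suc n) → A) {L : List A} → Unique L →
    (∀ i j → FreeRep E i → FreeRep E j → κ i ≡ κ j → i ≡ j) →
    (∀ i → FreeRep E i → κ i ∈ L) →
    (∀ {a} → a ∈ L → ∃ λ i → FreeRep E i × κ i ≡ a) →
    map κ (freeReps E) ↭ L
  freeReps-label E κ {L} uL inj into onto = ∼bag⇒↭
    (unique∧set⇒bag (map-unique (freeReps E) fr (filterᵇ-unique (freeRep E) (Uniqueₚ.allFin⁺ _))) uL (mk⇔ to from))
    where
    fr : ∀ {i} → i ∈ freeReps E → FreeRep E i
    fr i∈ = freeRep⁻ E _ (proj₂ (∈-filterᵇ⁻ (freeRep E) i∈))
    map-unique : ∀ xs → (∀ {i} → i ∈ xs → FreeRep E i) → Unique xs → Unique (map κ xs)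
    map-unique [] h [] = []
    map-unique (x ∷ xs) h (x∉ ∷ u) = AllL.tabulate (λ {a} a∈ κx≡a →
        let j , j∈ , eq = ∈ₚ.∈-map⁻ κ a∈ in
        AllL.lookup x∉ j∈ (inj x j (h (here refl)) (h (there j∈)) (trans κx≡a eq)))
      ∷ map-unique xs (h ∘ there) u
    to : ∀ {a} → a ∈ map κ (freeReps E) → a ∈ L
    to a∈ with i , i∈ , refl ← ∈ₚ.∈-map⁻ κ a∈ = into i (fr i∈)
    from : ∀ {a} → a ∈ L → a ∈ map κ (freeReps E)
    from a∈ with i , fi , refl ← onto a∈ = ∈ₚ.∈-map⁺ κ (∈-filterᵇ⁺ (freeRep E) (∈ₚ.∈-allFin i) (freeRep⁺ fi))

  -- Least representatives are not preserved by relabelling and are inconvenient for a partition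
  -- given by its rows. In both situations the type is computed from a better suited labelling `κ`.
  ptype-label : ∀ {n} {A : Set} {E : Rel (suc n)} → Equiv E → (κ : Fin (suc n) → A) (size : A → ℕ) {L : List A} → Unique L →
    (∀ i j → FreeRep E i → FreeRep E j → κ i ≡ κ j → i ≡ j) →
    (∀ i → FreeRep E i → κ i ∈ L) →
    (∀ {a} → a ∈ L → ∃ λ i → FreeRep E i × κ i ≡ a) →
    (∀ i → FreeRep E i → count (rel E i) ≡ size (κ i)) →
    ptype E ≡ (sortℕ (map size L) , zs E)
  ptype-label {E = E} eq κ size {L} uL inj into onto sz = cong₂ _,_
    (sort-cong-↭ (subst (_↭ map size L) (sym mid) (↭ₚ.map⁺ size (freeReps-label E κ uL inj into onto))))
    (ptype-zs eq)
    where
    go : ∀ xs → (∀ {i} → i ∈ xs → FreeRep E i) → map (blockSize E) xs ≡ map size (map κ xs)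
    go [] h = refl
    go (x ∷ xs) h = cong₂ _∷_ (trans (blockSize≡count E x) (sz x (h (here refl)))) (go xs (h ∘ there))
    mid : map (blockSize E) (freeReps E) ≡ map size (map κ (freeReps E))
    mid = go (freeReps E) λ i∈ → freeRep⁻ E _ (proj₂ (∈-filterᵇ⁻ (freeRep E) i∈))

  -- Coarsenings and types

  -- Inductive form of membership in `coarsenings`, for induction on how a coarsening arises. In
  -- `merge` the entry `x` joins the first run of the coarsening of the rest.
  data Coarse : List ℕ → List ℕ → Set where
    single : ∀ {x} → Coarse (x ∷ []) (x ∷ [])
    keep   : ∀ {x y c d} → Coarse (y ∷ c) d → Coarse (x ∷ y ∷ c) (x ∷ d)
    merge  : ∀ {x y z c d} → Coarse (y ∷ c) (z ∷ d) → Coarse (x ∷ y ∷ c) (x + z ∷ d)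

  coarse-≢[] : ∀ {c} → ¬ Coarse c []
  coarse-≢[] ()

  ∈-concatMap-find : ∀ {A : Set} {f : A → List A} {xs y} → y ∈ concatMap f xs → ∃ λ x → x ∈ xs × y ∈ f x
  ∈-concatMap-find {f = f} = find ∘ ∈ₚ.∈-concatMap⁻ f

  coarse⁻ : ∀ {x c d} → d ∈ coarsenings (x ∷ c) → Coarse (x ∷ c) d
  coarse⁻ {x} {[]} (here refl) = single
  coarse⁻ {x} {y ∷ c} d∈ with ∈-concatMap-find {xs = coarsenings (y ∷ c)} d∈
  ... | []     , e∈ , _                 = ⊥-elim (coarse-≢[] (coarse⁻ {y} {c} e∈))
  ... | z ∷ zs , e∈ , here refl         = keep (coarse⁻ {y} {c} e∈)
  ... | z ∷ zs , e∈ , there (here refl) = merge (coarse⁻ {y} {c} e∈)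

  coarse⁺ : ∀ {c d} → Coarse c d → d ∈ coarsenings c
  coarse⁺ single = here refl
  coarse⁺ (keep h) = ∈ₚ.∈-concatMap⁺ _ (Any.map (λ { refl → here refl }) (coarse⁺ h))
  coarse⁺ (merge h) = ∈ₚ.∈-concatMap⁺ _ (Any.map (λ { refl → there (here refl) }) (coarse⁺ h))

  coarse-refl : ∀ x c → Coarse (x ∷ c) (x ∷ c)
  coarse-refl x []      = single
  coarse-refl x (y ∷ c) = keep (coarse-refl y c)

  coarse-length : ∀ {c d} → Coarse c d → length d ≤ length c
  coarse-length single    = ℕₚ.≤-refl
  coarse-length (keep h)  = s≤s (coarse-length h)
  coarse-length (merge h) = ℕₚ.m≤n⇒m≤1+n (coarse-length h)

  mergeAt : ℕ → List ℕ → List ℕ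
  mergeAt i       []          = []
  mergeAt zero    (x ∷ [])    = x ∷ []
  mergeAt zero    (x ∷ y ∷ d) = x + y ∷ d
  mergeAt (suc i) (x ∷ d)     = x ∷ mergeAt i d

  coarse-mergeAt : ∀ i {c d} → Coarse c d → Coarse c (mergeAt i d)
  coarse-mergeAt zero    single    = single
  coarse-mergeAt (suc i) single    = single
  coarse-mergeAt zero    (keep {d = []} h)         = ⊥-elim (coarse-≢[] h)
  coarse-mergeAt zero    (keep {d = z ∷ d} h)      = merge h
  coarse-mergeAt (suc i) (keep h)  = keep (coarse-mergeAt i h)
  coarse-mergeAt zero    (merge {d = []} h)        = merge h
  coarse-mergeAt zero    (merge {x} {y} {z} {c} {w ∷ d} h) =
    subst (λ s → Coarse (x ∷ y ∷ c) (s ∷ d)) (sym (ℕₚ.+-assoc x z w)) (merge (coarse-mergeAt zero h))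
  coarse-mergeAt (suc i) (merge h) = merge (coarse-mergeAt (suc i) h)

  tailSum : List ℕ → ℕ → ℕ
  tailSum c j = sum (drop j c)

  last′ : List ℕ → ℕ
  last′ d = proj₂ (ctype′ d)

  -- The last entry of a coarsening is the sum of a final run of `c`. Hence only the `length c` tail
  -- sums can occur as sizes of pointed blocks.
  coarse-last : ∀ {c d} → Coarse c d → ∃ λ j → j < length c × last′ d ≡ tailSum c j
  coarse-last (single {x}) = 0 , s≤s z≤n , sym (ℕₚ.+-identityʳ x)
  coarse-last (keep {d = []} h) = ⊥-elim (coarse-≢[] h)
  coarse-last (keep {d = _ ∷ _} h) with j , j< , eq ← coarse-last h = suc j , s≤s j< , eq
  coarse-last {c = _ ∷ c} (merge {x} {d = []} h) = 0 , s≤s z≤n , cong (x +_) (go h)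
    where
    go : ∀ {c z} → Coarse c (z ∷ []) → z ≡ sum c
    go (single {x}) = sym (ℕₚ.+-identityʳ x)
    go (keep h) = ⊥-elim (coarse-≢[] h)
    go (merge {x} h) = cong (x +_) (go h)
  coarse-last (merge {d = _ ∷ _} h) with coarse-last h
  ... | j , j< , eq = suc j , s≤s j< , eq

  length-init′ : ∀ d → length (proj₁ (ctype′ d)) ≡ length d ∸ 1
  length-init′ []          = refl
  length-init′ (x ∷ [])    = refl
  length-init′ (x ∷ y ∷ d) = cong suc (length-init′ (y ∷ d))

  tailSum-antitone : ∀ c {i j} → i ≤ j → tailSum c j ≤ tailSum c i
  tailSum-antitone c       {i} {j} z≤n     = go c j
    where
    go : ∀ c j → tailSum c j ≤ sum c
    go c       zero    = ℕₚ.≤-refl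
    go []      (suc j) = z≤n
    go (x ∷ c) (suc j) = ℕₚ.≤-trans (go c j) (ℕₚ.m≤n+m _ x)
  tailSum-antitone []      (s≤s i≤j) = z≤n
  tailSum-antitone (x ∷ c) (s≤s i≤j) = tailSum-antitone c i≤j

  tailSum-strict : ∀ {c} → All (0 <_) c → ∀ {i j} → i < j → j ≤ length c → tailSum c j < tailSum c i
  tailSum-strict {x ∷ c} (p ∷ ps) {zero} {suc j} _ _ =
    ℕₚ.<-≤-trans (s≤s (tailSum-antitone c {0} {j} z≤n)) (ℕₚ.+-monoˡ-≤ (sum c) p)
  tailSum-strict {x ∷ c} (p ∷ ps) {suc i} {suc j} (s≤s i<j) (s≤s j≤) = tailSum-strict ps i<j j≤

  tailSum-suc : ∀ c i → tailSum c i ≡ nthD 0 c i + tailSum c (suc i)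
  tailSum-suc []      zero    = refl
  tailSum-suc []      (suc i) = refl
  tailSum-suc (x ∷ c) zero    = refl
  tailSum-suc (x ∷ c) (suc i) = tailSum-suc c i

  tailSum-end : ∀ c → tailSum c (length c) ≡ 0
  tailSum-end []      = refl
  tailSum-end (x ∷ c) = tailSum-end c

  nthD-pos : ∀ {c} → All (0 <_) c → ∀ {i} → i < length c → 0 < nthD 0 c i
  nthD-pos (p ∷ ps) {zero}  _        = p
  nthD-pos (p ∷ ps) {suc i} (s≤s i<) = nthD-pos ps i<

  isYes⁻ : ∀ {P : Set} (d : Dec P) → ⌊ d ⌋ ≡ true → P
  isYes⁻ (yes p) _ = p

  isYes⁺ : ∀ {P : Set} (d : Dec P) → P → ⌊ d ⌋ ≡ true
  isYes⁺ (yes _) _ = refl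
  isYes⁺ (no ¬p) p = contradiction p ¬p

  typeEqᵇ⁻ : ∀ {s t} → typeEqᵇ s t ≡ true → s ≡ t
  typeEqᵇ⁻ {l , p} {l′ , p′} h with h₁ , h₂ ← ∧-true⁻ (listℕEqᵇ l l′) h =
    cong₂ _,_ (isYes⁻ _ h₁) (≡ᵇ-true⁻ h₂)

  typeEqᵇ⁺ : ∀ {s t} → s ≡ t → typeEqᵇ s t ≡ true
  typeEqᵇ⁺ {l , p} refl = ∧-true⁺ (isYes⁺ _ refl) (≡ᵇ-true⁺ {p} refl)

  -- Members of the poset, chains, and their ranks

  record Elem {n} (c : List ℕ) (E : Rel (suc n)) : Set where
    field
      equiv  : Equiv E
      {d}    : List ℕ
      coarse : Coarse c d
      type   : ptype E ≡ ctype d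
      nontop : ¬ (topRel ⊑ E)

  isTop⁻ : ∀ {m} (E : Rel m) → isTop E ≡ true → topRel ⊑ E
  isTop⁻ E h i j _ = hold (allB⁻ (rel E i) (allB⁻ (λ i → allB (rel E i)) h i) j)

  isTop⁺ : ∀ {m} {E : Rel m} → topRel ⊑ E → isTop E ≡ true
  isTop⁺ h = allB⁺ _ λ i → allB⁺ _ λ j → _≃[_]_.holds (h i j (≃-top i j))

  boolMatrices : ∀ m → List (Rel m)
  boolMatrices m = allVec (allVec (true ∷ false ∷ []) m) m

  ∈-elems⁻ : ∀ {n x c} {E : Rel (suc n)} → E ∈ elemsΠc- n (x ∷ c) → Elem (x ∷ c) E
  ∈-elems⁻ {n} {x} {c} {E} E∈
    with _ , h ← ∈-filterᵇ⁻ (λ E → isEquivRel E ∧ inΠc (x ∷ c) E ∧ not (isTop E)) {xs = boolMatrices (suc n)} E∈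
    with h₁ , h₂₃ ← ∧-true⁻ (isEquivRel E) h
    with h₂ , h₃ ← ∧-true⁻ (inΠc (x ∷ c) E) h₂₃
    with d , d∈ , ty ← any⁻ (λ d → typeEqᵇ (ptype E) (ctype d)) (coarsenings (x ∷ c)) h₂ = record
    { equiv  = isEquivRel⁻ E h₁
    ; coarse = coarse⁻ d∈
    ; type   = typeEqᵇ⁻ ty
    ; nontop = λ t → true≢false (isTop⁺ t) (not-true⁻ h₃)
    }

  ∈-elems⁺ : ∀ {n c} {E : Rel (suc n)} → Elem c E → E ∈ elemsΠc- n c
  ∈-elems⁺ {n} {c} {E} el = ∈-filterᵇ⁺ (λ E → isEquivRel E ∧ inΠc c E ∧ not (isTop E))
    (∈-allVec⁺ E (λ i → ∈-allVec⁺ (Vec.lookup E i) (λ j → bool∈ (Vec.lookup (Vec.lookup E i) j))))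
    (∧-true⁺ (isEquivRel⁺ equiv) (∧-true⁺
      (any⁺ (λ d → typeEqᵇ (ptype E) (ctype d)) (coarsenings c) (coarse⁺ coarse) (typeEqᵇ⁺ type))
      (not-true⁺ (≢true⇒false (nontop ∘ isTop⁻ E)))))
    where
    open Elem el
    bool∈ : ∀ b → b ∈ true ∷ false ∷ []
    bool∈ true  = here refl
    bool∈ false = there (here refl)

  elems-unique : ∀ n c → Unique (elemsΠc- n c)
  elems-unique n c = filterᵇ-unique (λ E → isEquivRel E ∧ inΠc c E ∧ not (isTop E))
    (allVec-unique (allVec-unique (((λ ()) ∷ []) ∷ [] ∷ []) (suc n)) (suc n))

  -- The removed top element counts as the successor of the last element of a chain, so that the
  -- last step needs no separate treatment.
  hd : ∀ {n r} → RelChain n r → Rel (suc n)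
  hd []      = topRel
  hd (E ∷ _) = E

  upper : ∀ {n r} → RelChain n r → Fin r → Rel (suc n)
  upper (E ∷ σ) fzero    = hd σ
  upper (E ∷ σ) (fsuc p) = upper σ p

  data Valid {n} (c : List ℕ) : ∀ {r} → RelChain n r → Set where
    []  : Valid c []
    cons : ∀ {r E} {σ : RelChain n r} → Elem c E → E ⊏ hd σ → Valid c σ → Valid c (E ∷ σ)

  isChain-cons⁻ : ∀ {m r} (E F : Rel m) (σ : Vec (Rel m) r) →
    isChain (E ∷ F ∷ σ) ≡ true → E <ᵣ F ≡ true × isChain (F ∷ σ) ≡ true
  isChain-cons⁻ E F σ h = ∧-true⁻ (E <ᵣ F) h

  ⊏-top : ∀ {n c} {E : Rel (suc n)} → Elem c E → E ⊏ topRel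
  ⊏-top el = (λ i j _ → ≃-top i j) , Elem.nontop el

  ∈-simplices⁻ : ∀ {n x c r} {σ : RelChain n r} → σ ∈ simplices n (x ∷ c) r → Valid (x ∷ c) σ
  ∈-simplices⁻ {n} {x} {c} {r} {σ} σ∈
    with h₁ , h₂ ← ∈-filterᵇ⁻ isChain {xs = allVec (elemsΠc- n (x ∷ c)) r} σ∈ = go σ (∈-elems⁻ ∘ ∈-allVec⁻ h₁) h₂
    where
    go : ∀ {r} (σ : RelChain n r) → (∀ p → Elem (x ∷ c) (Vec.lookup σ p)) → isChain σ ≡ true → Valid (x ∷ c) σ
    go []          el h = []
    go (E ∷ [])    el h = cons (el fzero) (⊏-top (el fzero)) []
    go (E ∷ F ∷ σ) el h = cons (el fzero) (<ᵣ⁻ E F (proj₁ (isChain-cons⁻ E F σ h)))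
      (go (F ∷ σ) (el ∘ fsuc) (proj₂ (isChain-cons⁻ E F σ h)))

  valid-elem : ∀ {n c r} {σ : RelChain n r} → Valid c σ → ∀ p → Elem c (Vec.lookup σ p)
  valid-elem (cons el _ v) fzero    = el
  valid-elem (cons el _ v) (fsuc p) = valid-elem v p

  ∈-simplices⁺ : ∀ {n c r} {σ : RelChain n r} → Valid c σ → σ ∈ simplices n c r
  ∈-simplices⁺ {n} {c} {r} {σ} v =
    ∈-filterᵇ⁺ isChain (∈-allVec⁺ σ (λ p → ∈-elems⁺ (valid-elem v p))) (go v)
    where
    go : ∀ {r} {σ : RelChain n r} → Valid c σ → isChain σ ≡ true
    go []                          = refl
    go (cons _ _ [])               = refl
    go (cons _ lt v@(cons _ _ _))  = ∧-true⁺ (<ᵣ⁺ lt) (go v)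

  simplices-unique : ∀ n c r → Unique (simplices n c r)
  simplices-unique n c r = filterᵇ-unique isChain (allVec-unique (elems-unique n c) r)

  module _ {n : ℕ} {c : List ℕ} {E : Rel (suc n)} (el : Elem c E) where
    open Elem el

    elem-rank< : rank E < length c
    elem-rank< = ℕₚ.<-≤-trans (s≤s (ℕₚ.≤-reflexive
        (trans (sym (ptype-rank E)) (trans (cong (length ∘ proj₁) type)
        (trans (length-sort (proj₁ (ctype′ d))) (length-init′ d))))))
      (ℕₚ.≤-trans (go d coarse) (coarse-length coarse))
      where
      go : ∀ d → Coarse c d → suc (length d ∸ 1) ≤ length d
      go []      h = ⊥-elim (coarse-≢[] h)
      go (x ∷ d) h = ℕₚ.≤-refl

    elem-zs : ∃ λ j → j < length c × zs E ≡ tailSum c j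
    elem-zs with j , j< , eq ← coarse-last coarse =
      j , j< , trans (sym (ptype-zs equiv)) (trans (cong proj₂ type) eq)

    elem-zs< : zs E < n
    elem-zs< = ℕₚ.≰⇒> (nontop ∘ zs≡n⇒top equiv)

  hd-Equiv : ∀ {n c r} {σ : RelChain n r} → Valid c σ → Equiv (hd σ)
  hd-Equiv []            = top-Equiv
  hd-Equiv (cons el _ _) = Elem.equiv el

  countdown : ∀ r → Vec ℕ r
  countdown zero    = []
  countdown (suc r) = suc r ∷ countdown r

  head₀ : ∀ {r} → Vec ℕ r → ℕ
  head₀ []      = 0
  head₀ (x ∷ _) = x

  data StrictDown : ∀ {r} → Vec ℕ r → Set where
    []   : StrictDown []
    cons : ∀ {r x} {v : Vec ℕ r} → head₀ v < x → StrictDown v → StrictDown (x ∷ v)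

  strictDown-length : ∀ {r} {v : Vec ℕ r} → StrictDown v → r ≤ head₀ v
  strictDown-length []         = z≤n
  strictDown-length (cons p h) = ℕₚ.≤-trans (s≤s (strictDown-length h)) p

  -- A strictly decreasing sequence of `r` positive numbers that are at most `r` leaves no choice.
  -- This fixes the ranks in a maximal chain, and also the indices of the tail sums in a growing
  -- one.
  strictDown≡countdown : ∀ {r} {v : Vec ℕ r} → StrictDown v → head₀ v ≤ r → v ≡ countdown r
  strictDown≡countdown []         _ = refl
  strictDown≡countdown (cons p h) b = cong₂ _∷_
    (ℕₚ.≤-antisym b (strictDown-length (cons p h))) (strictDown≡countdown h (s≤s⁻¹ (ℕₚ.≤-trans p b)))

  rank-hd : ∀ {n r} (σ : RelChain n r) → rank (hd σ) ≡ head₀ (Vec.map rank σ)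
  rank-hd {n} []  = rank-top {n}
  rank-hd (E ∷ σ) = refl

  module _ {n : ℕ} {c : List ℕ} where

    valid-rank-down : ∀ {r} {σ : RelChain n r} → Valid c σ → StrictDown (Vec.map rank σ)
    valid-rank-down [] = []
    valid-rank-down (cons {σ = σ} el lt v) =
      cons (subst (_< _) (rank-hd σ) (rank-strict (Elem.equiv el) (hd-Equiv v) lt)) (valid-rank-down v)

    valid-rank-bound : ∀ {r} {σ : RelChain n r} → Valid c σ → head₀ (Vec.map rank σ) ≤ length c ∸ 1
    valid-rank-bound []            = z≤n
    valid-rank-bound (cons el _ _) = ℕₚ.<⇒≤pred (elem-rank< el)

    valid-length : ∀ {r} {σ : RelChain n r} → Valid c σ → r ≤ length c ∸ 1
    valid-length v = ℕₚ.≤-trans (strictDown-length (valid-rank-down v)) (valid-rank-bound v)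

    valid-ranks : ∀ {σ : RelChain n (length c ∸ 1)} → Valid c σ → Vec.map rank σ ≡ countdown (length c ∸ 1)
    valid-ranks v = strictDown≡countdown (valid-rank-down v) (valid-rank-bound v)

  -- Chains and their pointed blocks

  -- Rows after merging rows i and i+1.
  mg : ℕ → ℕ → ℕ
  mg i       zero    = zero
  mg zero    (suc v) = v
  mg (suc i) (suc v) = suc (mg i v)

  mg-low : ∀ {i v} → v ≤ i → mg i v ≡ v
  mg-low {i}     {zero}  _       = refl
  mg-low {suc i} {suc v} (s≤s p) = cong suc (mg-low p)

  mg-high : ∀ {i v} → i ≤ v → mg i (suc v) ≡ v
  mg-high {zero}  {v}     _       = refl
  mg-high {suc i} {suc v} (s≤s p) = cong suc (mg-high p)

  -- The simplicial identity for merging rows, responsible for the cancellation of double merges in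
  -- `sd-δ`.
  mg-mg : ∀ i j v → i ≤ j → mg j (mg i v) ≡ mg i (mg (suc j) v)
  mg-mg i       j       zero    _       = refl
  mg-mg zero    j       (suc v) _       = refl
  mg-mg (suc i) (suc j) (suc v) (s≤s p) = cong suc (mg-mg i j v p)

  mgV : ∀ {n} → ℕ → Tabloid n → Tabloid n
  mgV i = Vec.map (mg i)

  mgV-mgV : ∀ {n} i j (T : Tabloid n) → i ≤ j → mgV j (mgV i T) ≡ mgV i (mgV (suc j) T)
  mgV-mgV i j T i≤j = trans (sym (Vecₚ.map-∘ (mg j) (mg i) T))
    (trans (Vecₚ.map-cong (λ v → mg-mg i j v i≤j) T) (Vecₚ.map-∘ (mg i) (mg (suc j)) T))

  -- h σ e is the row of e in the tabloid recording the pointed blocks of σ.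
  h : ∀ {n r} → RelChain n r → Fin n → ℕ
  h []      e = 0
  h (E ∷ σ) e = b2n (Z E e) + h σ e

  hT : ∀ {n r} → RelChain n r → Tabloid n
  hT σ = Vec.tabulate (h σ)

  b2n≤1 : ∀ b → b2n b ≤ 1
  b2n≤1 true  = ℕₚ.≤-refl
  b2n≤1 false = z≤n

  h≤ : ∀ {n r} (σ : RelChain n r) e → h σ e ≤ r
  h≤ []      e = z≤n
  h≤ (E ∷ σ) e = ℕₚ.+-mono-≤ (b2n≤1 (Z E e)) (h≤ σ e)

  countdown-sum : ∀ r p → lookup (countdown r) p + toℕ p ≡ r
  countdown-sum (suc r) fzero    = ℕₚ.+-identityʳ (suc r)
  countdown-sum (suc r) (fsuc p) = trans (ℕₚ.+-suc _ (toℕ p)) (cong suc (countdown-sum r p))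

  countdown-surj : ∀ r i → i < r → ∃ λ p → lookup (countdown r) p ≡ suc i
  countdown-surj (suc r) i i<r with i ≟ r
  ... | yes refl = fzero , refl
  ... | no i≢r with p , eq ← countdown-surj r i (ℕₚ.≤∧≢⇒< (s≤s⁻¹ i<r) i≢r) = fsuc p , eq

  countdown-bound : ∀ r p → 0 < lookup (countdown r) p × lookup (countdown r) p ≤ r
  countdown-bound (suc r) fzero    = s≤s z≤n , ℕₚ.≤-refl
  countdown-bound (suc r) (fsuc p) with a , b ← countdown-bound r p = a , ℕₚ.m≤n⇒m≤1+n b

  countdown-injective : ∀ r p q → lookup (countdown r) p ≡ lookup (countdown r) q → p ≡ q
  countdown-injective r p q eq = Finₚ.toℕ-injective (ℕₚ.+-cancelˡ-≡ (lookup (countdown r) p) (toℕ p) (toℕ q)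
    (trans (countdown-sum r p) (trans (sym (countdown-sum r q)) (cong (_+ toℕ q) (sym eq)))))

  VecInj : ∀ {A : Set} {m} → Vec A m → Set
  VecInj v = ∀ i j → lookup v i ≡ lookup v j → i ≡ j

  lookup-removeAt : ∀ {A : Set} {m} (v : Vec A (suc m)) p j → lookup (removeAt v p) j ≡ lookup v (punchIn p j)
  lookup-removeAt (x ∷ v)     fzero    j        = refl
  lookup-removeAt (x ∷ y ∷ v) (fsuc p) fzero    = refl
  lookup-removeAt (x ∷ y ∷ v) (fsuc p) (fsuc j) = lookup-removeAt (y ∷ v) p j

  map-removeAt : ∀ {A B : Set} {m} (f : A → B) (v : Vec A (suc m)) p →
    Vec.map f (removeAt v p) ≡ removeAt (Vec.map f v) p
  map-removeAt f (x ∷ v)     fzero    = refl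
  map-removeAt f (x ∷ y ∷ v) (fsuc p) = cong (f x ∷_) (map-removeAt f (y ∷ v) p)

  -- If different positions were removed, two neighbouring entries would have to agree. Thus
  -- distinct ranks or sizes reveal which element of a chain was omitted.
  removeAt-injective : ∀ {A : Set} {m} (v : Vec A (suc m)) → VecInj v → ∀ p q →
    removeAt v p ≡ removeAt v q → p ≡ q
  removeAt-injective v inj fzero fzero eq = refl
  removeAt-injective (x ∷ y ∷ v) inj fzero (fsuc q) eq with () ← inj fzero (fsuc fzero) (sym (Vecₚ.∷-injectiveˡ eq))
  removeAt-injective (x ∷ y ∷ v) inj (fsuc p) fzero eq with () ← inj fzero (fsuc fzero) (Vecₚ.∷-injectiveˡ eq)
  removeAt-injective (x ∷ y ∷ v) inj (fsuc p) (fsuc q) eq = cong fsuc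
    (removeAt-injective (y ∷ v) (λ i j e → Finₚ.suc-injective (inj (fsuc i) (fsuc j) e)) p q (Vecₚ.∷-injectiveʳ eq))

  -- Removing a third position keeps the repetition at `i` and `j`, and no face of an injective
  -- vector has a repetition.
  removeAt-≢ : ∀ {A : Set} {m} {v w : Vec A (suc m)} → VecInj w → ∀ {i j} → i ≢ j → lookup v i ≡ lookup v j →
    ∀ {p} → p ≢ i → p ≢ j → ∀ {q} → removeAt v p ≢ removeAt w q
  removeAt-≢ {v = v} {w} inj i≢j vij {p} p≢i p≢j {q} eq = i≢j (Finₚ.punchOut-injective p≢i p≢j
    (Finₚ.punchIn-injective q _ _ (inj _ _ (trans (sym (lookup-removeAt w q (punchOut p≢i)))
      (trans (cong (λ z → lookup z (punchOut p≢i)) (sym eq)) (trans (Vecₚ.removeAt-punchOut v p≢i) (trans vij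
      (trans (sym (Vecₚ.removeAt-punchOut v p≢j)) (trans (cong (λ z → lookup z (punchOut p≢j)) eq)
      (lookup-removeAt w q (punchOut p≢j)))))))))))

  removeAt-adjacent : ∀ {A : Set} {m} (v : Vec A (suc m)) (q : Fin m) → lookup v (inject₁ q) ≡ lookup v (fsuc q) →
    removeAt v (inject₁ q) ≡ removeAt v (fsuc q)
  removeAt-adjacent (x ∷ y ∷ v) fzero    eq = cong (_∷ v) (sym eq)
  removeAt-adjacent (x ∷ y ∷ v) (fsuc q) eq = cong (x ∷_) (removeAt-adjacent (y ∷ v) q eq)

  h-removeAt-adjacent : ∀ {n m} (σ : RelChain n (suc m)) (q : Fin m) e →
    Z (lookup σ (inject₁ q)) e ≡ Z (lookup σ (fsuc q)) e →
    h (removeAt σ (inject₁ q)) e ≡ h (removeAt σ (fsuc q)) e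
  h-removeAt-adjacent (E ∷ F ∷ σ) fzero    e eq = cong (λ b → b2n b + h σ e) (sym eq)
  h-removeAt-adjacent (E ∷ F ∷ σ) (fsuc q) e eq = cong (b2n (Z E e) +_) (h-removeAt-adjacent (F ∷ σ) q e eq)

  data Grows {n} : ∀ {r} → RelChain n r → Set where
    []   : Grows []
    cons : ∀ {r E} {σ : RelChain n r} → zs E < zs (hd σ) → Grows σ → Grows (E ∷ σ)

  -- Of the growth above the stall only the next strict step is recorded; it is what `cover-unique`
  -- asks for.
  LastStall : ∀ {n r} → RelChain n (suc r) → Fin r → Set
  LastStall σ q = zs (lookup σ (inject₁ q)) ≡ zs (lookup σ (fsuc q)) × zs (lookup σ (fsuc q)) < zs (upper σ (fsuc q))

  total : ∀ {n r} → RelChain n r → ℕ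
  total []      = 0
  total (E ∷ σ) = zs E + total σ

  total≤ : ∀ {n r} (σ : RelChain n r) → total σ ≤ r * n
  total≤ []      = z≤n
  total≤ (E ∷ σ) = ℕₚ.+-mono-≤ (count≤ (Z E)) (total≤ σ)

  module _ {n : ℕ} {c : List ℕ} where

    h-full : ∀ {r} {σ : RelChain n r} → Valid c σ → ∀ e → Z (hd σ) e ≡ true → h σ e ≡ r
    h-full []                      e z = refl
    h-full (cons {σ = σ} el lt v) e z rewrite z = cong suc (h-full v e (Z-mono (proj₁ lt) e z))

    -- Pointed blocks increase along a chain, so `e` enters them at one position and then stays. Its
    -- row number counts the positions from there to the end.
    h-char⁺ : ∀ {r} {σ : RelChain n r} → Valid c σ → ∀ p e → Z (lookup σ p) e ≡ true → r ≤ h σ e + toℕ p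
    h-char⁺ v@(cons {r} el lt _) fzero e z =
      ℕₚ.≤-reflexive (trans (sym (h-full v e z)) (sym (ℕₚ.+-identityʳ _)))
    h-char⁺ (cons {r} {E} {σ} el lt v) (fsuc p) e z = begin
      suc r                                ≤⟨ s≤s (h-char⁺ v p e z) ⟩
      suc (h σ e + toℕ p)                  ≡⟨ ℕₚ.+-suc (h σ e) (toℕ p) ⟨
      h σ e + suc (toℕ p)                  ≤⟨ ℕₚ.+-monoˡ-≤ _ (ℕₚ.m≤n+m (h σ e) (b2n (Z E e))) ⟩
      b2n (Z E e) + h σ e + suc (toℕ p)    ∎
      where open ℕₚ.≤-Reasoning

    h-char⁻ : ∀ {r} {σ : RelChain n r} → Valid c σ → ∀ p e → r ≤ h σ e + toℕ p → Z (lookup σ p) e ≡ true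
    h-char⁻ (cons {r} {E} {σ} el lt v) fzero e le with Z E e
    ... | true  = refl
    ... | false = contradiction (subst (suc r ≤_) (ℕₚ.+-identityʳ (h σ e)) le) (ℕₚ.<⇒≱ (s≤s (h≤ σ e)))
    h-char⁻ (cons {r} {E} {σ} el lt v) (fsuc p) e le with Z E e in z
    ... | true  = h-char⁻ v p e (ℕₚ.≤-trans (ℕₚ.≤-reflexive (sym (h-full v e (Z-mono (proj₁ lt) e z)))) (ℕₚ.m≤m+n _ (toℕ p)))
    ... | false = h-char⁻ v p e (s≤s⁻¹ (subst (suc r ≤_) (ℕₚ.+-suc (h σ e) (toℕ p)) le))

    hT-determines-Z : ∀ {r} {σ τ : RelChain n r} → Valid c σ → Valid c τ → hT σ ≡ hT τ →
      ∀ p e → Z (lookup σ p) e ≡ Z (lookup τ p) e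
    hT-determines-Z {r} {σ} {τ} vσ vτ eq p e = bool-ext
      (λ z → h-char⁻ vτ p e (subst (λ x → r ≤ x + toℕ p) same (h-char⁺ vσ p e z)))
      (λ z → h-char⁻ vσ p e (subst (λ x → r ≤ x + toℕ p) (sym same) (h-char⁺ vτ p e z)))
      where
      same : h σ e ≡ h τ e
      same = trans (sym (Vecₚ.lookup∘tabulate (h σ) e))
        (trans (cong (λ T → lookup T e) eq) (Vecₚ.lookup∘tabulate (h τ) e))

    -- The element at position `p` is the one separating row `i` from row `i + 1`, where `i + 1` is
    -- the entry of `countdown` at `p`. Without it the two rows become one.
    h-removeAt : ∀ {r} {σ : RelChain n (suc r)} → Valid c σ → ∀ p e →
      h (removeAt σ p) e ≡ mg (lookup (countdown (suc r)) p ∸ 1) (h σ e)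
    h-removeAt (cons {r} {E} {σ} el lt v) fzero e with Z E e in z
    ... | true  = trans (h-full v e (Z-mono (proj₁ lt) e z)) (sym (trans
                    (cong (mg r ∘ suc) (h-full v e (Z-mono (proj₁ lt) e z))) (mg-high {r} ℕₚ.≤-refl)))
    ... | false = sym (mg-low (h≤ σ e))
    h-removeAt (cons {suc r} {E} {F ∷ σ} el lt v) (fsuc p) e with Z E e in z
    ... | false = h-removeAt v p e
    ... | true  = trans (cong suc (trans (h-removeAt v p e) (cong (mg i) full)))
        (trans (cong suc (mg-high {i} i≤r)) (sym (trans (cong (mg i ∘ suc) full) (mg-high (ℕₚ.m≤n⇒m≤1+n i≤r)))))
      where
      i = lookup (countdown (suc r)) p ∸ 1
      full = h-full v e (Z-mono (proj₁ lt) e z)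
      i≤r : i ≤ r
      i≤r = ℕₚ.∸-monoˡ-≤ 1 (proj₂ (countdown-bound (suc r) p))

    hT-removeAt : ∀ {r} {σ : RelChain n (suc r)} → Valid c σ → ∀ p →
      hT (removeAt σ p) ≡ mgV (lookup (countdown (suc r)) p ∸ 1) (hT σ)
    hT-removeAt {σ = σ} v p = trans (Vecₚ.tabulate-cong (h-removeAt v p)) (Vecₚ.tabulate-∘ _ (h σ))

    -- The last element never stalls, because a pointed block equal to `[n]` would make it the top.
    -- Going down from there, the first failure of growth is a last stall.
    grows-or-stalls : ∀ {r} {σ : RelChain n (suc r)} → Valid c σ → Grows σ ⊎ ∃ (LastStall σ)
    grows-or-stalls (cons {zero} {E} el lt []) = inj₁ (cons (subst (zs E <_) (sym zs-top) (elem-zs< el)) [])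
    grows-or-stalls (cons {suc r} {E} {F ∷ σ} el lt v) with grows-or-stalls v
    ... | inj₂ (q , s) = inj₂ (fsuc q , s)
    ... | inj₁ g@(cons z< _) with ℕₚ.m≤n⇒m<n∨m≡n (zs-mono (proj₁ lt))
    ... | inj₁ lt′ = inj₁ (cons lt′ g)
    ... | inj₂ eq  = inj₂ (fzero , eq , z<)

    rank-step : ∀ {r} E (σ : RelChain n r) → Vec.map rank (E ∷ σ) ≡ countdown (suc r) → rank E ≤ suc (rank (hd σ))
    rank-step {r} E σ eq = ℕₚ.≤-reflexive (trans (Vecₚ.∷-injectiveˡ eq)
      (cong suc (sym (trans (rank-hd σ) (trans (cong head₀ (Vecₚ.∷-injectiveʳ eq)) (head₀-countdown r))))))
      where
      head₀-countdown : ∀ r → head₀ (countdown r) ≡ r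
      head₀-countdown zero    = refl
      head₀-countdown (suc r) = refl

    -- From the top downwards, each element is determined by the one above it and by its own pointed
    -- block.
    grows-unique : ∀ {r} {σ τ : RelChain n r} → Valid c σ → Valid c τ → Grows σ →
      Vec.map rank σ ≡ countdown r → Vec.map rank τ ≡ countdown r →
      (∀ p e → Z (lookup σ p) e ≡ Z (lookup τ p) e) → σ ≡ τ
    grows-unique [] [] g rσ rτ zz = refl
    grows-unique (cons {E = E} {σ} elE ltE vσ) (cons {E = F} elF ltF vτ) (cons z< g) rσ rτ zz
      with refl ← grows-unique vσ vτ g (Vecₚ.∷-injectiveʳ rσ) (Vecₚ.∷-injectiveʳ rτ) (zz ∘ fsuc) =
      cong (_∷ _) (cover-unique (Elem.equiv elE) (Elem.equiv elF) (hd-Equiv vσ) (proj₁ ltE) (proj₁ ltF)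
        (rank-step E σ rσ) (rank-step F σ rτ) (zz fzero) z<)

    -- Exchanging the element after the last stall for any other one can only
    -- enlarge the pointed block.
    stall-exchange : ∀ {r} {σ τ : RelChain n (suc r)} → Valid c σ → Valid c τ →
      Vec.map rank σ ≡ countdown (suc r) → Vec.map rank τ ≡ countdown (suc r) → ∀ q → LastStall σ q →
      removeAt σ (fsuc q) ≡ removeAt τ (fsuc q) → σ ≡ τ ⊎ total σ < total τ
    stall-exchange (cons {E = E} {F ∷ ρ} _ ltF (cons elF lF vσ)) (cons {σ = F′ ∷ ρ′} elE ltF′ (cons elF′ lF′ vτ))
      rσ rτ fzero (stall , z<) eq with refl ← Vecₚ.∷-injectiveˡ eq | refl ← Vecₚ.∷-injectiveʳ eq
      -- `F′` lies above the common lower neighbour, whose pointed block is as large as that of `F`.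
      -- If the size does not grow, then `F` and `F′` have the same pointed block and the same upper
      -- neighbour, hence coincide.
      with ℕₚ.m≤n⇒m<n∨m≡n (zs-mono (proj₁ ltF′))
    ... | inj₁ lt = inj₂ (ℕₚ.+-monoʳ-< (zs E) (ℕₚ.+-monoˡ-< (total ρ) (subst (_< zs F′) stall lt)))
    ... | inj₂ e  = inj₁ (cong (λ G → _ ∷ G ∷ ρ) (cover-unique (Elem.equiv elF) (Elem.equiv elF′) (hd-Equiv vσ)
        (proj₁ lF) (proj₁ lF′) (rank-step F ρ (Vecₚ.∷-injectiveʳ rσ)) (rank-step F′ ρ (Vecₚ.∷-injectiveʳ rτ))
        (λ x → trans (sym (Z-ext (proj₁ ltF) (ℕₚ.≤-reflexive (sym stall)) x)) (Z-ext (proj₁ ltF′) (ℕₚ.≤-reflexive (sym e)) x)) z<))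
    stall-exchange (cons {E = E} {_ ∷ _} _ _ vσ) (cons {σ = _ ∷ _} _ _ vτ) rσ rτ (fsuc q) s eq
      with refl ← Vecₚ.∷-injectiveˡ eq
      with stall-exchange vσ vτ (Vecₚ.∷-injectiveʳ rσ) (Vecₚ.∷-injectiveʳ rτ) q s (Vecₚ.∷-injectiveʳ eq)
    ... | inj₁ refl = inj₁ refl
    ... | inj₂ lt   = inj₂ (ℕₚ.+-monoʳ-< (zs E) lt)

  -- Tabloids of shape `B` and the tabloid of a growing chain

  ∈-tabloids⁺ : ∀ {n c} (T : Tabloid n) → (∀ e → lookup T e < length c) →
    (∀ i → i < length c → count (λ e → lookup T e ≡ᵇ i) ≡ nthD 0 c i) → T ∈ tabloids n c
  ∈-tabloids⁺ {n} {c} T T< sizes = ∈-filterᵇ⁺ (isTabloid c) (∈-allVec⁺ T (λ e → ∈ₚ.∈-upTo⁺ (T< e)))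
    (all⁺ (λ i → countB {n} (λ e → lookup T e ≡ᵇ i) ≡ᵇ nthD 0 c i) (upTo (length c)) λ {i} i∈ →
      ≡ᵇ-true⁺ (trans (countB≡count (λ e → lookup T e ≡ᵇ i)) (sizes i (∈ₚ.∈-upTo⁻ i∈))))

  ∈-tabloids-row : ∀ {n c} {T : Tabloid n} → T ∈ tabloids n c → ∀ e → lookup T e < length c
  ∈-tabloids-row {n} {c} T∈ e = ∈ₚ.∈-upTo⁻ (∈-allVec⁻ (proj₁ (∈-filterᵇ⁻ (isTabloid c) {xs = allVec (upTo (length c)) n} T∈)) e)

  ∈-tabloids-size : ∀ {n c} {T : Tabloid n} → T ∈ tabloids n c → ∀ i → i < length c →
    count (λ e → lookup T e ≡ᵇ i) ≡ nthD 0 c i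
  ∈-tabloids-size {n} {c} {T} T∈ i i< = trans (sym (countB≡count (λ e → lookup T e ≡ᵇ i))) (≡ᵇ-true⁻
    (all⁻ (λ i → countB {n} (λ e → lookup T e ≡ᵇ i) ≡ᵇ nthD 0 c i) (upTo (length c))
      (proj₂ (∈-filterᵇ⁻ (isTabloid c) {xs = allVec (upTo (length c)) n} T∈)) (∈ₚ.∈-upTo⁺ i<)))

  tabloids-unique : ∀ n c → Unique (tabloids n c)
  tabloids-unique n c = filterᵇ-unique (isTabloid c) (allVec-unique (Uniqueₚ.upTo⁺ _) n)

  b2n-≡ᵇ+<ᵇ : ∀ v i → b2n (not (v <ᵇ i)) ≡ b2n (v ≡ᵇ i) + b2n (not (v <ᵇ suc i))
  b2n-≡ᵇ+<ᵇ zero    zero    = refl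
  b2n-≡ᵇ+<ᵇ zero    (suc i) = refl
  b2n-≡ᵇ+<ᵇ (suc v) zero    = refl
  b2n-≡ᵇ+<ᵇ (suc v) (suc i) = b2n-≡ᵇ+<ᵇ v i

  module _ {n x : ℕ} {c′ : List ℕ} (pos : All (0 <_) (x ∷ c′)) (n≡ : sum (x ∷ c′) ≡ n) where
    private
      c = x ∷ c′
      r = length c′

    -- Each size is a tail sum of `c`, and tail sums do not increase with the index; growing sizes
    -- therefore have strictly decreasing indices.
    grows-index : ∀ {m} {σ : RelChain n m} → Valid c σ → Grows σ →
      ∃ λ v → Vec.map zs σ ≡ Vec.map (tailSum c) v × StrictDown v × head₀ v ≤ r × zs (hd σ) ≡ tailSum c (head₀ v)
    grows-index [] [] = [] , refl , [] , z≤n , trans zs-top (sym n≡)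
    grows-index (cons {E = E} {σ} el lt vσ) (cons z< g)
      with v , eq , down , _ , eq₀ ← grows-index vσ g | j , j< , eqj ← elem-zs el =
      j ∷ v , cong₂ _∷_ eqj eq , cons (ℕₚ.≰⇒> λ j≤ → ℕₚ.<⇒≱ z<
        (subst₂ _≤_ (sym eq₀) (sym eqj) (tailSum-antitone c j≤))) down , s≤s⁻¹ j< , eqj

    tailSums : Vec ℕ r
    tailSums = Vec.map (tailSum c) (countdown r)

    grows-zs : ∀ {σ : RelChain n r} → Valid c σ → Grows σ → Vec.map zs σ ≡ tailSums
    grows-zs vσ g with v , eq , down , bound , _ ← grows-index vσ g =
      trans eq (cong (Vec.map (tailSum c)) (strictDown≡countdown down bound))

    tailSum-injective : ∀ {i j} → i ≤ length c → j ≤ length c → tailSum c i ≡ tailSum c j → i ≡ j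
    tailSum-injective {i} {j} i≤ j≤ eq with ℕₚ.<-cmp i j
    ... | tri< i<j _ _ = contradiction (sym eq) (ℕₚ.<⇒≢ (tailSum-strict pos i<j j≤))
    ... | tri≈ _ i≡j _ = i≡j
    ... | tri> _ _ j<i = contradiction eq (ℕₚ.<⇒≢ (tailSum-strict pos j<i i≤))

    tailSums-injective : VecInj tailSums
    tailSums-injective i j eq = countdown-injective r i j (tailSum-injective (bound i) (bound j)
      (trans (sym (Vecₚ.lookup-map i (tailSum c) (countdown r))) (trans eq (Vecₚ.lookup-map j (tailSum c) (countdown r)))))
      where
      bound : ∀ p → lookup (countdown r) p ≤ length c
      bound p = ℕₚ.m≤n⇒m≤1+n (proj₂ (countdown-bound r p))

    -- The entries in rows at least `i` form everything, a pointed block of the chain, or nothing,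
    -- and number `tailSum c i` in each case. Row `i` has the difference of two consecutive tail
    -- sums.
    grows-tabloid : ∀ {σ : RelChain n r} → Valid c σ → Grows σ → hT σ ∈ tabloids n c
    grows-tabloid {σ} vσ g = ∈-tabloids⁺ (hT σ)
      (λ e → subst (_< length c) (sym (Vecₚ.lookup∘tabulate (h σ) e)) (s≤s (h≤ σ e)))
      λ i i< → trans (count-cong λ e → cong (_≡ᵇ i) (Vecₚ.lookup∘tabulate (h σ) e)) (size i i<)
      where
      above : ℕ → ℕ
      above i = count (λ e → not (h σ e <ᵇ i))
      above≡tailSum : ∀ i → i ≤ length c → above i ≡ tailSum c i
      above≡tailSum zero    _ = trans (count-all {n} (λ e → refl)) (sym n≡)
      above≡tailSum (suc i) i≤ with i <? r
      ... | no i≮r with refl ← ℕₚ.≤-antisym (s≤s⁻¹ i≤) (ℕₚ.≮⇒≥ i≮r) =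
        trans (count-none {n} (λ e → cong not (<ᵇ-true⁺ {h σ e} {suc r} (s≤s (h≤ σ e))))) (sym (tailSum-end c))
      ... | yes i<r with p , eq ← countdown-surj r i i<r = begin
        above (suc i)            ≡⟨ count-cong (λ e → bool-ext (to e) (from e)) ⟩
        zs (lookup σ p)          ≡⟨ Vecₚ.lookup-map p zs σ ⟨
        lookup (Vec.map zs σ) p  ≡⟨ cong (λ v → lookup v p) (grows-zs vσ g) ⟩
        lookup tailSums p              ≡⟨ Vecₚ.lookup-map p (tailSum c) (countdown r) ⟩
        tailSum c (lookup (countdown r) p)   ≡⟨ cong (tailSum c) eq ⟩
        tailSum c (suc i)             ∎
        where
        open ≡-Reasoning
        sum≡ : suc i + toℕ p ≡ r
        sum≡ = trans (cong (_+ toℕ p) (sym eq)) (countdown-sum r p)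
        to : ∀ e → not (h σ e <ᵇ suc i) ≡ true → Z (lookup σ p) e ≡ true
        to e ge = h-char⁻ vσ p e (subst (_≤ h σ e + toℕ p) sum≡
          (ℕₚ.+-monoˡ-≤ (toℕ p) (<ᵇ-false⁻ {h σ e} {suc i} (not-true⁻ ge))))
        from : ∀ e → Z (lookup σ p) e ≡ true → not (h σ e <ᵇ suc i) ≡ true
        from e z = not-true⁺ (<ᵇ-false⁺ (ℕₚ.+-cancelʳ-≤ (toℕ p) (suc i) (h σ e)
          (subst (_≤ h σ e + toℕ p) (sym sum≡) (h-char⁺ vσ p e z))))
      size : ∀ i → i < length c → count (λ e → h σ e ≡ᵇ i) ≡ nthD 0 c i
      size i i< = ℕₚ.+-cancelʳ-≡ (above (suc i)) _ _ (begin
        count (λ e → h σ e ≡ᵇ i) + above (suc i)  ≡⟨ count-+ (λ e → b2n-≡ᵇ+<ᵇ (h σ e) i) ⟨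
        above i                                   ≡⟨ above≡tailSum i (ℕₚ.<⇒≤ i<) ⟩
        tailSum c i                                    ≡⟨ tailSum-suc c i ⟩
        nthD 0 c i + tailSum c (suc i)                 ≡⟨ cong (nthD 0 c i +_) (above≡tailSum (suc i) i<) ⟨
        nthD 0 c i + above (suc i)                ∎)
        where open ≡-Reasoning

  ∈-tabloids-occupied : ∀ {n c} {T : Tabloid n} → All (0 <_) c → T ∈ tabloids n c → ∀ i → i < length c →
    ∃ λ e → lookup T e ≡ i
  ∈-tabloids-occupied {c = c} pos T∈ i i<
    with e , p ← count-pos⁻ (subst (0 <_) (sym (∈-tabloids-size {c = c} T∈ i i<)) (nthD-pos pos i<)) = e , ≡ᵇ-true⁻ p

  -- The row between two equal pointed blocks is empty, whereas a tabloid has an entry in every row.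
  stall-no-tabloid : ∀ {n c r} {σ : RelChain n (suc r)} → All (0 <_) c → suc r < length c → Valid c σ →
    ∀ q → (∀ e → Z (lookup σ (inject₁ q)) e ≡ Z (lookup σ (fsuc q)) e) → ¬ (hT σ ∈ tabloids n c)
  stall-no-tabloid {c = c} {r} {σ} pos r< vσ q zz T∈
    with e , he ← ∈-tabloids-occupied {c = c} pos T∈ (lookup (countdown (suc r)) (fsuc q))
                    (ℕₚ.≤-<-trans (proj₂ (countdown-bound (suc r) (fsuc q))) r<) =
    contradiction low (ℕₚ.<⇒≱ (ℕₚ.≤-reflexive (trans (sym (ℕₚ.+-suc _ _)) total≡)))
    where
    total≡ : h σ e + suc (toℕ q) ≡ suc r
    total≡ = trans (cong (_+ suc (toℕ q)) (trans (sym (Vecₚ.lookup∘tabulate (h σ) e)) he)) (countdown-sum (suc r) (fsuc q))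
    low : suc r ≤ h σ e + toℕ q
    low = subst (λ z → suc r ≤ h σ e + z) (Finₚ.toℕ-inject₁ q)
      (h-char⁺ vσ (inject₁ q) e (trans (zz e) (h-char⁻ vσ (fsuc q) e (ℕₚ.≤-reflexive (sym total≡)))))

  -- Parity of permutations

  module 𝔹 = CommutativeRing Boolₚ.xor-∧-commutativeRing
  module ⊕ = CMSum 𝔹.+-commutativeMonoid
  module ⊕* = SSum 𝔹.semiring

  odd : ℕ → Bool
  odd k = not (isEvenᵇ k)

  odd-suc : ∀ k → odd (suc k) ≡ not (odd k)
  odd-suc zero          = refl
  odd-suc (suc zero)    = refl
  odd-suc (suc (suc k)) = odd-suc k

  private
    oddLength : ∀ {A : Set} → (A → Bool) → List A → Bool
    oddLength P L = odd (length (filterᵇ P L))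

    oddLength-∷ : ∀ {A : Set} (P : A → Bool) x L → oddLength P (x ∷ L) ≡ P x xor oddLength P L
    oddLength-∷ P x L with P x
    ... | true  = odd-suc (length (filterᵇ P L))
    ... | false = refl

    oddLength-++ : ∀ {A : Set} (P : A → Bool) L M → oddLength P (L ++ M) ≡ oddLength P L xor oddLength P M
    oddLength-++ P []      M = refl
    oddLength-++ P (x ∷ L) M = begin
      oddLength P (x ∷ L ++ M)                    ≡⟨ oddLength-∷ P x (L ++ M) ⟩
      P x xor oddLength P (L ++ M)                ≡⟨ cong (P x xor_) (oddLength-++ P L M) ⟩
      P x xor (oddLength P L xor oddLength P M)   ≡⟨ 𝔹.+-assoc (P x) _ _ ⟨
      (P x xor oddLength P L) xor oddLength P M   ≡⟨ cong (_xor oddLength P M) (oddLength-∷ P x L) ⟨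
      oddLength P (x ∷ L) xor oddLength P M       ∎
      where open ≡-Reasoning

    oddLength-map-tabulate : ∀ {A B : Set} {m} (P : B → Bool) (f : A → B) (g : Fin m → A) →
      oddLength P (map f (tabulate g)) ≡ ⊕.sum λ j → P (f (g j))
    oddLength-map-tabulate {m = zero}  P f g = refl
    oddLength-map-tabulate {m = suc m} P f g = trans (oddLength-∷ P (f (g fzero)) _)
      (cong (P (f (g fzero)) xor_) (oddLength-map-tabulate P f (g ∘ fsuc)))

    oddLength-concatMap : ∀ {A B : Set} {m} (P : B → Bool) (F : A → List B) (g : Fin m → A) →
      oddLength P (concatMap F (tabulate g)) ≡ ⊕.sum λ i → oddLength P (F (g i))
    oddLength-concatMap {m = zero}  P F g = refl
    oddLength-concatMap {m = suc m} P F g = trans (oddLength-++ P (F (g fzero)) _)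
      (cong (oddLength P (F (g fzero)) xor_) (oddLength-concatMap P F (g ∘ fsuc)))

  lt : ∀ {m} → Fin m → Fin m → Bool
  lt i j = toℕ i <ᵇ toℕ j

  parity : ∀ {m} → (Fin m → Fin m) → Bool
  parity f = ⊕.sum λ i → ⊕.sum λ j → lt i j ∧ lt (f j) (f i)

  inversions-parity : ∀ {m} (γ : Vec (Fin m) m) → odd (inversions γ) ≡ parity (Vec.lookup γ)
  inversions-parity {m} γ = trans (oddLength-concatMap P (λ i → map (i ,_) (allFin m)) id)
    (⊕.sum-cong-≗ λ i → oddLength-map-tabulate P (i ,_) id)
    where
    P : Fin m × Fin m → Bool
    P ij = lt (proj₁ ij) (proj₂ ij) ∧ lt (Vec.lookup γ (proj₂ ij)) (Vec.lookup γ (proj₁ ij))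

  lt-irrefl : ∀ {m} (i : Fin m) → lt i i ≡ false
  lt-irrefl i = <ᵇ-false⁺ {toℕ i} {toℕ i} ℕₚ.≤-refl

  lt-flip : ∀ {m} {i j : Fin m} → i ≢ j → lt j i ≡ not (lt i j)
  lt-flip {i = i} {j} i≢j with ℕₚ.<-cmp (toℕ i) (toℕ j)
  ... | tri< i<j _ _ = trans (<ᵇ-false⁺ (ℕₚ.<⇒≤ i<j)) (cong not (sym (<ᵇ-true⁺ i<j)))
  ... | tri≈ _ i≡j _ = contradiction (Finₚ.toℕ-injective i≡j) i≢j
  ... | tri> _ _ j<i = trans (<ᵇ-true⁺ j<i) (cong not (sym (<ᵇ-false⁺ (ℕₚ.<⇒≤ j<i))))

  lt-absurd : ∀ {m} {i j k : Fin m} → toℕ j < toℕ k → lt i j ∧ not (lt i k) ≡ false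
  lt-absurd {i = i} {j} {k} j<k with lt i j in p
  ... | false = refl
  ... | true  = cong not (<ᵇ-true⁺ (ℕₚ.<-trans (<ᵇ-true⁻ {toℕ i} {toℕ j} p) j<k))

  lt-absurdʳ : ∀ {m} {i j k : Fin m} → toℕ j < toℕ k → lt k i ∧ not (lt j i) ≡ false
  lt-absurdʳ {i = i} {j} {k} j<k with lt k i in p
  ... | false = refl
  ... | true  = cong not (<ᵇ-true⁺ (ℕₚ.<-trans j<k (<ᵇ-true⁻ {toℕ k} {toℕ i} p)))

  private
    ⊕⊕-cong : ∀ {m} {F G : Fin m → Fin m → Bool} → (∀ i j → F i j ≡ G i j) →
      (⊕.sum λ i → ⊕.sum λ j → F i j) ≡ (⊕.sum λ i → ⊕.sum λ j → G i j)
    ⊕⊕-cong eq = ⊕.sum-cong-≗ λ i → ⊕.sum-cong-≗ λ j → eq i j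

    ⊕⊕-xor : ∀ {m} (F G : Fin m → Fin m → Bool) →
      (⊕.sum λ i → ⊕.sum λ j → F i j xor G i j) ≡ (⊕.sum λ i → ⊕.sum λ j → F i j) xor (⊕.sum λ i → ⊕.sum λ j → G i j)
    ⊕⊕-xor F G = trans (⊕.sum-cong-≗ λ i → ⊕.∑-distrib-+ (F i) (G i))
      (⊕.∑-distrib-+ (λ i → ⊕.sum (F i)) (λ i → ⊕.sum (G i)))

    -- Collects the terms at `(i , j)` and `(j , i)`, so that the effect of exchanging the two
    -- indices becomes visible.
    ⊕⊕-halve : ∀ {m} (F : Fin m → Fin m → Bool) → (∀ i → F i i ≡ false) →
      (⊕.sum λ i → ⊕.sum λ j → F i j) ≡ (⊕.sum λ i → ⊕.sum λ j → lt i j ∧ (F i j xor F j i))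
    ⊕⊕-halve F diag = begin
      (⊕.sum λ i → ⊕.sum λ j → F i j)
        ≡⟨ ⊕⊕-cong split ⟩
      (⊕.sum λ i → ⊕.sum λ j → (lt i j ∧ F i j) xor (lt j i ∧ F i j))
        ≡⟨ ⊕⊕-xor (λ i j → lt i j ∧ F i j) (λ i j → lt j i ∧ F i j) ⟩
      (⊕.sum λ i → ⊕.sum λ j → lt i j ∧ F i j) xor (⊕.sum λ i → ⊕.sum λ j → lt j i ∧ F i j)
        ≡⟨ cong ((⊕.sum λ i → ⊕.sum λ j → lt i j ∧ F i j) xor_) (⊕.∑-comm λ i j → lt j i ∧ F i j) ⟩
      (⊕.sum λ i → ⊕.sum λ j → lt i j ∧ F i j) xor (⊕.sum λ i → ⊕.sum λ j → lt i j ∧ F j i)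
        ≡⟨ ⊕⊕-xor (λ i j → lt i j ∧ F i j) (λ i j → lt i j ∧ F j i) ⟨
      (⊕.sum λ i → ⊕.sum λ j → (lt i j ∧ F i j) xor (lt i j ∧ F j i))
        ≡⟨ ⊕⊕-cong (λ i j → sym (𝔹.distribˡ (lt i j) (F i j) (F j i))) ⟩
      (⊕.sum λ i → ⊕.sum λ j → lt i j ∧ (F i j xor F j i)) ∎
      where
      open ≡-Reasoning
      split : ∀ i j → F i j ≡ (lt i j ∧ F i j) xor (lt j i ∧ F i j)
      split i j with i ≟ᶠ j
      ... | yes refl rewrite diag i | lt-irrefl i = refl
      ... | no i≢j rewrite lt-flip i≢j with lt i j | F i j
      ... | true  | true  = refl
      ... | true  | false = refl
      ... | false | _     = refl

    δᵇ : ∀ {m} → Fin m → Fin m → Bool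
    δᵇ a i = does (i ≟ᶠ a)

    sum-δᵇ : ∀ {m} (a : Fin m) (g : Fin m → Bool) → (⊕.sum λ i → δᵇ a i ∧ g i) ≡ g a
    sum-δᵇ {suc m} fzero g = trans (cong (g fzero xor_) (⊕.sum-replicate-zero m)) (Boolₚ.xor-identityʳ _)
    sum-δᵇ {suc m} (fsuc a) g = trans (⊕.sum-cong-≗ λ i → cong (_∧ g (fsuc i)) (δᵇ-suc i)) (sum-δᵇ a (g ∘ fsuc))
      where
      δᵇ-suc : ∀ i → δᵇ (fsuc a) (fsuc i) ≡ δᵇ a i
      δᵇ-suc i with i ≟ᶠ a
      ... | yes _ = refl
      ... | no  _ = refl

  module Transposition {m : ℕ} (a b : Fin m) where

    τ : Fin m → Fin m
    τ i with i ≟ᶠ a | i ≟ᶠ b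
    ... | yes _ | _     = b
    ... | no  _ | yes _ = a
    ... | no  _ | no  _ = i

    τ-a : τ a ≡ b
    τ-a with a ≟ᶠ a
    ... | yes _ = refl
    ... | no ¬p = contradiction refl ¬p

    τ-b : τ b ≡ a
    τ-b with b ≟ᶠ a | b ≟ᶠ b
    ... | yes p | _     = p
    ... | no  _ | yes _ = refl
    ... | no  _ | no ¬p = contradiction refl ¬p

    τ-other : ∀ {i} → i ≢ a → i ≢ b → τ i ≡ i
    τ-other {i} i≢a i≢b with i ≟ᶠ a | i ≟ᶠ b
    ... | yes p | _     = contradiction p i≢a
    ... | no  _ | yes p = contradiction p i≢b
    ... | no  _ | no  _ = refl

    τ-τ : ∀ i → τ (τ i) ≡ i
    τ-τ i with i ≟ᶠ a | i ≟ᶠ b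
    ... | yes refl | _        = τ-b
    ... | no  _    | yes refl = τ-a
    ... | no  p    | no q     = τ-other p q

    τ-injective : ∀ {i j} → τ i ≡ τ j → i ≡ j
    τ-injective {i} {j} eq = trans (sym (τ-τ i)) (trans (cong τ eq) (τ-τ j))

    τ-perm : Permutation′ m
    τ-perm = permutation τ τ τ-τ τ-τ

  private
    module _ {m : ℕ} {a b : Fin m} (a<b : toℕ a < toℕ b) where
      open Transposition a b

      -- The pairs inverted by `τ` are `(a , b)` and, for each `x` strictly between, both `(a , x)`
      -- and `(x , b)`. All but the first come in twos.
      parity-τ< : (⊕.sum λ i → ⊕.sum λ j → lt i j ∧ not (lt (τ i) (τ j))) ≡ true
      parity-τ< = begin
        (⊕.sum λ i → ⊕.sum λ j → lt i j ∧ not (lt (τ i) (τ j)))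
          ≡⟨ ⊕⊕-cong term ⟩
        (⊕.sum λ i → ⊕.sum λ j → (δᵇ a i ∧ (δᵇ b j ∧ true)) xor ((δᵇ a i ∧ mid j) xor (δᵇ b j ∧ mid i)))
          ≡⟨ ⊕⊕-xor (λ i j → δᵇ a i ∧ (δᵇ b j ∧ true)) (λ i j → (δᵇ a i ∧ mid j) xor (δᵇ b j ∧ mid i)) ⟩
        (⊕.sum λ i → ⊕.sum λ j → δᵇ a i ∧ (δᵇ b j ∧ true)) xor (⊕.sum λ i → ⊕.sum λ j → (δᵇ a i ∧ mid j) xor (δᵇ b j ∧ mid i))
          ≡⟨ cong₂ _xor_ corner (⊕⊕-xor (λ i j → δᵇ a i ∧ mid j) (λ i j → δᵇ b j ∧ mid i)) ⟩
        true xor ((⊕.sum λ i → ⊕.sum λ j → δᵇ a i ∧ mid j) xor (⊕.sum λ i → ⊕.sum λ j → δᵇ b j ∧ mid i))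
          ≡⟨ cong (true xor_) (cong₂ _xor_ row (⊕.sum-cong-≗ λ i → sum-δᵇ b (λ _ → mid i))) ⟩
        true xor (⊕.sum mid xor ⊕.sum mid)
          ≡⟨ cong not (Boolₚ.xor-same (⊕.sum mid)) ⟩
        true ∎
        where
        open ≡-Reasoning
        mid : Fin m → Bool
        mid x = lt a x ∧ lt x b
        a≢b : a ≢ b
        a≢b refl = ℕₚ.<-irrefl refl a<b
        row : (⊕.sum λ i → ⊕.sum λ j → δᵇ a i ∧ mid j) ≡ ⊕.sum mid
        row = trans (⊕.sum-cong-≗ λ i → sym (⊕*.*-distribˡ-sum (δᵇ a i) mid)) (sum-δᵇ a (λ _ → ⊕.sum mid))
        corner : (⊕.sum λ i → ⊕.sum λ j → δᵇ a i ∧ (δᵇ b j ∧ true)) ≡ true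
        corner = trans (⊕.sum-cong-≗ λ i → trans (sym (⊕*.*-distribˡ-sum (δᵇ a i) (λ j → δᵇ b j ∧ true)))
          (cong (δᵇ a i ∧_) (sum-δᵇ b (λ _ → true)))) (sum-δᵇ a (λ _ → true))
        term : ∀ i j → lt i j ∧ not (lt (τ i) (τ j)) ≡ (δᵇ a i ∧ (δᵇ b j ∧ true)) xor ((δᵇ a i ∧ mid j) xor (δᵇ b j ∧ mid i))
        ab : lt a b ≡ true
        ab = <ᵇ-true⁺ a<b
        ba : lt b a ≡ false
        ba = <ᵇ-false⁺ (ℕₚ.<⇒≤ a<b)
        term i j with i ≟ᶠ a | j ≟ᶠ b | i ≟ᶠ b | j ≟ᶠ a
        ... | yes refl | yes refl | _        | yes p    = contradiction (sym p) a≢b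
        ... | yes refl | yes refl | _        | no _     rewrite ab | ba | lt-irrefl a | lt-irrefl b = refl
        ... | yes refl | no j≢b   | _        | yes refl rewrite lt-irrefl a = refl
        ... | yes refl | no j≢b   | _        | no j≢a   rewrite lt-flip (j≢b ∘ sym) = sym (Boolₚ.xor-identityʳ _)
        ... | no i≢a   | yes refl | yes refl | _        rewrite lt-irrefl b | ab = refl
        ... | no i≢a   | yes refl | no i≢b   | yes p    = contradiction (sym p) a≢b
        ... | no i≢a   | yes refl | no i≢b   | no _     rewrite lt-flip i≢a = Boolₚ.∧-comm (lt i b) _
        ... | no i≢a   | no j≢b   | yes refl | yes refl rewrite ba = refl
        ... | no i≢a   | no j≢b   | yes refl | no j≢a   = lt-absurdʳ {i = j} {a} {b} a<b
        ... | no i≢a   | no j≢b   | no i≢b   | yes refl = lt-absurd {i = i} {a} {b} a<b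
        ... | no i≢a   | no j≢b   | no i≢b   | no j≢a   = Boolₚ.∧-inverseʳ (lt i j)

      -- After reindexing by `τ`, both parities add up the same bits `c i j`, with weights that
      -- differ exactly at the pairs on which `τ` inverts the order. As `f` is injective, exactly
      -- one of `c i j` and `c j i` is true, so the difference counts the pairs inverted by `τ`,
      -- whatever `f` is.
      parity-∘τ< : ∀ (f : Fin m → Fin m) → (∀ {i j} → f i ≡ f j → i ≡ j) → parity f xor parity (f ∘ τ) ≡ true
      parity-∘τ< f f-inj = begin
        parity f xor parity (f ∘ τ)
          ≡⟨ cong (parity f xor_) reindex ⟩
        parity f xor (⊕.sum λ i → ⊕.sum λ j → lt (τ i) (τ j) ∧ c i j)
          ≡⟨ ⊕⊕-xor (λ i j → lt i j ∧ c i j) (λ i j → lt (τ i) (τ j) ∧ c i j) ⟨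
        (⊕.sum λ i → ⊕.sum λ j → (lt i j ∧ c i j) xor (lt (τ i) (τ j) ∧ c i j))
          ≡⟨ ⊕⊕-cong (λ i j → sym (𝔹.distribʳ (c i j) (lt i j) (lt (τ i) (τ j)))) ⟩
        (⊕.sum λ i → ⊕.sum λ j → d i j ∧ c i j)
          ≡⟨ ⊕⊕-halve (λ i j → d i j ∧ c i j) diag ⟩
        (⊕.sum λ i → ⊕.sum λ j → lt i j ∧ ((d i j ∧ c i j) xor (d j i ∧ c j i)))
          ≡⟨ ⊕⊕-cong collapse ⟩
        (⊕.sum λ i → ⊕.sum λ j → lt i j ∧ not (lt (τ i) (τ j)))
          ≡⟨ parity-τ< ⟩
        true ∎
        where
        open ≡-Reasoning
        c d : Fin m → Fin m → Bool
        c i j = lt (f j) (f i)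
        d i j = lt i j xor lt (τ i) (τ j)
        diag : ∀ i → d i i ∧ c i i ≡ false
        diag i rewrite lt-irrefl (f i) = Boolₚ.∧-zeroʳ (d i i)
        reindex : parity (f ∘ τ) ≡ (⊕.sum λ i → ⊕.sum λ j → lt (τ i) (τ j) ∧ c i j)
        reindex = trans (⊕.sum-permute (λ i → ⊕.sum λ j → lt i j ∧ lt (f (τ j)) (f (τ i))) τ-perm)
          (⊕.sum-cong-≗ λ i → trans (⊕.sum-permute (λ j → lt (τ i) j ∧ lt (f (τ j)) (f (τ (τ i)))) τ-perm)
            (⊕.sum-cong-≗ λ j → cong₂ (λ x y → lt (τ i) (τ j) ∧ lt (f x) (f y)) (τ-τ j) (τ-τ i)))
        collapse : ∀ i j → lt i j ∧ ((d i j ∧ c i j) xor (d j i ∧ c j i)) ≡ lt i j ∧ not (lt (τ i) (τ j))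
        collapse i j with i ≟ᶠ j
        ... | yes refl rewrite lt-irrefl i = refl
        ... | no i≢j rewrite lt-flip i≢j | lt-flip {i = τ i} {τ j} (i≢j ∘ τ-injective) | lt-flip {i = f i} {f j} (i≢j ∘ f-inj)
          with lt i j | lt (τ i) (τ j) | lt (f i) (f j)
        ... | false | _     | _     = refl
        ... | true  | true  | _     = refl
        ... | true  | false | true  = refl
        ... | true  | false | false = refl

  parity-cong : ∀ {m} {f g : Fin m → Fin m} → (∀ i → f i ≡ g i) → parity f ≡ parity g
  parity-cong eq = ⊕⊕-cong λ i j → cong₂ (λ x y → lt i j ∧ lt x y) (eq j) (eq i)

  parity-id : ∀ m → parity {m} id ≡ false
  parity-id m = trans (⊕⊕-cong {m} {G = λ _ _ → false} lt-lt)
    (trans (⊕.sum-cong-≗ {m} λ _ → ⊕.sum-replicate-zero m) (⊕.sum-replicate-zero m))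
    where
    lt-lt : ∀ i j → lt i j ∧ lt j i ≡ false
    lt-lt i j with lt i j in p
    ... | false = refl
    ... | true  = <ᵇ-false⁺ (ℕₚ.<⇒≤ (<ᵇ-true⁻ {toℕ i} {toℕ j} p))

  xor-true⇒not : ∀ x {y} → x xor y ≡ true → y ≡ not x
  xor-true⇒not true  {false} _ = refl
  xor-true⇒not false {true}  _ = refl

  parity-∘transposition : ∀ {m} {a b : Fin m} → a ≢ b → (f : Fin m → Fin m) → (∀ {i j} → f i ≡ f j → i ≡ j) →
    parity (f ∘ Transposition.τ a b) ≡ not (parity f)
  parity-∘transposition {a = a} {b} a≢b f f-inj with ℕₚ.<-cmp (toℕ a) (toℕ b)
  ... | tri< a<b _ _ = xor-true⇒not (parity f) (parity-∘τ< a<b f f-inj)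
  ... | tri≈ _ a≡b _ = contradiction (Finₚ.toℕ-injective a≡b) a≢b
  ... | tri> _ _ b<a = trans (parity-cong λ i → cong f (τ-sym i)) (xor-true⇒not (parity f) (parity-∘τ< b<a f f-inj))
    where
    module T = Transposition a b
    module T′ = Transposition b a
    τ-sym : ∀ i → T.τ i ≡ T′.τ i
    τ-sym i = go (i ≟ᶠ a) (i ≟ᶠ b)
      where
      go : Dec (i ≡ a) → Dec (i ≡ b) → T.τ i ≡ T′.τ i
      go (yes refl) _          = trans T.τ-a (sym T′.τ-b)
      go (no _)     (yes refl) = trans T.τ-b (sym T′.τ-a)
      go (no i≢a)   (no i≢b)   = trans (T.τ-other i≢a i≢b) (sym (T′.τ-other i≢b i≢a))

  -- Boxes of the border strip

  boxesFrom : ℕ → ℕ → List ℕ → List (ℕ × ℕ)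
  boxesFrom row start []       = []
  boxesFrom row start (x ∷ xs) =
    map (λ p → row , start + p) (upTo x) ++ boxesFrom (suc row) (start + x ∸ 1) xs

  -- The left-hand side of go≡ is the helper local to boxList: it has no name
  -- outside Defs, and is found by unification from its use in boxList≡.
  mutual
    boxList≡ : ∀ c → boxList c ≡ boxesFrom 0 0 c
    boxList≡ [] = refl
    boxList≡ (x ∷ xs) with x ∷ xs | 1 | x ∸ 1
    ... | w | row | start = cong (map (λ p → 0 , p) (upTo x) ++_) (go≡ w row start xs)

    go≡ : ∀ (w : List ℕ) row start xs → _ ≡ boxesFrom row start xs
    go≡ w row start []       = refl
    go≡ w row start (x ∷ xs) = cong (map (λ p → row , start + p) (upTo x) ++_) (go≡ w (suc row) (start + x ∸ 1) xs)

  startBox : List ℕ → ℕ → ℕ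
  startBox []      _       = 0
  startBox (x ∷ c) zero    = 0
  startBox (x ∷ c) (suc ρ) = x + startBox c ρ

  startCol : ℕ → List ℕ → ℕ → ℕ
  startCol s _       zero    = s
  startCol s []      (suc ρ) = s
  startCol s (x ∷ c) (suc ρ) = startCol (s + x ∸ 1) c ρ

  startCol-suc : ∀ s c {ρ} → ρ < length c → startCol s c (suc ρ) ≡ startCol s c ρ + nthD 0 c ρ ∸ 1
  startCol-suc s (x ∷ c) {zero}  _        = refl
  startCol-suc s (x ∷ c) {suc ρ} (s≤s ρ<) = startCol-suc (s + x ∸ 1) c ρ<

  startBox-suc : ∀ c {ρ} → suc ρ < length c → startBox c (suc ρ) ≡ startBox c ρ + nthD 0 c ρ
  startBox-suc (x ∷ y ∷ c) {zero}  _        = ℕₚ.+-identityʳ x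
  startBox-suc (x ∷ c)     {suc ρ} (s≤s ρ<) = trans (cong (x +_) (startBox-suc c ρ<)) (sym (ℕₚ.+-assoc x _ _))

  nthD-++ˡ : ∀ {A : Set} {d : A} xs {ys i} → i < length xs → nthD d (xs ++ ys) i ≡ nthD d xs i
  nthD-++ˡ (x ∷ xs) {i = zero}  _        = refl
  nthD-++ˡ (x ∷ xs) {i = suc i} (s≤s i<) = nthD-++ˡ xs i<

  nthD-++ʳ : ∀ {A : Set} {d : A} xs {ys} i → nthD d (xs ++ ys) (length xs + i) ≡ nthD d ys i
  nthD-++ʳ []       i = refl
  nthD-++ʳ (x ∷ xs) i = nthD-++ʳ xs i

  nthD-applyUpTo : ∀ {A : Set} {d : A} (f : ℕ → A) {m i} → i < m → nthD d (applyUpTo f m) i ≡ f i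
  nthD-applyUpTo f {suc m} {zero}  _        = refl
  nthD-applyUpTo f {suc m} {suc i} (s≤s i<) = nthD-applyUpTo (f ∘ suc) i<

  nthD-boxesFrom : ∀ row s c ρ p → ρ < length c → p < nthD 0 c ρ →
    nthD (0 , 0) (boxesFrom row s c) (startBox c ρ + p) ≡ (row + ρ , startCol s c ρ + p)
  nthD-boxesFrom row s (x ∷ c) ρ p ρ< p<
    rewrite map-upTo (λ p → row , s + p) x with ρ
  ... | zero = trans (nthD-++ˡ (applyUpTo (λ p → row , s + p) x)
        (subst (p <_) (sym (length-applyUpTo _ x)) p<))
      (trans (nthD-applyUpTo (λ p → row , s + p) p<) (cong (_, s + p) (sym (ℕₚ.+-identityʳ row))))
  ... | suc ρ′ = trans (cong (nthD (0 , 0) (applyUpTo (λ p → row , s + p) x ++ boxesFrom (suc row) (s + x ∸ 1) c))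
        (trans (ℕₚ.+-assoc x _ p) (cong (_+ (startBox c ρ′ + p)) (sym (length-applyUpTo (λ p → row , s + p) x)))))
      (trans (nthD-++ʳ (applyUpTo (λ p → row , s + p) x) (startBox c ρ′ + p))
      (trans (nthD-boxesFrom (suc row) (s + x ∸ 1) c ρ′ p (s≤s⁻¹ ρ<) p<)
      (cong (_, startCol (s + x ∸ 1) c ρ′ + p) (sym (ℕₚ.+-suc row ρ′)))))

  startBox-< : ∀ c {ρ p} → ρ < length c → p < nthD 0 c ρ → startBox c ρ + p < sum c
  startBox-< (x ∷ c) {zero}  _        p< = ℕₚ.<-≤-trans p< (ℕₚ.m≤m+n x _)
  startBox-< (x ∷ c) {suc ρ} {p} (s≤s ρ<) p< = subst (_< x + sum c) (sym (ℕₚ.+-assoc x _ p))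
    (ℕₚ.+-monoʳ-< x (startBox-< c ρ< p<))

  box-position : ∀ c {b} → b < sum c → ∃₂ λ ρ p → ρ < length c × p < nthD 0 c ρ × b ≡ startBox c ρ + p
  box-position (x ∷ c) {b} b< with b <? x
  ... | yes b<x = 0 , b , s≤s z≤n , b<x , refl
  ... | no b≮x with ρ , p , ρ< , p< , eq ← box-position c {b ∸ x}
        (ℕₚ.+-cancelˡ-< x _ _ (subst (_< x + sum c) (sym (ℕₚ.m+[n∸m]≡n (ℕₚ.≮⇒≥ b≮x))) b<)) =
    suc ρ , p , s≤s ρ< , p< , trans (sym (ℕₚ.m+[n∸m]≡n (ℕₚ.≮⇒≥ b≮x))) (trans (cong (x +_) eq) (sym (ℕₚ.+-assoc x _ p)))

  count-toℕ-+ : ∀ x m (q : ℕ → Bool) →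
    count {x + m} (λ b → q (toℕ b)) ≡ count {x} (λ b → q (toℕ b)) + count {m} (λ b → q (x + toℕ b))
  count-toℕ-+ zero    m q = refl
  count-toℕ-+ (suc x) m q = trans (cong (b2n (q 0) +_) (count-toℕ-+ x m (q ∘ suc))) (sym (ℕₚ.+-assoc (b2n (q 0)) _ _))

  count-rows : ∀ row s c i → i < length c →
    count {sum c} (λ b → proj₁ (nthD (0 , 0) (boxesFrom row s c) (toℕ b)) ≡ᵇ row + i) ≡ nthD 0 c i
  count-rows row s (x ∷ c) i i< = trans (count-toℕ-+ x (sum c) (λ b → rowOf b ≡ᵇ row + i)) (cases i i<)
    where
    rowOf : ℕ → ℕ
    rowOf b = proj₁ (nthD (0 , 0) (boxesFrom row s (x ∷ c)) b)
    first : ∀ (b : Fin x) → rowOf (toℕ b) ≡ row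
    first b = trans (cong proj₁ (nthD-boxesFrom row s (x ∷ c) 0 (toℕ b) (s≤s z≤n) (Finₚ.toℕ<n b))) (ℕₚ.+-identityʳ row)
    rest : ∀ b → rowOf (x + b) ≡ proj₁ (nthD (0 , 0) (boxesFrom (suc row) (s + x ∸ 1) c) b)
    rest b = cong proj₁ (trans (cong (nthD (0 , 0) (boxesFrom row s (x ∷ c))) (cong (_+ b) (sym len)))
      (nthD-++ʳ (map (λ p → row , s + p) (upTo x)) b))
      where
      len : length (map (λ p → row , s + p) (upTo x)) ≡ x
      len = trans (cong length (map-upTo (λ p → row , s + p) x)) (length-applyUpTo (λ p → row , s + p) x)
    above : ∀ (b : Fin (sum c)) → rowOf (x + toℕ b) ≢ row
    above b eq with ρ , p , ρ< , p< , b≡ ← box-position c (Finₚ.toℕ<n b) =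
      ℕₚ.m+1+n≢m row (trans (ℕₚ.+-suc row ρ) (trans (sym (cong proj₁ (trans (cong (nthD (0 , 0) (boxesFrom (suc row) (s + x ∸ 1) c)) b≡)
        (nthD-boxesFrom (suc row) (s + x ∸ 1) c ρ p ρ< p<)))) (trans (sym (rest (toℕ b))) eq)))
    cases : ∀ i → i < suc (length c) →
      count {x} (λ b → rowOf (toℕ b) ≡ᵇ row + i) + count {sum c} (λ b → rowOf (x + toℕ b) ≡ᵇ row + i) ≡ nthD 0 (x ∷ c) i
    cases zero _ = trans (cong₂ _+_
      (count-all {x} λ b → ≡ᵇ-true⁺ (trans (first b) (sym (ℕₚ.+-identityʳ row))))
      (count-none {sum c} λ b → ≡ᵇ-false⁺ λ eq → above b (trans eq (ℕₚ.+-identityʳ row)))) (ℕₚ.+-identityʳ x)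
    cases (suc i) (s≤s i<) = cong₂ _+_
      (count-none {x} λ b → ≡ᵇ-false⁺ λ eq → ℕₚ.m+1+n≢m row (trans (sym eq) (first b)))
      (trans (count-cong {sum c} λ b → cong₂ _≡ᵇ_ (rest (toℕ b)) (ℕₚ.+-suc row i)) (count-rows (suc row) (s + x ∸ 1) c i i<))

  count-boxRow : ∀ {n} c → sum c ≡ n → ∀ i → i < length c → count {n} (λ b → boxRow c b ≡ᵇ i) ≡ nthD 0 c i
  count-boxRow c refl i i< = trans
    (count-cong {sum c} λ b → cong (λ L → proj₁ (nthD (0 , 0) L (toℕ b)) ≡ᵇ i) (boxList≡ c)) (count-rows 0 0 c i i<)

  module Boxes {n : ℕ} {c : List ℕ} (n≡ : sum c ≡ n) where

    box : ∀ {ρ p} → ρ < length c → p < nthD 0 c ρ → Fin n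
    box {ρ} {p} ρ< p< = fromℕ< {startBox c ρ + p} (subst (startBox c ρ + p <_) n≡ (startBox-< c ρ< p<))

    boxCoord-at : ∀ {ρ p} (b : Fin n) → ρ < length c → p < nthD 0 c ρ → toℕ b ≡ startBox c ρ + p →
      boxCoord c b ≡ (ρ , startCol 0 c ρ + p)
    boxCoord-at {ρ} {p} b ρ< p< b≡ = trans (cong₂ (nthD (0 , 0)) (boxList≡ c) b≡) (nthD-boxesFrom 0 0 c ρ p ρ< p<)

    boxCoord-box : ∀ {ρ p} (ρ< : ρ < length c) (p< : p < nthD 0 c ρ) → boxCoord c (box ρ< p<) ≡ (ρ , startCol 0 c ρ + p)
    boxCoord-box ρ< p< = boxCoord-at (box ρ< p<) ρ< p< (Finₚ.toℕ-fromℕ< (subst (_ <_) n≡ (startBox-< c ρ< p<)))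

    position : ∀ (b : Fin n) → ∃₂ λ ρ p → ρ < length c × p < nthD 0 c ρ × toℕ b ≡ startBox c ρ + p
    position b = box-position c (subst (toℕ b <_) (sym n≡) (Finₚ.toℕ<n b))

    boxRow< : ∀ (b : Fin n) → boxRow c b < length c
    boxRow< b with ρ , p , ρ< , p< , b≡ ← position b = subst (_< length c) (sym (cong proj₁ (boxCoord-at b ρ< p< b≡))) ρ<

    tabloidOf-∈ : ∀ (t : Permutation′ n) → tabloidOf c t ∈ tabloids n c
    tabloidOf-∈ t = ∈-tabloids⁺ {c = c} (tabloidOf c t)
      (λ e → subst (_< length c) (sym (row e)) (boxRow< (t ⟨$⟩ˡ e)))
      λ i i< → trans (count-cong λ e → cong (_≡ᵇ i) (row e))
        (trans (sym (count-permute (λ b → boxRow c b ≡ᵇ i) (flip t))) (count-boxRow c n≡ i i<))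
      where
      row : ∀ e → Vec.lookup (tabloidOf c t) e ≡ boxRow c (t ⟨$⟩ˡ e)
      row = Vecₚ.lookup∘tabulate (λ e → boxRow c (t ⟨$⟩ˡ e))

open Combinatorics

-- Finite sums and signs in the coefficient ring

module RingSums {a ℓ} (K : CommutativeRing a ℓ) where

  open CommutativeRing K
  open import Algebra.Properties.Ring ring
  import Algebra.Properties.CommutativeMonoid.Sum +-commutativeMonoid as S
  import Algebra.Properties.Semiring.Sum semiring as S*
  open import Relation.Binary.Reasoning.Setoid setoid

  -- Opaque, so that the summand can be inferred from a sum.
  opaque
    ∑ : ∀ {m} → (Fin m → Carrier) → Carrier
    ∑ = S.sum

    sum-[] : ∀ (f : Fin 0 → Carrier) → ∑ f ≡ 0#
    sum-[] f = ≡.refl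

    sum-∷ : ∀ {m} (f : Fin (suc m) → Carrier) → ∑ f ≡ f fzero + ∑ (f ∘ fsuc)
    sum-∷ f = ≡.refl

    sum-cong : ∀ {m} {f g : Fin m → Carrier} → (∀ i → f i ≈ g i) → ∑ f ≈ ∑ g
    sum-cong h = S.sum-cong-≋ h

    sum-const-0 : ∀ m → ∑ {m} (λ _ → 0#) ≈ 0#
    sum-const-0 = S.sum-replicate-zero

    sum-+ : ∀ {m} (f g : Fin m → Carrier) → ∑ (λ i → f i + g i) ≈ ∑ f + ∑ g
    sum-+ = S.∑-distrib-+

    sum-comm : ∀ {m n} (f : Fin m → Fin n → Carrier) → ∑ (λ i → ∑ λ j → f i j) ≈ ∑ (λ j → ∑ λ i → f i j)
    sum-comm = S.∑-comm

    sum-permute : ∀ {m} (f : Fin m → Carrier) (π : Permutation′ m) → ∑ f ≈ ∑ (λ i → f (π ⟨$⟩ʳ i))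
    sum-permute = S.sum-permute

    sum-remove : ∀ {m} i (f : Fin (suc m) → Carrier) → ∑ f ≈ f i + ∑ (λ j → f (punchIn i j))
    sum-remove i f = S.sum-remove {i = i} f

    *-distribˡ-sum : ∀ {m} s (f : Fin m → Carrier) → s * ∑ f ≈ ∑ λ i → s * f i
    *-distribˡ-sum = S*.*-distribˡ-sum

    *-distribʳ-sum : ∀ {m} s (f : Fin m → Carrier) → ∑ f * s ≈ ∑ λ i → f i * s
    *-distribʳ-sum = S*.*-distribʳ-sum

  private
    +-inv : ∀ {x y} → y ≈ - x → x + y ≈ 0#
    +-inv {x} e = trans (+-congˡ e) (-‿inverseʳ x)

  foldr-tabulate : ∀ {b} {A : Set b} {m} (f : A → Carrier) (g : Fin m → A) →
    foldr (λ x s → f x + s) 0# (tabulate g) ≡ ∑ (f ∘ g)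
  foldr-tabulate {m = zero}  f g = ≡.sym (sum-[] _)
  foldr-tabulate {m = suc m} f g = ≡.trans (≡.cong (f (g fzero) +_) (foldr-tabulate f (g ∘ fsuc))) (≡.sym (sum-∷ _))

  foldr-lookup : ∀ {b} {A : Set b} (L : List A) (f : A → Carrier) →
    foldr (λ x s → f x + s) 0# L ≡ ∑ (f ∘ lookupL L)
  foldr-lookup []      f = ≡.sym (sum-[] _)
  foldr-lookup (x ∷ L) f = ≡.trans (≡.cong (f x +_) (foldr-lookup L f)) (≡.sym (sum-∷ _))

  sum-zero : ∀ {m} {f : Fin m → Carrier} → (∀ i → f i ≈ 0#) → ∑ f ≈ 0#
  sum-zero {m} h = trans (sum-cong h) (sum-const-0 m)

  -- Transposition of the matrix `a`. The boundary, the map `f`, the group action and subdivision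
  -- are all moved across a pairing in this way.
  sum-exchange : ∀ {m n} (x : Fin m → Carrier) (a : Fin m → Fin n → Carrier) (b : Fin n → Carrier) →
    ∑ (λ j → ∑ (λ i → x i * a i j) * b j) ≈ ∑ (λ i → x i * ∑ (λ j → b j * a i j))
  sum-exchange x a b = begin
    ∑ (λ j → ∑ (λ i → x i * a i j) * b j)    ≈⟨ sum-cong (λ j → *-distribʳ-sum (b j) _) ⟩
    ∑ (λ j → ∑ (λ i → (x i * a i j) * b j))  ≈⟨ sum-comm (λ j i → (x i * a i j) * b j) ⟩
    ∑ (λ i → ∑ (λ j → (x i * a i j) * b j))  ≈⟨ sum-cong (λ i → trans (sum-cong λ j → trans (*-assoc _ _ _) (*-congˡ (*-comm _ _)))
                                                  (sym (*-distribˡ-sum (x i) _))) ⟩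
    ∑ (λ i → x i * ∑ (λ j → b j * a i j))    ∎

  sum-single : ∀ {m} {f : Fin m → Carrier} i → (∀ j → j ≢ i → f j ≈ 0#) → ∑ f ≈ f i
  sum-single {suc m} {f = f} i h = trans (sum-remove i f) (trans (+-congˡ (sum-zero λ j →
    h _ (Finₚ.punchInᵢ≢i i j))) (+-identityʳ _))

  sum-two : ∀ {m} {f : Fin (suc m) → Carrier} (q : Fin m) → (∀ j → j ≢ inject₁ q → j ≢ fsuc q → f j ≈ 0#) →
    f (inject₁ q) + f (fsuc q) ≈ 0# → ∑ f ≈ 0#
  sum-two {suc m} {f} fzero h e = trans (reflexive (sum-∷ f)) (trans (+-congˡ (sum-single {f = f ∘ fsuc} fzero
    λ j j≢ → h (fsuc j) (λ ()) (j≢ ∘ Finₚ.suc-injective))) e)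
  sum-two {suc m} {f} (fsuc q) h e = trans (reflexive (sum-∷ f)) (trans (+-cong (h fzero (λ ()) (λ ()))
    (sum-two {f = f ∘ fsuc} q (λ j p p′ → h (fsuc j) (p ∘ Finₚ.suc-injective) (p′ ∘ Finₚ.suc-injective)) e))
    (+-identityˡ 0#))

  ind : Bool → Carrier
  ind b = if b then 1# else 0#

  *-ind-true : ∀ {b} x → b ≡ true → x * ind b ≈ x
  *-ind-true x ≡.refl = *-identityʳ x

  *-ind-false : ∀ {b} x → b ≡ false → x * ind b ≈ 0#
  *-ind-false x ≡.refl = zeroʳ x

  sum-ind : ∀ {m} (p : Fin m → Bool) (g : Fin m → Carrier) i → p i ≡ true → (∀ j → p j ≡ true → j ≡ i) →
    ∑ (λ j → g j * ind (p j)) ≈ g i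
  sum-ind p g i pi h = trans (sum-single i λ j j≢i → *-ind-false (g j) (≢true⇒false (j≢i ∘ h j)))
    (*-ind-true (g i) pi)

  sum-ind-none : ∀ {m} (p : Fin m → Bool) (g : Fin m → Carrier) → (∀ j → p j ≡ false) →
    ∑ (λ j → g j * ind (p j)) ≈ 0#
  sum-ind-none p g h = sum-zero λ j → *-ind-false (g j) (h j)

  sum-neg : ∀ {m} (f : Fin m → Carrier) → ∑ (λ i → - f i) ≈ - ∑ f
  sum-neg {zero}  f = trans (reflexive (sum-[] _)) (trans (sym -0#≈0#) (-‿cong (sym (reflexive (sum-[] f)))))
  sum-neg {suc m} f = begin
    ∑ (λ i → - f i)                       ≡⟨ sum-∷ (λ i → - f i) ⟩
    - f fzero + ∑ (λ i → - f (fsuc i))    ≈⟨ +-congˡ (sum-neg (f ∘ fsuc)) ⟩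
    - f fzero + - ∑ (f ∘ fsuc)            ≈⟨ -‿+-comm _ _ ⟩
    - (f fzero + ∑ (f ∘ fsuc))            ≡⟨ ≡.cong -_ (sum-∷ f) ⟨
    - ∑ f                                 ∎

  -- Pairing i with ι i avoids dividing by 2 in S = - S.
  sum-involution : ∀ {m} (g : Fin m → Carrier) (p : Fin m → Bool) (ι : Fin m → Fin m) →
    (∀ i → ι (ι i) ≡ i) → (∀ i → p (ι i) ≡ not (p i)) → (∀ i → g (ι i) ≈ - g i) → ∑ g ≈ 0#
  sum-involution g p ι ιι pι gι = begin
    ∑ g                                                      ≈⟨ sum-cong split ⟩
    ∑ (λ i → g i * ind (p i) + g i * ind (not (p i)))        ≈⟨ sum-+ (λ i → g i * ind (p i)) (λ i → g i * ind (not (p i))) ⟩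
    ∑ (λ i → g i * ind (p i)) + ∑ (λ i → g i * ind (not (p i)))  ≈⟨ +-inv other ⟩
    0#                                                         ∎
    where
    split : ∀ i → g i ≈ g i * ind (p i) + g i * ind (not (p i))
    split i with p i
    ... | true  = sym (trans (+-cong (*-identityʳ _) (zeroʳ _)) (+-identityʳ _))
    ... | false = sym (trans (+-cong (zeroʳ _) (*-identityʳ _)) (+-identityˡ _))
    flipped : ∀ i → g (ι i) * ind (not (p (ι i))) ≈ - (g i * ind (p i))
    flipped i rewrite pι i with p i
    ... | true  = trans (*-congʳ (gι i)) (sym (-‿distribˡ-* _ _))
    ... | false = trans (zeroʳ _) (trans (sym -0#≈0#) (-‿cong (sym (zeroʳ _))))
    other : ∑ (λ i → g i * ind (not (p i))) ≈ - ∑ (λ i → g i * ind (p i))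
    other = begin
      ∑ (λ i → g i * ind (not (p i)))              ≈⟨ sum-permute (λ i → g i * ind (not (p i))) (permutation ι ι ιι ιι) ⟩
      ∑ (λ i → g (ι i) * ind (not (p (ι i))))      ≈⟨ sum-cong flipped ⟩
      ∑ (λ i → - (g i * ind (p i)))                ≈⟨ sum-neg (λ i → g i * ind (p i)) ⟩
      - ∑ (λ i → g i * ind (p i))                  ∎

  sg : ℕ → Carrier
  sg k = if isEvenᵇ k then 1# else - 1#

  sg-suc : ∀ k → sg (suc k) ≈ - sg k
  sg-suc zero          = refl
  sg-suc (suc zero)    = sym (-‿involutive 1#)
  sg-suc (suc (suc k)) = sg-suc k

  sg-+ : ∀ j k → sg (j +ℕ k) ≈ sg j * sg k
  sg-+ zero    k = sym (*-identityˡ _)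
  sg-+ (suc j) k = begin
    sg (suc (j +ℕ k))  ≈⟨ sg-suc (j +ℕ k) ⟩
    - sg (j +ℕ k)      ≈⟨ -‿cong (sg-+ j k) ⟩
    - (sg j * sg k)    ≈⟨ -‿distribˡ-* (sg j) (sg k) ⟩
    - sg j * sg k      ≈⟨ *-congʳ (sg-suc j) ⟨
    sg (suc j) * sg k  ∎

  sg-square : ∀ k → sg k * sg k ≈ 1#
  sg-square zero          = *-identityˡ 1#
  sg-square (suc zero)    = trans (-1*x≈-x (- 1#)) (-‿involutive 1#)
  sg-square (suc (suc k)) = sg-square k

  sg-double : ∀ k → sg (k +ℕ k) ≈ 1#
  sg-double k = trans (sg-+ k k) (sg-square k)

  sg-cancel : ∀ k {x} → x * sg k ≈ 0# → x ≈ 0#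
  sg-cancel k {x} h = begin
    x                  ≈⟨ *-identityʳ x ⟨
    x * 1#             ≈⟨ *-congˡ (sg-square k) ⟨
    x * (sg k * sg k)  ≈⟨ *-assoc x _ _ ⟨
    x * sg k * sg k    ≈⟨ *-congʳ h ⟩
    0# * sg k          ≈⟨ zeroˡ _ ⟩
    0#                 ∎

  -- The cancellation behind ∂∂ = 0, for a family with the simplicial symmetry.
  sum-∂∂ : ∀ r (G : ℕ → ℕ → Carrier) → (∀ i j → i ≤ j → G i j ≈ G (suc j) i) →
    ∑ {suc r} (λ i → ∑ {r} λ j → (sg (toℕ i) * sg (toℕ j)) * G (toℕ i) (toℕ j)) ≈ 0#
  sum-∂∂ zero    G h = sum-zero λ i → reflexive (sum-[] _)
  sum-∂∂ (suc r) G h = begin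
    ∑ {suc (suc r)} (λ i → ∑ {suc r} λ j → term (toℕ i) (toℕ j))
      ≡⟨ sum-∷ _ ⟩
    ∑ {suc r} (λ j → term 0 (toℕ j)) + ∑ {suc r} (λ i → ∑ {suc r} λ j → term (suc (toℕ i)) (toℕ j))
      ≈⟨ +-congˡ (sum-cong λ i → reflexive (sum-∷ _)) ⟩
    ∑ {suc r} (λ j → term 0 (toℕ j)) + ∑ {suc r} (λ i → term (suc (toℕ i)) 0 + ∑ {r} (λ j → term (suc (toℕ i)) (suc (toℕ j))))
      ≈⟨ +-congˡ (sum-+ _ _) ⟩
    ∑ {suc r} (λ j → term 0 (toℕ j)) + (∑ {suc r} (λ i → term (suc (toℕ i)) 0) + ∑ {suc r} (λ i → ∑ {r} (λ j → term (suc (toℕ i)) (suc (toℕ j)))))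
      ≈⟨ +-assoc _ _ _ ⟨
    (∑ {suc r} (λ j → term 0 (toℕ j)) + ∑ {suc r} (λ i → term (suc (toℕ i)) 0)) + ∑ {suc r} (λ i → ∑ {r} (λ j → term (suc (toℕ i)) (suc (toℕ j))))
      ≈⟨ +-cong border inner ⟩
    0# + 0#
      ≈⟨ +-identityˡ 0# ⟩
    0# ∎
    where
    term : ℕ → ℕ → Carrier
    term i j = (sg i * sg j) * G i j
    edge : ∀ j → term (suc j) 0 ≈ - term 0 j
    edge j = begin
      (sg (suc j) * 1#) * G (suc j) 0  ≈⟨ *-cong (trans (*-identityʳ _) (sg-suc j)) (sym (h 0 j z≤n)) ⟩
      - sg j * G 0 j                   ≈⟨ -‿distribˡ-* _ _ ⟨
      - (sg j * G 0 j)                 ≈⟨ -‿cong (*-congʳ (*-identityˡ _)) ⟨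
      - ((1# * sg j) * G 0 j)          ∎
    border : ∑ {suc r} (λ j → term 0 (toℕ j)) + ∑ {suc r} (λ i → term (suc (toℕ i)) 0) ≈ 0#
    border = +-inv (trans (sum-cong {suc r} λ j → edge (toℕ j)) (sum-neg {suc r} (λ j → term 0 (toℕ j))))
    signs : ∀ i j → sg (suc i) * sg (suc j) ≈ sg i * sg j
    signs i j = begin
      sg (suc i) * sg (suc j)  ≈⟨ *-cong (sg-suc i) (sg-suc j) ⟩
      - sg i * - sg j          ≈⟨ -‿distribˡ-* _ _ ⟨
      - (sg i * - sg j)        ≈⟨ -‿cong (-‿distribʳ-* _ _) ⟨
      - - (sg i * sg j)        ≈⟨ -‿involutive _ ⟩
      sg i * sg j              ∎
    inner : ∑ {suc r} (λ i → ∑ {r} (λ j → term (suc (toℕ i)) (suc (toℕ j)))) ≈ 0#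
    inner = trans (sum-cong {suc r} λ i → sum-cong {r} λ j → *-congʳ {G (suc (toℕ i)) (suc (toℕ j))} (signs (toℕ i) (toℕ j)))
      (sum-∂∂ r (λ i j → G (suc i) (suc j)) λ i j i≤j → h (suc i) (suc j) (s≤s i≤j))

-- The chain complex and the vanishing of cycles

tabloidEqᵇ⁻ : ∀ {n} (T U : Tabloid n) → tabloidEqᵇ T U ≡ true → T ≡ U
tabloidEqᵇ⁻ T U p = lookup-ext λ e → ≡ᵇ-true⁻ (allB⁻ (λ e → lookup T e ≡ᵇ lookup U e) p e)

tabloidEqᵇ⁺ : ∀ {n} {T U : Tabloid n} → T ≡ U → tabloidEqᵇ T U ≡ true
tabloidEqᵇ⁺ {T = T} ≡.refl = allB⁺ (λ e → lookup T e ≡ᵇ lookup T e) λ e → ≡ᵇ-true⁺ {lookup T e} ≡.refl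

chainEqᵇ⁻ : ∀ {m r} (σ τ : Vec (Rel m) r) → chainEqᵇ σ τ ≡ true → σ ≡ τ
chainEqᵇ⁻ σ τ p = lookup-ext λ q → isYes⁻ _ (allB⁻ (λ q → relEqᵇ (lookup σ q) (lookup τ q)) p q)

chainEqᵇ⁺ : ∀ {m r} {σ τ : Vec (Rel m) r} → σ ≡ τ → chainEqᵇ σ τ ≡ true
chainEqᵇ⁺ {σ = σ} ≡.refl = allB⁺ (λ q → relEqᵇ (lookup σ q) (lookup σ q)) λ q → isYes⁺ _ ≡.refl

⊏-trans : ∀ {m} {E F G : Rel m} → E ⊏ F → F ⊏ G → E ⊏ G
⊏-trans (p , _) (q , ¬q) = ⊑-trans p q , λ r → ¬q (⊑-trans r p)

⊏-hd-removeAt : ∀ {n c m E} {σ : RelChain n (suc m)} → E ⊏ hd σ → Valid c σ → ∀ p → E ⊏ hd (removeAt σ p)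
⊏-hd-removeAt lt (cons el lt′ v) fzero                  = ⊏-trans lt lt′
⊏-hd-removeAt lt (cons {σ = _ ∷ _} el lt′ v) (fsuc p) = lt

valid-removeAt : ∀ {n c m} {σ : RelChain n (suc m)} → Valid c σ → ∀ p → Valid c (removeAt σ p)
valid-removeAt (cons el lt v) fzero = v
valid-removeAt (cons {σ = _ ∷ _} el lt v) (fsuc p) = cons el (⊏-hd-removeAt lt v p) (valid-removeAt v p)

module Complex {a ℓ} (K : CommutativeRing a ℓ) (n x₀ : ℕ) (c′ : List ℕ) where
  open CommutativeRing K
  open RingSums K
  open import Relation.Binary.Reasoning.Setoid setoid
  c = x₀ ∷ c′
  open Hom K n c

  sumFin≡sum : ∀ {m} (f : Fin m → Carrier) → sumFin f ≡ ∑ f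
  sumFin≡sum f = foldr-tabulate f id

  sumFin≈sum : ∀ {m} (f : Fin m → Carrier) → sumFin f ≈ ∑ f
  sumFin≈sum f = reflexive (sumFin≡sum f)

  simplex-valid : ∀ m i → Valid c (simplex m i)
  simplex-valid m i = ∈-simplices⁻ (∈ₚ.∈-lookup i)

  simplexIndex : ∀ {m} {σ : RelChain n m} → Valid c σ → ∃ λ i → simplex m i ≡ σ
  simplexIndex v = index (∈-simplices⁺ v) , ≡.sym (Anyₚ.lookup-index (∈-simplices⁺ v))

  simplex-injective : ∀ m i j → simplex m i ≡ simplex m j → i ≡ j
  simplex-injective m = lookup-injective (simplices-unique n c m)

  tabloidIndex : ∀ {T} → T ∈ tabloids n c → ∃ λ j → tabloid j ≡ T
  tabloidIndex T∈ = index T∈ , ≡.sym (Anyₚ.lookup-index T∈)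

  tabloid-injective : ∀ i j → tabloid i ≡ tabloid j → i ≡ j
  tabloid-injective = lookup-injective (tabloids-unique n c)

  sum-tabloid-δ : ∀ {T} (Ψ : Tabloid n → Carrier) → T ∈ tabloids n c →
    ∑ (λ j → Ψ (tabloid j) * ind (tabloidEqᵇ T (tabloid j))) ≈ Ψ T
  sum-tabloid-δ {T} Ψ T∈ with i , ≡.refl ← tabloidIndex T∈ =
    sum-ind (λ j → tabloidEqᵇ (tabloid i) (tabloid j)) (Ψ ∘ tabloid) i (tabloidEqᵇ⁺ {T = tabloid i} ≡.refl)
      λ j p → tabloid-injective j i (≡.sym (tabloidEqᵇ⁻ _ _ p))

  sum-tabloid-δ-none : ∀ {T} (Ψ : Tabloid n → Carrier) → ¬ (T ∈ tabloids n c) →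
    ∑ (λ j → Ψ (tabloid j) * ind (tabloidEqᵇ T (tabloid j))) ≈ 0#
  sum-tabloid-δ-none {T} Ψ T∉ = sum-ind-none (λ j → tabloidEqᵇ T (tabloid j)) (Ψ ∘ tabloid)
    λ j → ≢true⇒false λ p → T∉ (subst (_∈ tabloids n c) (≡.sym (tabloidEqᵇ⁻ T (tabloid j) p)) (∈ₚ.∈-lookup j))

  sum-simplex-δ : ∀ {m} {σ : RelChain n m} (ψ : RelChain n m → Carrier) → Valid c σ →
    ∑ (λ j → ψ (simplex m j) * ind (chainEqᵇ σ (simplex m j))) ≈ ψ σ
  sum-simplex-δ {m} {σ} ψ v with i , ≡.refl ← simplexIndex v =
    sum-ind (λ j → chainEqᵇ (simplex m i) (simplex m j)) (ψ ∘ simplex m) i (chainEqᵇ⁺ {σ = simplex m i} ≡.refl)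
      λ j p → simplex-injective m j i (≡.sym (chainEqᵇ⁻ _ _ p))

  -- The simplicial coboundary, defined on arbitrary vectors so that it can be computed face by face
  -- without indices into the list of simplices.
  δ : ∀ {m} → (RelChain n m → Carrier) → RelChain n (suc m) → Carrier
  δ ψ σ = ∑ λ p → sg (toℕ p) * ψ (removeAt σ p)

  incidence≈ : ∀ {m} (σ : RelChain n (suc m)) τ →
    incidence σ τ ≈ δ (λ ρ → ind (chainEqᵇ ρ τ)) σ
  incidence≈ σ τ = sumFin≈sum λ p → sg (toℕ p) * ind (chainEqᵇ (removeAt σ p) τ)

  -- Each face of a simplex occurs exactly once in the list of simplices, so summing over that list
  -- recovers the sum over faces.
  sum-incidence : ∀ {m} {σ : RelChain n (suc m)} (ψ : RelChain n m → Carrier) → Valid c σ →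
    ∑ (λ j → incidence σ (simplex m j) * ψ (simplex m j)) ≈ δ ψ σ
  sum-incidence {m} {σ} ψ v = begin
    ∑ (λ j → incidence σ (simplex m j) * ψ (simplex m j))
      ≈⟨ sum-cong (λ j → *-congʳ (incidence≈ σ (simplex m j))) ⟩
    ∑ (λ j → ∑ (λ p → sg (toℕ p) * ind (chainEqᵇ (removeAt σ p) (simplex m j))) * ψ (simplex m j))
      ≈⟨ sum-exchange (sg ∘ toℕ) _ (ψ ∘ simplex m) ⟩
    ∑ (λ p → sg (toℕ p) * ∑ λ j → ψ (simplex m j) * ind (chainEqᵇ (removeAt σ p) (simplex m j)))
      ≈⟨ sum-cong (λ p → *-congˡ (sum-simplex-δ ψ (valid-removeAt v p))) ⟩
    δ ψ σ ∎

  ∂≈ : ∀ m y j → ∂ m y j ≈ ∑ λ i → y i * incidence (simplex (suc m) i) (simplex m j)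
  ∂≈ m y j = sumFin≈sum _

  -- The map induced by π ↦ [n] ∖ Z π on chains.
  f : ∀ m → Chains m → Mᴮ
  f m y j = ∑ λ i → y i * ind (tabloidEqᵇ (hT (simplex m i)) (tabloid j))

  f-pairing : ∀ m y (Ψ : Tabloid n → Carrier) →
    ∑ (λ j → f m y j * Ψ (tabloid j)) ≈
    ∑ (λ i → y i * ∑ λ j → Ψ (tabloid j) * ind (tabloidEqᵇ (hT (simplex m i)) (tabloid j)))
  f-pairing m y Ψ = sum-exchange y _ (Ψ ∘ tabloid)

  AllRanks : ℕ → Set
  AllRanks m = ∀ {σ : RelChain n m} → Valid c σ → Vec.map rank σ ≡ countdown m

  private
    module Stall {m : ℕ} (ranks : AllRanks (suc m)) (i : Fin (length (simplices n c (suc m)))) (q : Fin m)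
      (stall : LastStall (simplex (suc m) i) q) where

      face : Fin (length (simplices n c (suc m))) → Fin (suc m) → RelChain n m
      face k p = removeAt (simplex (suc m) k) p

      j : Fin (length (simplices n c m))
      j = proj₁ (simplexIndex (valid-removeAt (simplex-valid (suc m) i) (fsuc q)))

      simplex-j : simplex m j ≡ face i (fsuc q)
      simplex-j = proj₂ (simplexIndex (valid-removeAt (simplex-valid (suc m) i) (fsuc q)))

      face-ranks : ∀ k p → Vec.map rank (face k p) ≡ removeAt (countdown (suc m)) p
      face-ranks k p = ≡.trans (map-removeAt rank (simplex (suc m) k) p)
        (cong (λ v → removeAt v p) (ranks (simplex-valid (suc m) k)))

      -- The ranks of a top chain are forced and distinct, so those of a face show which position
      -- was omitted.
      same-position : ∀ k p → face k p ≡ simplex m j → p ≡ fsuc q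
      same-position k p eq = removeAt-injective (countdown (suc m)) (countdown-injective (suc m)) p (fsuc q)
        (≡.trans (≡.sym (face-ranks k p)) (≡.trans (cong (Vec.map rank) (≡.trans eq simplex-j)) (face-ranks i (fsuc q))))

      incidence-self : incidence (simplex (suc m) i) (simplex m j) ≈ sg (suc (toℕ q))
      incidence-self = trans (incidence≈ (simplex (suc m) i) (simplex m j))
        (sum-ind (λ p → chainEqᵇ (face i p) (simplex m j)) (λ p → sg (toℕ p)) (fsuc q)
          (chainEqᵇ⁺ (≡.sym simplex-j)) λ p eq → same-position i p (chainEqᵇ⁻ _ _ eq))

      incidence-other : ∀ k → face k (fsuc q) ≢ simplex m j → incidence (simplex (suc m) k) (simplex m j) ≈ 0#
      incidence-other k ne = trans (incidence≈ (simplex (suc m) k) (simplex m j))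
        (sum-ind-none (λ p → chainEqᵇ (face k p) (simplex m j)) (λ p → sg (toℕ p)) λ p → ≢true⇒false λ t →
          let eq = chainEqᵇ⁻ (face k p) (simplex m j) t in
          ne (subst (λ p → face k p ≡ simplex m j) (same-position k p eq) eq))

      exchange : ∀ k → k ≢ i → face k (fsuc q) ≡ simplex m j →
        total (simplex (suc m) i) < total (simplex (suc m) k)
      exchange k k≢i eq = [ (λ p → contradiction (≡.sym (simplex-injective (suc m) i k p)) k≢i) , id ]′
        (stall-exchange (simplex-valid (suc m) i) (simplex-valid (suc m) k) (ranks (simplex-valid (suc m) i))
          (ranks (simplex-valid (suc m) k)) q stall (≡.trans (≡.sym simplex-j) (≡.sym eq)))

      face? : ∀ k → Dec (face k (fsuc q) ≡ simplex m j)
      face? k = Vecₚ.≡-dec (Vecₚ.≡-dec (Vecₚ.≡-dec Boolₚ._≟_)) (face k (fsuc q)) (simplex m j)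

      -- In the cycle equation at the face omitting the element after the stall, every other chain
      -- involved has a larger total and coefficient zero. Only `y i` times a sign remains.
      vanishes : ∀ y → IsCycle (suc m) y → (∀ k → total (simplex (suc m) i) < total (simplex (suc m) k) → y k ≈ 0#) →
        y i ≈ 0#
      vanishes y cycle larger = sg-cancel (suc (toℕ q)) (begin
        y i * sg (suc (toℕ q))                                         ≈⟨ *-congˡ incidence-self ⟨
        y i * incidence (simplex (suc m) i) (simplex m j)              ≈⟨ sum-single i (λ k k≢i → others k k≢i (face? k)) ⟨
        ∑ (λ k → y k * incidence (simplex (suc m) k) (simplex m j))  ≈⟨ ∂≈ m y j ⟨
        ∂ m y j                                                        ≈⟨ cycle j ⟩
        0#                                                             ∎)
        where
        others : ∀ k → k ≢ i → Dec (face k (fsuc q) ≡ simplex m j) → y k * incidence (simplex (suc m) k) (simplex m j) ≈ 0#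
        others k k≢i (yes eq) = trans (*-congʳ (larger k (exchange k k≢i eq))) (zeroˡ _)
        others k k≢i (no ne)  = trans (*-congˡ (incidence-other k ne)) (zeroʳ _)

    []-Grows : ∀ (σ : RelChain n 0) → Grows σ
    []-Grows [] = []

  cycle-zero-step : ∀ m y → IsCycle m y → AllRanks m → ∀ i → (Grows (simplex m i) → y i ≈ 0#) →
    (∀ k → total (simplex m i) < total (simplex m k) → y k ≈ 0#) → y i ≈ 0#
  cycle-zero-step zero    y cycle ranks i base larger = base ([]-Grows (simplex 0 i))
  cycle-zero-step (suc m) y cycle ranks i base larger =
    [ base , (λ (q , stall) → Stall.vanishes ranks i q stall y cycle larger) ]′ (grows-or-stalls (simplex-valid (suc m) i))

  -- Descending induction on `total`, which never exceeds `m` times `n`; `fuel` measures the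
  -- distance to this bound.
  cycle-zero : ∀ m y → IsCycle m y → AllRanks m → (∀ i → Grows (simplex m i) → y i ≈ 0#) →
    ∀ fuel i → m *ℕ n < total (simplex m i) +ℕ fuel → y i ≈ 0#
  cycle-zero m y cycle ranks base zero       i lt = contradiction (total≤ (simplex m i))
    (ℕₚ.<⇒≱ (subst (m *ℕ n <_) (ℕₚ.+-identityʳ _) lt))
  cycle-zero m y cycle ranks base (suc fuel) i lt = cycle-zero-step m y cycle ranks i (base i)
    λ k tot< → cycle-zero m y cycle ranks base fuel k (ℕₚ.<-≤-trans lt (ℕₚ.≤-trans
      (ℕₚ.≤-reflexive (ℕₚ.+-suc _ fuel)) (ℕₚ.+-monoˡ-≤ fuel tot<)))

  -- y is a top cycle of the rank-selected Boolean lattice: merging any two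
  -- adjacent rows kills it.  Quantifying over Ψ avoids naming the tabloids of the
  -- merged shapes.
  IsZ : ℕ → Mᴮ → Set _
  IsZ m y = ∀ i → i < m → (Ψ : Tabloid n → Carrier) → ∑ (λ j → y j * Ψ (mgV i (tabloid j))) ≈ 0#

-- Injectivity of `f` on cycles, and its image

valid-⊑ : ∀ {n c m} {σ : RelChain n (suc m)} → Valid c σ → ∀ q → lookup σ (inject₁ q) ⊑ lookup σ (fsuc q)
valid-⊑ (cons _ lt (cons _ _ _)) fzero    = proj₁ lt
valid-⊑ (cons {σ = _ ∷ _} _ _ v) (fsuc q) = valid-⊑ v q

module Comparison {a ℓ} (K : CommutativeRing a ℓ) (n x₀ : ℕ) (c′ : List ℕ)
  (pos : All (0 <_) (x₀ ∷ c′)) (n≡ : sum (x₀ ∷ c′) ≡ n) where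
  open CommutativeRing K
  open RingSums K
  open Complex K n x₀ c′
  open Hom K n c
  open import Algebra.Properties.Ring ring
  open import Relation.Binary.Reasoning.Setoid setoid

  r : ℕ
  r = length c′

  -- A growing chain is the only maximal chain with its tabloid, so its coefficient is a coefficient
  -- of `f r y`. This is the base case that `cycle-zero` needs.
  f-injective : ∀ y → IsCycle r y → (∀ j → f r y j ≈ 0#) → ∀ i → y i ≈ 0#
  f-injective y cycle fy≈0 i = cycle-zero r y cycle valid-ranks grown (suc (r *ℕ n)) i (ℕₚ.m≤n+m (suc (r *ℕ n)) _)
    where
    grown : ∀ i → Grows (simplex r i) → y i ≈ 0#
    grown i g = begin
      y i        ≈⟨ sum-ind (λ k → tabloidEqᵇ (hT (simplex r k)) (tabloid j)) y i (tabloidEqᵇ⁺ (≡.sym eqj)) only ⟨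
      f r y j    ≈⟨ fy≈0 j ⟩
      0#         ∎
      where
      hTσ∈ : hT (simplex r i) ∈ tabloids n c
      hTσ∈ = grows-tabloid {c′ = c′} pos n≡ (simplex-valid r i) g
      j = proj₁ (tabloidIndex hTσ∈)
      eqj : tabloid j ≡ hT (simplex r i)
      eqj = proj₂ (tabloidIndex hTσ∈)
      only : ∀ k → tabloidEqᵇ (hT (simplex r k)) (tabloid j) ≡ true → k ≡ i
      only k p = ≡.sym (simplex-injective r i k (grows-unique (simplex-valid r i) (simplex-valid r k) g
        (valid-ranks (simplex-valid r i)) (valid-ranks (simplex-valid r k))
        (hT-determines-Z (simplex-valid r i) (simplex-valid r k) (≡.trans (≡.sym eqj) (≡.sym (tabloidEqᵇ⁻ _ _ p))))))

  -- Test ∂ y ≈ 0 against Ψ ∘ hT restricted to the chains with the sizes of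
  -- pointed blocks found in a generic chain with its p-th element removed.
  -- On a chain with two equal pointed blocks the two surviving faces cancel.
  private
    module Test {m : ℕ} (m< : suc m < length c) (S : Vec ℕ (suc m)) (S-inj : VecInj S)
      (grown-sizes : ∀ {σ : RelChain n (suc m)} → Valid c σ → Grows σ → Vec.map zs σ ≡ S)
      (grown-tabloid : ∀ {σ : RelChain n (suc m)} → Valid c σ → Grows σ → hT σ ∈ tabloids n c)
      (i : ℕ) (p : Fin (suc m)) (p↔i : lookup (countdown (suc m)) p ≡ suc i) (Ψ : Tabloid n → Carrier) where

      Ψ′ : Tabloid n → Carrier
      Ψ′ T = Ψ (mgV i T)

      fits : RelChain n m → Bool
      fits τ = tabloidEqᵇ (Vec.map zs τ) (removeAt S p)

      ψ : RelChain n m → Carrier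
      ψ τ = Ψ (hT τ) * ind (fits τ)

      Σ-tabloids : RelChain n (suc m) → Carrier
      Σ-tabloids σ = ∑ λ j → Ψ′ (tabloid j) * ind (tabloidEqᵇ (hT σ) (tabloid j))

      -- The sizes are pairwise distinct, so only the face omitting position `p` fits, and its
      -- tabloid is that of `σ` with rows `i` and `i + 1` merged.
      δψ-grows : ∀ {σ : RelChain n (suc m)} → Valid c σ → Grows σ → δ ψ σ ≈ sg (toℕ p) * Σ-tabloids σ
      δψ-grows {σ} v g = begin
        δ ψ σ                           ≈⟨ sum-single p (λ q q≢p → trans (*-congˡ (*-ind-false _ (≢true⇒false (q≢p ∘ only q)))) (zeroʳ _)) ⟩
        sg (toℕ p) * ψ (removeAt σ p)   ≈⟨ *-congˡ (trans (*-ind-true _ (tabloidEqᵇ⁺ (face p))) (reflexive (cong Ψ merged))) ⟩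
        sg (toℕ p) * Ψ′ (hT σ)          ≈⟨ *-congˡ (sum-tabloid-δ Ψ′ (grown-tabloid v g)) ⟨
        sg (toℕ p) * Σ-tabloids σ       ∎
        where
        face : ∀ q → Vec.map zs (removeAt σ q) ≡ removeAt S q
        face q = ≡.trans (map-removeAt zs σ q) (cong (λ w → removeAt w q) (grown-sizes v g))
        only : ∀ q → fits (removeAt σ q) ≡ true → q ≡ p
        only q t = removeAt-injective S S-inj q p (≡.trans (≡.sym (face q)) (tabloidEqᵇ⁻ _ _ t))
        merged : hT (removeAt σ p) ≡ mgV i (hT σ)
        merged = ≡.trans (hT-removeAt v p) (cong (λ d → mgV (d ∸ 1) (hT σ)) p↔i)

      -- A face keeping both elements of the stall repeats a size and does not fit. The right-hand
      -- side is zero too, since such a chain gives no tabloid of shape `B`.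
      δψ-stalls : ∀ {σ : RelChain n (suc m)} → Valid c σ → ∃ (LastStall σ) → δ ψ σ ≈ sg (toℕ p) * Σ-tabloids σ
      δψ-stalls {σ} v (q , stall , _) = trans
        (sum-two q (λ j j≢q j≢q′ → trans (*-congˡ (*-ind-false _ (≢true⇒false (misfit j≢q j≢q′)))) (zeroʳ _)) cancel)
        (sym (trans (*-congˡ (sum-tabloid-δ-none Ψ′ (stall-no-tabloid pos m< v q zz))) (zeroʳ _)))
        where
        q′ = inject₁ q
        adjacent : lookup (Vec.map zs σ) q′ ≡ lookup (Vec.map zs σ) (fsuc q)
        adjacent = ≡.trans (Vecₚ.lookup-map q′ zs σ) (≡.trans stall (≡.sym (Vecₚ.lookup-map (fsuc q) zs σ)))
        q′≢ : q′ ≢ fsuc q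
        q′≢ e = ℕₚ.<⇒≢ ℕₚ.≤-refl (≡.trans (≡.sym (Finₚ.toℕ-inject₁ q)) (cong toℕ e))
        misfit : ∀ {j} → j ≢ q′ → j ≢ fsuc q → ¬ (fits (removeAt σ j) ≡ true)
        misfit {j} j≢q j≢q′ t = removeAt-≢ {v = Vec.map zs σ} {S} S-inj q′≢ adjacent j≢q j≢q′
          (≡.trans (≡.sym (map-removeAt zs σ j)) (tabloidEqᵇ⁻ _ _ t))
        zz : ∀ e → Z (lookup σ q′) e ≡ Z (lookup σ (fsuc q)) e
        zz = Z-ext (valid-⊑ v q) (ℕₚ.≤-reflexive (≡.sym stall))
        ψ-same : ψ (removeAt σ q′) ≡ ψ (removeAt σ (fsuc q))
        ψ-same = cong₂ (λ T w → Ψ T * ind (tabloidEqᵇ w (removeAt S p)))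
          (Vecₚ.tabulate-cong λ e → h-removeAt-adjacent σ q e (zz e))
          (≡.trans (map-removeAt zs σ q′) (≡.trans (removeAt-adjacent (Vec.map zs σ) q adjacent) (≡.sym (map-removeAt zs σ (fsuc q)))))
        cancel : sg (toℕ q′) * ψ (removeAt σ q′) + sg (toℕ (fsuc q)) * ψ (removeAt σ (fsuc q)) ≈ 0#
        cancel = begin
          sg (toℕ q′) * ψ (removeAt σ q′) + sg (suc (toℕ q)) * ψ (removeAt σ (fsuc q))
            ≈⟨ +-cong (*-cong (reflexive (cong sg (Finₚ.toℕ-inject₁ q))) (reflexive ψ-same)) (*-congʳ (sg-suc (toℕ q))) ⟩
          sg (toℕ q) * ψ (removeAt σ (fsuc q)) + - sg (toℕ q) * ψ (removeAt σ (fsuc q))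
            ≈⟨ distribʳ _ _ _ ⟨
          (sg (toℕ q) + - sg (toℕ q)) * ψ (removeAt σ (fsuc q))
            ≈⟨ trans (*-congʳ (-‿inverseʳ _)) (zeroˡ _) ⟩
          0# ∎

      δψ : ∀ {σ : RelChain n (suc m)} → Valid c σ → δ ψ σ ≈ sg (toℕ p) * Σ-tabloids σ
      δψ v = [ δψ-grows v , δψ-stalls v ]′ (grows-or-stalls v)

      -- Up to the sign of position `p`, the sum is the pairing of `y` with `δ ψ`, that is, of `∂ y`
      -- with `ψ`.
      vanishes : ∀ y → IsCycle (suc m) y → ∑ (λ j → f (suc m) y j * Ψ′ (tabloid j)) ≈ 0#
      vanishes y cycle = sg-cancel (toℕ p) (begin
        ∑ (λ j → f (suc m) y j * Ψ′ (tabloid j)) * sg (toℕ p)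
          ≈⟨ *-congʳ (f-pairing (suc m) y Ψ′) ⟩
        ∑ (λ k → y k * Σ-tabloids (simplex (suc m) k)) * sg (toℕ p)
          ≈⟨ trans (*-distribʳ-sum (sg (toℕ p)) _) (sum-cong λ k → trans (*-assoc _ _ _) (*-congˡ (*-comm _ _))) ⟩
        ∑ (λ k → y k * (sg (toℕ p) * Σ-tabloids (simplex (suc m) k)))
          ≈⟨ sum-cong (λ k → *-congˡ (δψ (simplex-valid (suc m) k))) ⟨
        ∑ (λ k → y k * δ ψ (simplex (suc m) k))
          ≈⟨ sum-cong (λ k → *-congˡ (sum-incidence ψ (simplex-valid (suc m) k))) ⟨
        ∑ (λ k → y k * ∑ λ j → incidence (simplex (suc m) k) (simplex m j) * ψ (simplex m j))
          ≈⟨ sum-cong (λ k → *-congˡ (sum-cong λ j → *-comm _ _)) ⟩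
        ∑ (λ k → y k * ∑ λ j → ψ (simplex m j) * incidence (simplex (suc m) k) (simplex m j))
          ≈⟨ sum-exchange y _ (ψ ∘ simplex m) ⟨
        ∑ (λ j → ∑ (λ k → y k * incidence (simplex (suc m) k) (simplex m j)) * ψ (simplex m j))
          ≈⟨ sum-zero (λ j → trans (*-congʳ (trans (sym (∂≈ m y j)) (cycle j))) (zeroˡ _)) ⟩
        0# ∎)

  -- Stated for a variable length so that empty and nonempty chains can be told apart; for `m = 0`
  -- there are no two rows to merge.
  f-IsZ-generic : ∀ m (y : Chains m) → IsCycle m y → m < length c →
    (S : Vec ℕ m) → VecInj S → (∀ {σ : RelChain n m} → Valid c σ → Grows σ → Vec.map zs σ ≡ S) →
    (∀ {σ : RelChain n m} → Valid c σ → Grows σ → hT σ ∈ tabloids n c) →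
    IsZ m (f m y)
  f-IsZ-generic (suc m) y cycle m< S S-inj grown-sizes grown-tabloid i i< Ψ =
    let p , p↔i = countdown-surj (suc m) i i< in Test.vanishes m< S S-inj grown-sizes grown-tabloid i p p↔i Ψ y cycle

  f-IsZ : ∀ y → IsCycle r y → IsZ r (f r y)
  f-IsZ y cycle = f-IsZ-generic r y cycle ℕₚ.≤-refl (tailSums pos n≡) (tailSums-injective pos n≡)
    (grows-zs pos n≡) (grows-tabloid pos n≡)

  -- A chain of `r + 1` elements would need as many different ranks among `1, ..., r`.
  no-long-simplex : ¬ Fin (length (simplices n c (suc r)))
  no-long-simplex i = ℕₚ.<⇒≱ ℕₚ.≤-refl (valid-length (simplex-valid (suc r) i))

  boundary-zero : ∀ y → IsBoundary r y → ∀ j → y j ≈ 0#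
  boundary-zero y (z , ∂z≈y) j = trans (sym (∂z≈y j)) (trans (∂≈ r z j) (sum-zero λ i → ⊥-elim (no-long-simplex i)))

  zero-boundary : ∀ y → (∀ i → y i ≈ 0#) → IsBoundary r y
  zero-boundary y y≈0 = (λ _ → 0#) , λ j → trans (∂≈ r (λ _ → 0#) j)
    (trans (sum-zero λ i → zeroˡ (incidence (simplex (suc r) i) (simplex r j))) (sym (y≈0 j)))

  f-cong : ∀ y z → (∀ i → y i ≈ z i) → ∀ j → f r y j ≈ f r z j
  f-cong y z y≈z j = sum-cong λ i → *-congʳ (y≈z i)

  f-zero : ∀ y → (∀ i → y i ≈ 0#) → ∀ j → f r y j ≈ 0#
  f-zero y y≈0 j = sum-zero λ i → trans (*-congʳ (y≈0 i)) (zeroˡ _)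

  f-+ : ∀ y z j → f r (λ i → y i + z i) j ≈ f r y j + f r z j
  f-+ y z j = trans (sum-cong λ i → distribʳ _ _ _) (sum-+ (λ i → y i * eq i) (λ i → z i * eq i))
    where
    eq : Fin (length (simplices n c r)) → Carrier
    eq i = ind (tabloidEqᵇ (hT (simplex r i)) (tabloid j))

  f-* : ∀ s y j → f r (λ i → s * y i) j ≈ s * f r y j
  f-* s y j = trans (sum-cong λ i → *-assoc _ _ _) (sym (*-distribˡ-sum s _))

-- Relabelling and equivariance

module _ {n : ℕ} (g : Permutation′ n) where
  private
    lg = liftPermInv g
    lp = liftPerm g

    lg-lp : ∀ i → lg (lp i) ≡ i
    lg-lp fzero    = ≡.refl
    lg-lp (fsuc i) = cong fsuc (inverseˡ g)

    lp-lg : ∀ i → lp (lg i) ≡ i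
    lp-lg fzero    = ≡.refl
    lp-lg (fsuc i) = cong fsuc (inverseʳ g)

  rel-actRel : ∀ (E : Rel (suc n)) i j → rel (actRel g E) i j ≡ rel E (lg i) (lg j)
  rel-actRel E = rel-tabRel (λ i j → rel E (lg i) (lg j))

  act⁻ : ∀ {E i j} → i ≃[ actRel g E ] j → lg i ≃[ E ] lg j
  act⁻ {E} {i} {j} (hold p) = hold (≡.trans (≡.sym (rel-actRel E i j)) p)

  act⁺ : ∀ {E i j} → lg i ≃[ E ] lg j → i ≃[ actRel g E ] j
  act⁺ {E} {i} {j} (hold p) = hold (≡.trans (rel-actRel E i j) p)

  act⁺′ : ∀ {E i j} → i ≃[ E ] j → lp i ≃[ actRel g E ] lp j
  act⁺′ {E} {i} {j} p = act⁺ (subst₂ (_≃[ E ]_) (≡.sym (lg-lp i)) (≡.sym (lg-lp j)) p)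

  act-Equiv : ∀ {E} → Equiv E → Equiv (actRel g E)
  act-Equiv eq = record
    { rfl = λ i → act⁺ (rfl (lg i))
    ; smm = λ p → act⁺ (smm (act⁻ p))
    ; trn = λ p q → act⁺ (trn (act⁻ p) (act⁻ q)) }
    where open Equiv eq

  act-⊑ : ∀ {E F} → E ⊑ F → actRel g E ⊑ actRel g F
  act-⊑ le i j p = act⁺ (le (lg i) (lg j) (act⁻ p))

  act-⊑⁻ : ∀ {E F} → actRel g E ⊑ actRel g F → E ⊑ F
  act-⊑⁻ {E} {F} le i j p = subst₂ (_≃[ F ]_) (lg-lp i) (lg-lp j) (act⁻ (le (lp i) (lp j) (act⁺′ p)))

  act-⊏ : ∀ {E F} → E ⊏ F → actRel g E ⊏ actRel g F
  act-⊏ (p , ¬q) = act-⊑ p , λ q → ¬q (act-⊑⁻ q)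

  act-top : actRel g topRel ≡ topRel
  act-top = rel-ext λ i j → ≡.trans (rel-actRel topRel i j)
    (≡.trans (_≃[_]_.holds (≃-top (lg i) (lg j))) (≡.sym (_≃[_]_.holds (≃-top i j))))

  Z-act : ∀ E e → Z (actRel g E) e ≡ Z E (g ⟨$⟩ˡ e)
  Z-act E e = rel-actRel E fzero (fsuc e)

  zs-act : ∀ E → zs (actRel g E) ≡ zs E
  zs-act E = ≡.trans (count-cong (Z-act E)) (≡.sym (count-permute (Z E) (flip g)))

  -- Relabelling moves the least elements of blocks, so a block of the relabelled partition is named
  -- by the representative of its preimage in `E`.
  ptype-act : ∀ {E} → Equiv E → ptype (actRel g E) ≡ ptype E
  ptype-act {E} eq = ≡.trans
    (ptype-label (act-Equiv eq) (λ i → proj₁ (rep eq (lg i))) (λ a → count (rel E a)) unique inj into onto size)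
    (≡.trans (cong (_ ,_) (zs-act E)) (≡.sym (ptype-label eq id (λ a → count (rel E a)) unique
      (λ _ _ _ _ p → p)
      (λ i fi → ∈-filterᵇ⁺ (freeRep E) (∈ₚ.∈-allFin i) (freeRep⁺ fi))
      (λ {a} a∈ → a , free∈ a∈ , ≡.refl) (λ _ _ → ≡.refl))))
    where
    open Equiv eq
    free∈ : ∀ {a} → a ∈ freeReps E → FreeRep E a
    free∈ a∈ = freeRep⁻ E _ (proj₂ (∈-filterᵇ⁻ (freeRep E) a∈))
    unique = filterᵇ-unique (freeRep E) (Uniqueₚ.allFin⁺ (suc n))
    κ≃ : ∀ i → proj₁ (rep eq (lg i)) ≃[ E ] lg i
    κ≃ i = proj₂ (proj₂ (rep eq (lg i)))
    inj : ∀ i j → FreeRep (actRel g E) i → FreeRep (actRel g E) j → proj₁ (rep eq (lg i)) ≡ proj₁ (rep eq (lg j)) → i ≡ j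
    inj i j fi fj κ≡ = reps-equal (act-Equiv eq) (proj₁ fi) (proj₁ fj)
      (act⁺ (trn (smm (κ≃ i)) (subst (_≃[ E ] lg j) (≡.sym κ≡) (κ≃ j))))
    into : ∀ i → FreeRep (actRel g E) i → proj₁ (rep eq (lg i)) ∈ freeReps E
    into i (_ , free) = ∈-filterᵇ⁺ (freeRep E) (∈ₚ.∈-allFin _) (freeRep⁺
      (proj₁ (proj₂ (rep eq (lg i))) , λ p → free (act⁺ (trn p (κ≃ i)))))
    onto : ∀ {b} → b ∈ freeReps E → ∃ λ i → FreeRep (actRel g E) i × proj₁ (rep eq (lg i)) ≡ b
    onto {b} b∈ with rb , free ← free∈ b∈ with i , ri , i≃ ← rep (act-Equiv eq) (lp b) =
      i , (ri , λ p → free (subst (fzero ≃[ E ]_) (lg-lp b) (act⁻ (Equiv.trn (act-Equiv eq) p i≃)))) ,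
      reps-equal eq (proj₁ (proj₂ (rep eq (lg i)))) rb
        (trn (κ≃ i) (subst (lg i ≃[ E ]_) (lg-lp b) (act⁻ i≃)))
    size : ∀ i → FreeRep (actRel g E) i → count (rel (actRel g E) i) ≡ count (rel E (proj₁ (rep eq (lg i))))
    size i _ = ≡.trans (count-cong (rel-actRel E i))
      (≡.trans (≡.sym (count-permute (rel E (lg i)) (permutation lg lp lg-lp lp-lg)))
      (count-cong {suc n} {rel E (lg i)} λ j → bool-ext (λ p → holds (trn (κ≃ i) (hold {j = j} p)))
        (λ p → holds (trn (smm (κ≃ i)) (hold {j = j} p)))))
      where open _≃[_]_

  act-Elem : ∀ {c E} → Elem c E → Elem c (actRel g E)
  act-Elem {E = E} el = record
    { equiv  = act-Equiv equiv
    ; coarse = coarse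
    ; type   = ≡.trans (ptype-act equiv) type
    ; nontop = λ t → nontop (act-⊑⁻ (subst (_⊑ actRel g E) (≡.sym act-top) t))
    }
    where open Elem el

  act-Valid : ∀ {c m} {σ : RelChain n m} → Valid c σ → Valid c (actChain g σ)
  act-Valid []             = []
  act-Valid (cons {E = E} {σ} el lt v) = cons (act-Elem el) (subst (actRel g E ⊏_) (hd-act σ) (act-⊏ lt)) (act-Valid v)
    where
    hd-act : ∀ {m} (σ : RelChain n m) → actRel g (hd σ) ≡ hd (actChain g σ)
    hd-act []      = act-top
    hd-act (E ∷ σ) = ≡.refl

  h-act : ∀ {m} (σ : RelChain n m) e → h (actChain g σ) e ≡ h σ (g ⟨$⟩ˡ e)
  h-act []      e = ≡.refl
  h-act (E ∷ σ) e = cong₂ _+ℕ_ (cong b2n (Z-act E e)) (h-act σ e)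

  hT-act : ∀ {m} (σ : RelChain n m) → hT (actChain g σ) ≡ actTabloid g (hT σ)
  hT-act σ = Vecₚ.tabulate-cong λ e → ≡.trans (h-act σ e) (≡.sym (Vecₚ.lookup∘tabulate (h σ) (g ⟨$⟩ˡ e)))

  actTabloid-∈⁻ : ∀ {c} (T : Tabloid n) → actTabloid g T ∈ tabloids n c → T ∈ tabloids n c
  actTabloid-∈⁻ {c} T gT∈ = ∈-tabloids⁺ {c = c} T
    (λ e → subst (_< length c) (≡.trans (look (g ⟨$⟩ʳ e)) (cong (lookup T) (inverseˡ g)))
             (∈-tabloids-row {c = c} gT∈ (g ⟨$⟩ʳ e)))
    λ i i< → ≡.trans (count-permute (λ e → lookup T e ≡ᵇ i) (flip g))
      (≡.trans (count-cong λ e → cong (_≡ᵇ i) (≡.sym (look e))) (∈-tabloids-size {c = c} gT∈ i i<))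
    where
    look : ∀ e → lookup (actTabloid g T) e ≡ lookup T (g ⟨$⟩ˡ e)
    look = Vecₚ.lookup∘tabulate (λ e → lookup T (g ⟨$⟩ˡ e))

module Equivariance {a ℓ} (K : CommutativeRing a ℓ) (n x₀ : ℕ) (c′ : List ℕ) where
  open CommutativeRing K
  open RingSums K
  open Complex K n x₀ c′
  open Hom K n c
  open import Relation.Binary.Reasoning.Setoid setoid

  f-equivariant : ∀ m g y j → f m (actC m g y) j ≈ actM g (f m y) j
  f-equivariant m g y j = begin
    ∑ (λ i → actC m g y i * eqT (hT (simplex m i)))
      ≈⟨ sum-cong (λ i → *-congʳ (sumFin≈sum _)) ⟩
    ∑ (λ i → ∑ (λ l → y l * ind (chainEqᵇ (actChain g (simplex m l)) (simplex m i))) * eqT (hT (simplex m i)))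
      ≈⟨ sum-exchange y _ (eqT ∘ hT ∘ simplex m) ⟩
    ∑ (λ l → y l * ∑ λ i → eqT (hT (simplex m i)) * ind (chainEqᵇ (actChain g (simplex m l)) (simplex m i)))
      ≈⟨ sum-cong (λ l → *-congˡ (trans (sum-simplex-δ (eqT ∘ hT) (act-Valid g (simplex-valid m l)))
           (trans (reflexive (cong eqT (hT-act g (simplex m l)))) (sym (pick (hT (simplex m l))))))) ⟩
    ∑ (λ l → y l * ∑ λ i → Ψ (tabloid i) * ind (tabloidEqᵇ (hT (simplex m l)) (tabloid i)))
      ≈⟨ f-pairing m y Ψ ⟨
    ∑ (λ i → f m y i * Ψ (tabloid i))
      ≈⟨ sumFin≈sum _ ⟨
    actM g (f m y) j ∎
    where
    eqT Ψ : Tabloid n → Carrier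
    eqT T = ind (tabloidEqᵇ T (tabloid j))
    Ψ T = eqT (actTabloid g T)
    -- `T` need not have shape `B`. It does if its relabelling is the tabloid `j`; otherwise both
    -- sides are zero.
    pick : ∀ T → ∑ (λ i → Ψ (tabloid i) * ind (tabloidEqᵇ T (tabloid i))) ≈ Ψ T
    pick T = bool-cases (tabloidEqᵇ (actTabloid g T) (tabloid j))
      (λ t → sum-tabloid-δ Ψ (actTabloid-∈⁻ g {c} T (subst (_∈ tabloids n c) (≡.sym (tabloidEqᵇ⁻ _ _ t)) (∈ₚ.∈-lookup j))))
      (λ t → trans (sum-zero λ i → none t i) (sym (reflexive (cong ind t))))
      where
      none : tabloidEqᵇ (actTabloid g T) (tabloid j) ≡ false → ∀ i → Ψ (tabloid i) * ind (tabloidEqᵇ T (tabloid i)) ≈ 0#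
      none t i = bool-cases (tabloidEqᵇ T (tabloid i))
        (λ s → trans (*-congʳ (reflexive (cong ind (≡.trans
          (cong (λ U → tabloidEqᵇ (actTabloid g U) (tabloid j)) (≡.sym (tabloidEqᵇ⁻ T (tabloid i) s))) t)))) (zeroˡ _))
        (*-ind-false _)

open _≃[_]_

-- Ordered partitions and merging of adjacent rows

cnt : ∀ {n} → Tabloid n → ℕ → ℕ
cnt W i = count λ e → lookup W e ≡ᵇ i

sizes : ∀ {n} → ℕ → Tabloid n → List ℕ
sizes m W = applyUpTo (cnt W) (suc m)

-- The row sizes after merging rows `i` and `i + 1`. The formula is additive in the size function,
-- hence can be checked one entry of the tabloid at a time.
mergeF : ℕ → (ℕ → ℕ) → ℕ → ℕ
mergeF zero    g zero    = g 0 +ℕ g 1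
mergeF zero    g (suc q) = g (suc (suc q))
mergeF (suc i) g zero    = g 0
mergeF (suc i) g (suc q) = mergeF i (g ∘ suc) q

mergeF-+ : ∀ i g g′ q → mergeF i (λ q → g q +ℕ g′ q) q ≡ mergeF i g q +ℕ mergeF i g′ q
mergeF-+ zero    g g′ zero    = interchange (g 0) (g′ 0) (g 1) (g′ 1)
  where open import Algebra.Properties.CommutativeSemigroup ℕₚ.+-commutativeSemigroup using (interchange)
mergeF-+ zero    g g′ (suc q) = ≡.refl
mergeF-+ (suc i) g g′ zero    = ≡.refl
mergeF-+ (suc i) g g′ (suc q) = mergeF-+ i (g ∘ suc) (g′ ∘ suc) q

mergeF-0 : ∀ i q → mergeF i (λ _ → 0) q ≡ 0
mergeF-0 zero    zero    = ≡.refl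
mergeF-0 zero    (suc q) = ≡.refl
mergeF-0 (suc i) zero    = ≡.refl
mergeF-0 (suc i) (suc q) = mergeF-0 i q

mergeF-δ : ∀ i v q → b2n (mg i v ≡ᵇ q) ≡ mergeF i (λ q → b2n (v ≡ᵇ q)) q
mergeF-δ zero    zero    zero    = ≡.refl
mergeF-δ zero    zero    (suc q) = ≡.refl
mergeF-δ (suc i) zero    zero    = ≡.refl
mergeF-δ (suc i) zero    (suc q) = ≡.sym (mergeF-0 i q)
mergeF-δ zero    (suc v) zero    = ≡.refl
mergeF-δ zero    (suc v) (suc q) = ≡.refl
mergeF-δ (suc i) (suc v) zero    = ≡.refl
mergeF-δ (suc i) (suc v) (suc q) = mergeF-δ i v q

cnt-mgV : ∀ {n} i (W : Tabloid n) q → cnt (mgV i W) q ≡ mergeF i (cnt W) q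
cnt-mgV i []      q = ≡.sym (mergeF-0 i q)
cnt-mgV i (v ∷ W) q = ≡.trans (cong₂ _+ℕ_ (mergeF-δ i v q) (cnt-mgV i W q))
  (≡.sym (mergeF-+ i (λ q → b2n (v ≡ᵇ q)) (cnt W) q))

applyUpTo-cong : ∀ {g g′ : ℕ → ℕ} → (∀ i → g i ≡ g′ i) → ∀ m → applyUpTo g m ≡ applyUpTo g′ m
applyUpTo-cong eq zero    = ≡.refl
applyUpTo-cong eq (suc m) = cong₂ _∷_ (eq 0) (applyUpTo-cong (eq ∘ suc) m)

applyUpTo-mergeF : ∀ {i r} g → i ≤ r → applyUpTo (mergeF i g) (suc r) ≡ mergeAt i (applyUpTo g (suc (suc r)))
applyUpTo-mergeF {zero}  {r}     g _         = ≡.refl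
applyUpTo-mergeF {suc i} {suc r} g (s≤s i≤r) = cong (g 0 ∷_) (applyUpTo-mergeF (g ∘ suc) i≤r)

applyUpTo-nthD : ∀ g c → (∀ i → i < length c → g i ≡ nthD 0 c i) → applyUpTo g (length c) ≡ c
applyUpTo-nthD g []      eq = ≡.refl
applyUpTo-nthD g (x ∷ c) eq = cong₂ _∷_ (eq 0 (s≤s z≤n)) (applyUpTo-nthD (g ∘ suc) c λ i i< → eq (suc i) (s≤s i<))

ctype′-applyUpTo : ∀ g m → ctype′ (applyUpTo g (suc m)) ≡ (applyUpTo g m , g m)
ctype′-applyUpTo g zero    = ≡.refl
ctype′-applyUpTo g (suc m) = cong (λ lp → g 0 ∷ proj₁ lp , proj₂ lp) (ctype′-applyUpTo (g ∘ suc) m)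

-- What a tabloid of shape `B` becomes under merges of adjacent rows: an ordered partition into
-- nonempty rows `0, ..., m` whose sizes coarsen `c`. For `m > 0`, forgetting the order of the rows
-- below the last gives a member of the poset.
record Good {n} (c : List ℕ) (m : ℕ) (W : Tabloid n) : Set where
  field
    occupied : ∀ i → i ≤ m → ∃ λ e → lookup W e ≡ i
    bounded  : ∀ e → lookup W e ≤ m
    coarse   : Coarse c (sizes m W)

mg≤ : ∀ {i m v} → i ≤ m → v ≤ suc m → mg i v ≤ m
mg≤ {i}     {m}     {zero}  _       _        = z≤n
mg≤ {zero}  {m}     {suc v} _       (s≤s v≤) = v≤
mg≤ {suc i} {suc m} {suc v} (s≤s p) (s≤s v≤) = s≤s (mg≤ p v≤)

lookup-mgV : ∀ {n} i (W : Tabloid n) e → lookup (mgV i W) e ≡ mg i (lookup W e)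
lookup-mgV i W e = Vecₚ.lookup-map e (mg i) W

good-mgV : ∀ {n c m i} {W : Tabloid n} → i ≤ m → Good c (suc m) W → Good c m (mgV i W)
good-mgV {c = c} {m} {i} {W} i≤m good = record
  { occupied = occ
  ; bounded  = λ e → subst (_≤ m) (≡.sym (lookup-mgV i W e)) (mg≤ i≤m (bounded e))
  ; coarse   = subst (Coarse c) (≡.sym (≡.trans (applyUpTo-cong (cnt-mgV i W) (suc m)) (applyUpTo-mergeF (cnt W) i≤m)))
                 (coarse-mergeAt i coarse)
  }
  where
  open Good good
  occ : ∀ q → q ≤ m → ∃ λ e → lookup (mgV i W) e ≡ q
  occ q q≤m with q ≤? i
  ... | yes q≤i with e , eq ← occupied q (ℕₚ.m≤n⇒m≤1+n q≤m) =
    e , ≡.trans (lookup-mgV i W e) (≡.trans (cong (mg i) eq) (mg-low q≤i))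
  ... | no q≰i with e , eq ← occupied (suc q) (s≤s q≤m) =
    e , ≡.trans (lookup-mgV i W e) (≡.trans (cong (mg i) eq) (mg-high (ℕₚ.<⇒≤ (ℕₚ.≰⇒> q≰i))))

tabloid-good : ∀ {n x c′} {T : Tabloid n} → All (0 <_) (x ∷ c′) → T ∈ tabloids n (x ∷ c′) → Good (x ∷ c′) (length c′) T
tabloid-good {n} {x} {c′} {T} pos T∈ = record
  { occupied = λ i i≤ → ∈-tabloids-occupied {c = x ∷ c′} pos T∈ i (s≤s i≤)
  ; bounded  = λ e → s≤s⁻¹ (∈-tabloids-row {c = x ∷ c′} T∈ e)
  ; coarse   = subst (Coarse (x ∷ c′)) (≡.sym (applyUpTo-nthD (cnt T) (x ∷ c′) (∈-tabloids-size {c = x ∷ c′} T∈)))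
                 (coarse-refl x c′)
  }

label : ∀ {n} → ℕ → Tabloid n → Fin (suc n) → ℕ
label m W fzero    = m
label m W (fsuc e) = lookup W e

-- The pointed partition of an ordered one with rows 0,…,m, row m being pointed.
φ : ∀ {n} → ℕ → Tabloid n → Rel (suc n)
φ m W = tabRel λ i j → label m W i ≡ᵇ label m W j

module _ {n : ℕ} (m : ℕ) (W : Tabloid n) where
  φ⁻ : ∀ {i j} → i ≃[ φ m W ] j → label m W i ≡ label m W j
  φ⁻ {i} {j} (hold p) = ≡ᵇ-true⁻ (≡.trans (≡.sym (rel-tabRel (λ i j → label m W i ≡ᵇ label m W j) i j)) p)

  φ⁺ : ∀ {i j} → label m W i ≡ label m W j → i ≃[ φ m W ] j
  φ⁺ {i} {j} p = hold (≡.trans (rel-tabRel (λ i j → label m W i ≡ᵇ label m W j) i j) (≡ᵇ-true⁺ p))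

  φ-Equiv : Equiv (φ m W)
  φ-Equiv = record
    { rfl = λ i → φ⁺ ≡.refl
    ; smm = λ p → φ⁺ (≡.sym (φ⁻ p))
    ; trn = λ p q → φ⁺ (≡.trans (φ⁻ p) (φ⁻ q)) }

  Z-φ : ∀ e → Z (φ m W) e ≡ (lookup W e ≡ᵇ m)
  Z-φ e = bool-ext (λ p → ≡ᵇ-true⁺ (≡.sym (φ⁻ {fzero} {fsuc e} (hold p))))
    (λ p → holds (φ⁺ {fzero} {fsuc e} (≡.sym (≡ᵇ-true⁻ p))))

-- The rows serve as labels in `ptype-label`. An entry of row `0` lies outside the pointed row, so
-- the partition is not the top.
φ-Elem : ∀ {n c m} {W : Tabloid n} → Good c (suc m) W → Elem c (φ (suc m) W)
φ-Elem {n} {c} {m} {W} good = record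
  { equiv  = eq
  ; coarse = coarse
  ; type   = ≡.trans (ptype-label eq lab (cnt W) (Uniqueₚ.upTo⁺ (suc m)) inj into onto size)
      (≡.sym (≡.trans (cong (λ lp → sortℕ (proj₁ lp) , proj₂ lp) (ctype′-applyUpTo (cnt W) (suc m)))
      (cong₂ _,_ (cong sortℕ (≡.sym (map-upTo (cnt W) (suc m)))) (≡.sym (count-cong (Z-φ (suc m) W))))))
  ; nontop = λ t → let e , We = occupied 0 z≤n in
      case-0 (≡.trans (φ⁻ (suc m) W (t fzero (fsuc e) (≃-top _ _))) We)
  }
  where
  open Good good
  eq = φ-Equiv (suc m) W
  lab = label (suc m) W
  case-0 : ¬ (suc m ≡ 0)
  case-0 ()
  inj : ∀ i j → FreeRep (φ (suc m) W) i → FreeRep (φ (suc m) W) j → lab i ≡ lab j → i ≡ j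
  inj i j fi fj p = reps-equal eq (proj₁ fi) (proj₁ fj) (φ⁺ (suc m) W p)
  lab≤ : ∀ i → lab i ≤ suc m
  lab≤ fzero    = ℕₚ.≤-refl
  lab≤ (fsuc e) = bounded e
  lab≢ : ∀ i → FreeRep (φ (suc m) W) i → lab i ≢ suc m
  lab≢ i (_ , free) p = free (φ⁺ (suc m) W (≡.sym p))
  into : ∀ i → FreeRep (φ (suc m) W) i → lab i ∈ upTo (suc m)
  into i fi = ∈ₚ.∈-upTo⁺ (ℕₚ.≤∧≢⇒< (lab≤ i) (lab≢ i fi))
  onto : ∀ {b} → b ∈ upTo (suc m) → ∃ λ i → FreeRep (φ (suc m) W) i × lab i ≡ b
  onto {b} b∈ with e , We ← occupied b (ℕₚ.<⇒≤ (∈ₚ.∈-upTo⁻ b∈)) with i , ri , i≃ ← rep eq (fsuc e) =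
    i , (ri , λ p → ℕₚ.<⇒≢ (∈ₚ.∈-upTo⁻ b∈) (≡.sym (≡.trans (φ⁻ (suc m) W p) lab≡))) , lab≡
    where
    lab≡ : lab i ≡ b
    lab≡ = ≡.trans (φ⁻ (suc m) W i≃) We
  size : ∀ i → FreeRep (φ (suc m) W) i → count (rel (φ (suc m) W) i) ≡ cnt W (lab i)
  size i fi = cong₂ _+ℕ_ (cong b2n (≄⇒false {E = φ (suc m) W} {i} {fzero} λ p → lab≢ i fi (φ⁻ (suc m) W p)))
    (count-cong λ e → bool-ext (λ p → ≡ᵇ-true⁺ (≡.sym (φ⁻ (suc m) W {i} {fsuc e} (hold p))))
      (λ p → holds (φ⁺ (suc m) W {i} {fsuc e} (≡.sym (≡ᵇ-true⁻ p)))))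

label-mgV : ∀ {n} i m (W : Tabloid n) → i ≤ m → ∀ x → label m (mgV i W) x ≡ mg i (label (suc m) W x)
label-mgV i m W i≤m fzero    = ≡.sym (mg-high i≤m)
label-mgV i m W i≤m (fsuc e) = lookup-mgV i W e

-- The step is strict because both merged rows are occupied.
φ-⊏ : ∀ {n c m i} {W : Tabloid n} → i ≤ m → Good c (suc m) W → φ (suc m) W ⊏ φ m (mgV i W)
φ-⊏ {m = m} {i} {W} i≤m good = (λ a b p → φ⁺ m (mgV i W) (lab≡ {a} {b} (cong (mg i) (φ⁻ (suc m) W p)))) , strict
  where
  open Good good
  lab≡ : ∀ {a b} → mg i (label (suc m) W a) ≡ mg i (label (suc m) W b) → label m (mgV i W) a ≡ label m (mgV i W) b
  lab≡ {a} {b} p = ≡.trans (label-mgV i m W i≤m a) (≡.trans p (≡.sym (label-mgV i m W i≤m b)))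
  strict : ¬ (φ m (mgV i W) ⊑ φ (suc m) W)
  strict le with e , p ← occupied i (ℕₚ.m≤n⇒m≤1+n i≤m) | e′ , p′ ← occupied (suc i) (s≤s i≤m) =
    ℕₚ.<⇒≢ (ℕₚ.n<1+n i) (≡.trans (≡.sym p) (≡.trans (φ⁻ (suc m) W (le (fsuc e) (fsuc e′) (φ⁺ m (mgV i W)
      (lab≡ {fsuc e} {fsuc e′} (≡.trans (cong (mg i) p) (≡.trans (mg-low ℕₚ.≤-refl)
      (≡.sym (≡.trans (cong (mg i) p′) (mg-high {i} ℕₚ.≤-refl))))))))) p′))

-- The chains of the barycentric subdivision of the simplex of W.
data Sup {n} : ∀ m → Tabloid n → RelChain n m → Set where
  []   : ∀ {W} → Sup 0 W []
  cons : ∀ {m W τ} (i : Fin (suc m)) → Sup m (mgV (toℕ i) W) τ → Sup (suc m) W (φ (suc m) W ∷ τ)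

toℕ≤ : ∀ {m} (i : Fin (suc m)) → toℕ i ≤ m
toℕ≤ = Finₚ.toℕ≤pred[n]

sup-valid : ∀ {n c m} {W : Tabloid n} {σ} → Good c m W → Sup m W σ → Valid c σ
sup-valid good [] = []
sup-valid good (cons i []) = cons (φ-Elem good) (⊏-top (φ-Elem good)) []
sup-valid good (cons i s@(cons j _)) = cons (φ-Elem good) (φ-⊏ (toℕ≤ i) good) (sup-valid (good-mgV (toℕ≤ i) good) s)

-- The last row remains part of the last row under every merge, so its entries lie in all pointed
-- blocks of the flag.
sup-full : ∀ {n m} {W : Tabloid n} {σ} → Sup m W σ → ∀ e → lookup W e ≡ m → h σ e ≡ m
sup-full [] e We = ≡.refl
sup-full (cons {m} {W} i s) e We = cong₂ _+ℕ_ (cong b2n (≡.trans (Z-φ (suc m) W e) (≡ᵇ-true⁺ We)))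
  (sup-full s e (≡.trans (lookup-mgV (toℕ i) W e) (≡.trans (cong (mg (toℕ i)) We) (mg-high (toℕ≤ i)))))

-- Barycentric subdivision as a right inverse of `f`

module Subdivision {a ℓ} (K : CommutativeRing a ℓ) (n x₀ : ℕ) (c′ : List ℕ) where
  open CommutativeRing K
  open RingSums K
  open Complex K n x₀ c′
  open Hom K n c
  open import Algebra.Properties.Ring ring
  open import Relation.Binary.Reasoning.Setoid setoid

  -- sd m W ψ is the value of ψ on the fundamental chain of the barycentric
  -- subdivision; the signs are normalised so that the flag cutting off the
  -- last row first has sign +1.
  sd : ∀ m → Tabloid n → (RelChain n m → Carrier) → Carrier
  sd zero    W ψ = ψ []
  sd (suc m) W ψ = ∑ {suc m} λ i → sg (m +ℕ toℕ i) * sd m (mgV (toℕ i) W) (λ τ → ψ (φ (suc m) W ∷ τ))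

  sd-cong : ∀ m W {ψ ψ′ : RelChain n m → Carrier} → (∀ {σ} → Sup m W σ → ψ σ ≈ ψ′ σ) → sd m W ψ ≈ sd m W ψ′
  sd-cong zero    W eq = eq []
  sd-cong (suc m) W eq = sum-cong {suc m} λ i → *-congˡ (sd-cong m (mgV (toℕ i) W) λ s → eq (cons i s))

  sd-+ : ∀ m W (ψ ψ′ : RelChain n m → Carrier) → sd m W (λ σ → ψ σ + ψ′ σ) ≈ sd m W ψ + sd m W ψ′
  sd-+ zero    W ψ ψ′ = refl
  sd-+ (suc m) W ψ ψ′ = trans
    (sum-cong {suc m} λ i → trans (*-congˡ (sd-+ m (mgV (toℕ i) W) _ _)) (distribˡ _ _ _))
    (sum-+ {suc m} (λ i → sg (m +ℕ toℕ i) * sd m (mgV (toℕ i) W) (λ τ → ψ (φ (suc m) W ∷ τ)))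
      (λ i → sg (m +ℕ toℕ i) * sd m (mgV (toℕ i) W) (λ τ → ψ′ (φ (suc m) W ∷ τ))))

  sd-*ʳ : ∀ m W s (ψ : RelChain n m → Carrier) → sd m W (λ σ → ψ σ * s) ≈ sd m W ψ * s
  sd-*ʳ zero    W s ψ = refl
  sd-*ʳ (suc m) W s ψ = trans
    (sum-cong {suc m} λ i → trans (*-congˡ (sd-*ʳ m (mgV (toℕ i) W) s _)) (sym (*-assoc _ _ _)))
    (sym (*-distribʳ-sum {suc m} s _))

  sd-0 : ∀ m W → sd m W (λ _ → 0#) ≈ 0#
  sd-0 m W = trans (sd-cong m W λ _ → sym (zeroʳ 0#)) (trans (sd-*ʳ m W 0# (λ _ → 0#)) (zeroʳ _))

  sd-sum : ∀ m W {k} (F : Fin k → RelChain n m → Carrier) →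
    sd m W (λ σ → ∑ λ i → F i σ) ≈ ∑ λ i → sd m W (F i)
  sd-sum m W {zero}  F = trans (sd-cong m W λ {σ} _ → reflexive (sum-[] (λ i → F i σ)))
    (trans (sd-0 m W) (sym (reflexive (sum-[] _))))
  sd-sum m W {suc k} F = begin
    sd m W (λ σ → ∑ λ i → F i σ)                              ≈⟨ sd-cong m W (λ {σ} _ → reflexive (sum-∷ (λ i → F i σ))) ⟩
    sd m W (λ σ → F fzero σ + ∑ λ i → F (fsuc i) σ)           ≈⟨ sd-+ m W (F fzero) _ ⟩
    sd m W (F fzero) + sd m W (λ σ → ∑ λ i → F (fsuc i) σ)    ≈⟨ +-congˡ (sd-sum m W (F ∘ fsuc)) ⟩
    sd m W (F fzero) + ∑ (λ i → sd m W (F (fsuc i)))          ≡⟨ sum-∷ _ ⟨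
    ∑ (λ i → sd m W (F i))                                    ∎

  -- The face without `E` has sign `+1`; in the others all positions shift by one. The resulting
  -- sign stands on the right, where `sd-*ʳ` can extract it.
  δ-∷ : ∀ {m} (ψ : RelChain n (suc m) → Carrier) E (τ : RelChain n (suc m)) →
    δ ψ (E ∷ τ) ≈ ψ τ + δ (λ ρ → ψ (E ∷ ρ)) τ * (- 1#)
  δ-∷ {m} ψ E (F ∷ τ) = begin
    ∑ (λ p → sg (toℕ p) * ψ (removeAt (E ∷ F ∷ τ) p))
      ≡⟨ sum-∷ _ ⟩
    1# * ψ (F ∷ τ) + ∑ (λ p → sg (suc (toℕ p)) * ψ (E ∷ removeAt (F ∷ τ) p))
      ≈⟨ +-cong (*-identityˡ _) (sum-cong λ p →
           trans (*-congʳ (trans (sg-suc (toℕ p)) (sym (-1*x≈-x _)))) (trans (*-assoc _ _ _) (*-comm _ _))) ⟩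
    ψ (F ∷ τ) + ∑ (λ p → sg (toℕ p) * ψ (E ∷ removeAt (F ∷ τ) p) * - 1#)
      ≈⟨ +-congˡ (*-distribʳ-sum (- 1#) _) ⟨
    ψ (F ∷ τ) + δ (λ ρ → ψ (E ∷ ρ)) (F ∷ τ) * - 1# ∎

  -- Subdivision is a chain map.
  sd-δ : ∀ m W (ψ : RelChain n m → Carrier) →
    sd (suc m) W (δ ψ) ≈ ∑ {suc m} λ i → sg (m +ℕ toℕ i) * sd m (mgV (toℕ i) W) ψ
  sd-δ zero W ψ = sum-cong λ i → *-congˡ (trans (reflexive (sum-∷ _)) (trans (+-congˡ (reflexive (sum-[] _)))
    (trans (+-identityʳ _) (*-identityˡ _))))
  sd-δ (suc m) W ψ = begin
    ∑ {M} (λ i → s i * sd (suc m) (mgV (toℕ i) W) (λ τ → δ ψ (E ∷ τ)))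
      ≈⟨ sum-cong {M} (λ i → *-congˡ (trans (sd-cong (suc m) (mgV (toℕ i) W) (λ {τ} _ → δ-∷ ψ E τ))
           (trans (sd-+ (suc m) (mgV (toℕ i) W) ψ (λ τ → δ ψE τ * - 1#)) (+-congˡ (sd-*ʳ (suc m) (mgV (toℕ i) W) (- 1#) (δ ψE)))))) ⟩
    ∑ {M} (λ i → s i * (sd (suc m) (mgV (toℕ i) W) ψ + sd (suc m) (mgV (toℕ i) W) (δ ψE) * - 1#))
      ≈⟨ sum-cong {M} (λ i → trans (distribˡ _ _ _) (+-congˡ (sym (*-assoc _ _ _)))) ⟩
    ∑ {M} (λ i → s i * sd (suc m) (mgV (toℕ i) W) ψ + (s i * sd (suc m) (mgV (toℕ i) W) (δ ψE)) * - 1#)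
      ≈⟨ sum-+ {M} (λ i → s i * sd (suc m) (mgV (toℕ i) W) ψ) (λ i → (s i * sd (suc m) (mgV (toℕ i) W) (δ ψE)) * - 1#) ⟩
    main + ∑ {M} (λ i → (s i * sd (suc m) (mgV (toℕ i) W) (δ ψE)) * - 1#)
      ≈⟨ +-congˡ (trans (sym (*-distribʳ-sum {M} (- 1#) (λ i → s i * sd (suc m) (mgV (toℕ i) W) (δ ψE)))) (trans (*-congʳ square) (zeroˡ _))) ⟩
    main + 0#
      ≈⟨ +-identityʳ main ⟩
    main ∎
    where
    M = suc (suc m)
    E = φ (suc (suc m)) W
    ψE : RelChain n m → Carrier
    ψE ρ = ψ (E ∷ ρ)
    s : Fin M → Carrier
    s i = sg (suc m +ℕ toℕ i)
    main = ∑ {M} λ i → s i * sd (suc m) (mgV (toℕ i) W) ψ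
    G : ℕ → ℕ → Carrier
    G i j = sd m (mgV j (mgV i W)) ψE
    factor : ∀ i j g → sg (suc m +ℕ i) * (sg (m +ℕ j) * g) ≈ (sg (suc m) * sg m) * ((sg i * sg j) * g)
    factor i j g = begin
      sg (suc m +ℕ i) * (sg (m +ℕ j) * g)              ≈⟨ *-assoc _ _ _ ⟨
      (sg (suc m +ℕ i) * sg (m +ℕ j)) * g              ≈⟨ *-congʳ (*-cong (sg-+ (suc m) i) (sg-+ m j)) ⟩
      ((sg (suc m) * sg i) * (sg m * sg j)) * g        ≈⟨ *-congʳ (interchange (sg (suc m)) (sg i) (sg m) (sg j)) ⟩
      ((sg (suc m) * sg m) * (sg i * sg j)) * g        ≈⟨ *-assoc _ _ _ ⟩
      (sg (suc m) * sg m) * ((sg i * sg j) * g)        ∎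
      where open import Algebra.Properties.CommutativeSemigroup *-commutativeSemigroup using (interchange)
    -- The faces that keep `E` lead to double merges. By `factor` the signs are those of an iterated
    -- boundary up to a common scalar, and `mgV-mgV` supplies the symmetry for `sum-∂∂`.
    square : ∑ {M} (λ i → s i * sd (suc m) (mgV (toℕ i) W) (δ ψE)) ≈ 0#
    square = begin
      ∑ {M} (λ i → s i * sd (suc m) (mgV (toℕ i) W) (δ ψE))
        ≈⟨ sum-cong {M} (λ i → *-congˡ (sd-δ m (mgV (toℕ i) W) ψE)) ⟩
      ∑ {M} (λ i → s i * ∑ {suc m} λ j → sg (m +ℕ toℕ j) * G (toℕ i) (toℕ j))
        ≈⟨ sum-cong {M} (λ i → trans (*-distribˡ-sum {suc m} (s i) (λ j → sg (m +ℕ toℕ j) * G (toℕ i) (toℕ j)))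
             (trans (sum-cong {suc m} λ j → factor (toℕ i) (toℕ j) (G (toℕ i) (toℕ j)))
             (sym (*-distribˡ-sum {suc m} (sg (suc m) * sg m) (λ j → (sg (toℕ i) * sg (toℕ j)) * G (toℕ i) (toℕ j)))))) ⟩
      ∑ {M} (λ i → (sg (suc m) * sg m) * ∑ {suc m} λ j → (sg (toℕ i) * sg (toℕ j)) * G (toℕ i) (toℕ j))
        ≈⟨ *-distribˡ-sum {M} (sg (suc m) * sg m) (λ i → ∑ {suc m} λ j → (sg (toℕ i) * sg (toℕ j)) * G (toℕ i) (toℕ j)) ⟨
      (sg (suc m) * sg m) * ∑ {M} (λ i → ∑ {suc m} λ j → (sg (toℕ i) * sg (toℕ j)) * G (toℕ i) (toℕ j))
        ≈⟨ trans (*-congˡ (sum-∂∂ (suc m) G λ i j i≤j → reflexive (cong (λ V → sd m V ψE) (mgV-mgV i j W i≤j)))) (zeroʳ _) ⟩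
      0# ∎

  subdivide : ∀ m → Mᴮ → Chains m
  subdivide m y i = ∑ λ k → y k * sd m (tabloid k) (λ σ → ind (chainEqᵇ σ (simplex m i)))

  module _ {m : ℕ} (good : ∀ k → Good c m (tabloid k)) (y : Mᴮ) where

    -- All flags of a good tabloid are simplices, so reading off coefficients at simplices loses
    -- nothing.
    subdivide-pairing : ∀ (F : RelChain n m → Carrier) →
      ∑ (λ i → subdivide m y i * F (simplex m i)) ≈ ∑ λ k → y k * sd m (tabloid k) F
    subdivide-pairing F = begin
      ∑ (λ i → subdivide m y i * F (simplex m i))
        ≈⟨ sum-exchange y _ (F ∘ simplex m) ⟩
      ∑ (λ k → y k * ∑ λ i → F (simplex m i) * sd m (tabloid k) (eq i))
        ≈⟨ sum-cong (λ k → *-congˡ (trans (sum-cong λ i → trans (*-comm _ _) (sym (sd-*ʳ m (tabloid k) (F (simplex m i)) (eq i))))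
             (sym (sd-sum m (tabloid k) (λ i σ → eq i σ * F (simplex m i)))))) ⟩
      ∑ (λ k → y k * sd m (tabloid k) (λ σ → ∑ λ i → eq i σ * F (simplex m i)))
        ≈⟨ sum-cong (λ k → *-congˡ (sd-cong m (tabloid k) λ s → trans (sum-cong λ i → *-comm _ _)
             (sum-simplex-δ F (sup-valid (good k) s)))) ⟩
      ∑ (λ k → y k * sd m (tabloid k) F) ∎
      where
      eq : Fin (length (simplices n c m)) → RelChain n m → Carrier
      eq i σ = ind (chainEqᵇ σ (simplex m i))

  -- By `sd-δ` the boundary sees a tabloid only after one merge, so each of its coefficients is a
  -- signed sum of instances of `IsZ`.
  subdivide-cycle : ∀ m → (∀ k → Good c m (tabloid k)) → ∀ y → IsZ m y → IsCycle m (subdivide m y)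
  subdivide-cycle zero    good y yZ = _
  subdivide-cycle (suc m) good y yZ j = begin
    ∂ m (subdivide (suc m) y) j
      ≈⟨ ∂≈ m (subdivide (suc m) y) j ⟩
    ∑ (λ i → subdivide (suc m) y i * incidence (simplex (suc m) i) (simplex m j))
      ≈⟨ subdivide-pairing good y (λ σ → incidence σ (simplex m j)) ⟩
    ∑ (λ k → y k * sd (suc m) (tabloid k) (λ σ → incidence σ (simplex m j)))
      ≈⟨ sum-cong (λ k → *-congˡ (trans (sd-cong (suc m) (tabloid k) (λ {σ} _ → incidence≈ σ (simplex m j))) (sd-δ m (tabloid k) eq))) ⟩
    ∑ (λ k → y k * ∑ {suc m} λ i → sg (m +ℕ toℕ i) * sd m (mgV (toℕ i) (tabloid k)) eq)
      ≈⟨ sum-cong (λ k → trans (*-distribˡ-sum {suc m} (y k) (λ i → sg (m +ℕ toℕ i) * sd m (mgV (toℕ i) (tabloid k)) eq))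
           (sum-cong {suc m} λ i → x∙yz≈y∙xz (y k) (sg (m +ℕ toℕ i)) (sd m (mgV (toℕ i) (tabloid k)) eq))) ⟩
    ∑ (λ k → ∑ {suc m} λ i → sg (m +ℕ toℕ i) * (y k * sd m (mgV (toℕ i) (tabloid k)) eq))
      ≈⟨ sum-comm {_} {suc m} (λ k i → sg (m +ℕ toℕ i) * (y k * sd m (mgV (toℕ i) (tabloid k)) eq)) ⟩
    ∑ {suc m} (λ i → ∑ λ k → sg (m +ℕ toℕ i) * (y k * sd m (mgV (toℕ i) (tabloid k)) eq))
      ≈⟨ sum-zero {suc m} (λ i → trans (sym (*-distribˡ-sum (sg (m +ℕ toℕ i)) (λ k → y k * sd m (mgV (toℕ i) (tabloid k)) eq)))
           (trans (*-congˡ (yZ (toℕ i) (Finₚ.toℕ<n i) (λ V → sd m V eq))) (zeroʳ _))) ⟩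
    0# ∎
    where
    open import Algebra.Properties.CommutativeSemigroup *-commutativeSemigroup using (x∙yz≈y∙xz)
    eq : RelChain n m → Carrier
    eq ρ = ind (chainEqᵇ ρ (simplex m j))

  Misses : ℕ → Tabloid n → Set
  Misses q V = ∀ e → lookup V e ≢ q

  -- Of the flags of W only the one cutting off the last row first is mapped
  -- to a nondegenerate simplex, namely to W.
  sd-hT : ∀ m W (Ψ : Tabloid n → Carrier) → (∀ e → lookup W e ≤ m) →
    (∀ V q → 0 < q → q ≤ m → Misses q V → Ψ V ≈ 0#) → sd m W (Ψ ∘ hT) ≈ Ψ W
  sd-hT zero W Ψ W≤ nd = reflexive (cong Ψ (lookup-ext λ e → ≡.trans (Vecₚ.lookup∘tabulate (h {n} []) e) (≡.sym (ℕₚ.n≤0⇒n≡0 (W≤ e)))))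
  sd-hT (suc m) W Ψ W≤ nd = begin
    ∑ {suc m} (λ i → sg (m +ℕ toℕ i) * sd m (mgV (toℕ i) W) (λ τ → Ψ (hT (φ (suc m) W ∷ τ))))
      ≈⟨ sum-cong {suc m} (λ i → *-congˡ (trans (sd-cong m (mgV (toℕ i) W) (λ {τ} s → trans (reflexive (cong Ψ (hT-raise τ)))
           (sym (*-ind-true _ (sup⇒full i s))))) (sd-hT m (mgV (toℕ i) W) Ψ′ (bounded i) nd′))) ⟩
    ∑ {suc m} (λ i → sg (m +ℕ toℕ i) * Ψ′ (mgV (toℕ i) W))
      ≈⟨ sum-single {suc m} last (λ i i≢ → trans (*-congˡ (trans (*-ind-true _ (mgV-full i)) (inner i i≢))) (zeroʳ _)) ⟩
    sg (m +ℕ toℕ last) * Ψ′ (mgV (toℕ last) W)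
      ≈⟨ *-cong (trans (reflexive (cong (λ z → sg (m +ℕ z)) (Finₚ.toℕ-fromℕ m))) (sg-double m))
           (trans (*-ind-true _ (mgV-full last)) (reflexive (cong Ψ outer))) ⟩
    1# * Ψ W
      ≈⟨ *-identityˡ _ ⟩
    Ψ W ∎
    where
    last = fromℕ m
    raise : Tabloid n → Tabloid n
    raise V = Vec.tabulate λ e → b2n (lookup W e ≡ᵇ suc m) +ℕ lookup V e
    -- The assumption on missed rows passes to `Ψ′` only for those `V` that keep the last row of `W`
    -- in row `m`; for others `raise` might fill a missed row. The indicator discards them, and no
    -- flag of `W` produces one.
    full : Tabloid n → Bool
    full V = allB λ e → (lookup W e ≡ᵇ suc m) ⇒ᵇ (lookup V e ≡ᵇ m)
    Ψ′ : Tabloid n → Carrier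
    Ψ′ V = Ψ (raise V) * ind (full V)
    full⁺ : ∀ V → (∀ e → lookup W e ≡ suc m → lookup V e ≡ m) → full V ≡ true
    full⁺ V eq = allB⁺ _ λ e → ⇒ᵇ⁺ (lookup W e ≡ᵇ suc m) λ p → ≡ᵇ-true⁺ (eq e (≡ᵇ-true⁻ p))
    full⁻ : ∀ V → full V ≡ true → ∀ e → lookup W e ≡ suc m → lookup V e ≡ m
    full⁻ V p e We = ≡ᵇ-true⁻ (⇒ᵇ⁻ (lookup W e ≡ᵇ suc m)
      (allB⁻ (λ e → (lookup W e ≡ᵇ suc m) ⇒ᵇ (lookup V e ≡ᵇ m)) p e) (≡ᵇ-true⁺ We))
    mgV-top : ∀ (i : Fin (suc m)) e → lookup W e ≡ suc m → lookup (mgV (toℕ i) W) e ≡ m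
    mgV-top i e We = ≡.trans (lookup-mgV (toℕ i) W e) (≡.trans (cong (mg (toℕ i)) We) (mg-high (toℕ≤ i)))
    mgV-full : ∀ (i : Fin (suc m)) → full (mgV (toℕ i) W) ≡ true
    mgV-full i = full⁺ (mgV (toℕ i) W) (mgV-top i)
    sup⇒full : ∀ (i : Fin (suc m)) {τ} → Sup m (mgV (toℕ i) W) τ → full (hT τ) ≡ true
    sup⇒full i {τ} s = full⁺ (hT τ) λ e We → ≡.trans (Vecₚ.lookup∘tabulate (h τ) e) (sup-full s e (mgV-top i e We))
    hT-raise : ∀ (τ : RelChain n m) → hT (φ (suc m) W ∷ τ) ≡ raise (hT τ)
    hT-raise τ = Vecₚ.tabulate-cong λ e → cong₂ _+ℕ_ (cong b2n (Z-φ (suc m) W e)) (≡.sym (Vecₚ.lookup∘tabulate (h τ) e))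
    bounded : ∀ (i : Fin (suc m)) e → lookup (mgV (toℕ i) W) e ≤ m
    bounded i e = subst (_≤ m) (≡.sym (lookup-mgV (toℕ i) W e)) (mg≤ (toℕ≤ i) (W≤ e))
    lookup-raise : ∀ V e → lookup (raise V) e ≡ b2n (lookup W e ≡ᵇ suc m) +ℕ lookup V e
    lookup-raise V = Vecₚ.lookup∘tabulate (λ e → b2n (lookup W e ≡ᵇ suc m) +ℕ lookup V e)
    raise-top : ∀ V e → lookup W e ≡ suc m → lookup (raise V) e ≡ suc (lookup V e)
    raise-top V e We = ≡.trans (lookup-raise V e) (cong (λ b → b2n b +ℕ lookup V e) (≡ᵇ-true⁺ We))
    raise-low : ∀ V e → lookup W e ≢ suc m → lookup (raise V) e ≡ lookup V e
    raise-low V e We = ≡.trans (lookup-raise V e) (cong (λ b → b2n b +ℕ lookup V e) (≡ᵇ-false⁺ We))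
    raise-misses : ∀ V q → (∀ e → lookup W e ≡ suc m → suc (lookup V e) ≢ q) →
      (∀ e → lookup W e ≢ suc m → lookup V e ≢ q) → Misses q (raise V)
    raise-misses V q up low e eq with lookup W e ≟ suc m
    ... | yes We = up e We (≡.trans (≡.sym (raise-top V e We)) eq)
    ... | no  We = low e We (≡.trans (≡.sym (raise-low V e We)) eq)
    nd′ : ∀ V q → 0 < q → q ≤ m → Misses q V → Ψ′ V ≈ 0#
    nd′ V q 0<q q≤m miss = bool-cases (full V)
      (λ fl → trans (*-congʳ (nd (raise V) q 0<q (ℕₚ.m≤n⇒m≤1+n q≤m) (raise-misses V q
        (λ e We p → ℕₚ.<⇒≢ (s≤s q≤m) (≡.trans (≡.sym p) (cong suc (full⁻ V fl e We)))) (λ e _ → miss e)))) (zeroˡ _))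
      (*-ind-false _)
    -- For `i < m` only the former last row lands in row `m`, and `raise` lifts it to row `m + 1`.
    -- Row `m` is then missed, and the term is degenerate.
    inner : ∀ i → i ≢ last → Ψ (raise (mgV (toℕ i) W)) ≈ 0#
    inner i i≢ = nd (raise (mgV (toℕ i) W)) m (ℕₚ.≤-<-trans z≤n i<m) (ℕₚ.n≤1+n m)
      (raise-misses (mgV (toℕ i) W) m
        (λ e We p → ℕₚ.<⇒≢ ℕₚ.≤-refl (≡.trans (≡.sym p) (cong suc (mgV-top i e We))))
        (λ e We≢ p → ℕₚ.<⇒≢ (mg< i<m (s≤s⁻¹ (ℕₚ.≤∧≢⇒< (W≤ e) We≢))) (≡.trans (≡.sym (lookup-mgV (toℕ i) W e)) p)))
      where
      i<m : toℕ i < m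
      i<m = ℕₚ.≤∧≢⇒< (toℕ≤ i) λ p → i≢ (Finₚ.toℕ-injective (≡.trans p (≡.sym (Finₚ.toℕ-fromℕ m))))
      mg< : ∀ {i m v} → i < m → v ≤ m → mg i v < m
      mg< {m = suc m} (s≤s i≤m) v≤m = s≤s (mg≤ i≤m v≤m)
    outer : raise (mgV (toℕ last) W) ≡ W
    outer = lookup-ext λ e → row e (lookup W e ≟ suc m)
      where
      row : ∀ e → Dec (lookup W e ≡ suc m) → lookup (raise (mgV (toℕ last) W)) e ≡ lookup W e
      row e (yes We) = ≡.trans (raise-top (mgV (toℕ last) W) e We) (≡.trans (cong suc (mgV-top last e We)) (≡.sym We))
      row e (no We)  = ≡.trans (raise-low (mgV (toℕ last) W) e We) (≡.trans (lookup-mgV (toℕ last) W e)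
        (mg-low (subst (lookup W e ≤_) (≡.sym (Finₚ.toℕ-fromℕ m)) (s≤s⁻¹ (ℕₚ.≤∧≢⇒< (W≤ e) We)))))

  -- The test function is the indicator of a single tabloid. All rows of that tabloid are occupied,
  -- so the function vanishes on degenerate images, as `sd-hT` requires.
  f-subdivide : ∀ m → (∀ k → Good c m (tabloid k)) → ∀ y j → f m (subdivide m y) j ≈ y j
  f-subdivide m good y j = begin
    f m (subdivide m y) j
      ≈⟨ subdivide-pairing good y (Ψ ∘ hT) ⟩
    ∑ (λ k → y k * sd m (tabloid k) (Ψ ∘ hT))
      ≈⟨ sum-cong (λ k → *-congˡ (sd-hT m (tabloid k) Ψ (Good.bounded (good k)) nd)) ⟩
    ∑ (λ k → y k * Ψ (tabloid k))
      ≈⟨ sum-ind (λ k → tabloidEqᵇ (tabloid k) (tabloid j)) y j (tabloidEqᵇ⁺ {T = tabloid j} ≡.refl)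
           (λ k p → tabloid-injective k j (tabloidEqᵇ⁻ _ _ p)) ⟩
    y j ∎
    where
    Ψ : Tabloid n → Carrier
    Ψ V = ind (tabloidEqᵇ V (tabloid j))
    nd : ∀ V q → 0 < q → q ≤ m → Misses q V → Ψ V ≈ 0#
    nd V q _ q≤m miss = reflexive (cong ind (≢true⇒false λ t →
      let e , p = Good.occupied (good j) q q≤m in
      miss e (≡.trans (cong (λ U → lookup U e) (tabloidEqᵇ⁻ V (tabloid j) t)) p)))

-- Column stabilisers and polytabloids

injective⇒surjective : ∀ {n} (f : Fin n → Fin n) → (∀ {i j} → f i ≡ f j → i ≡ j) → ∀ j → ∃ λ i → f i ≡ j
injective⇒surjective {suc n} f inj j with Finₚ.any? (λ i → f i ≟ᶠ j)
... | yes p = p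
... | no ¬p = contradiction (Finₚ.injective⇒≤ {f = λ i → punchOut (j≢ i)}
    λ {i} {i′} eq → inj (Finₚ.punchOut-injective (j≢ i) (j≢ i′) eq)) ℕₚ.1+n≰n
  where
  j≢ : ∀ i → j ≢ f i
  j≢ i eq = ¬p (i , ≡.sym eq)

permOf : ∀ {n} (f : Fin n → Fin n) → (∀ {i j} → f i ≡ f j → i ≡ j) → Permutation′ n
permOf f inj = permutation f f⁻¹ f∘f⁻¹ λ i → inj (f∘f⁻¹ (f i))
  where
  f⁻¹ = λ j → proj₁ (injective⇒surjective f inj j)
  f∘f⁻¹ : ∀ j → f (f⁻¹ j) ≡ j
  f∘f⁻¹ j = proj₂ (injective⇒surjective f inj j)

∈-permVecs⁻ : ∀ {n} {γ : Vec (Fin n) n} → γ ∈ permVecs n → ∀ {i j} → lookup γ i ≡ lookup γ j → i ≡ j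
∈-permVecs⁻ {n} {γ} γ∈ {i} {j} eq = Finₚ.toℕ-injective (≡ᵇ-true⁻ (⇒ᵇ⁻ (finEqᵇ (lookup γ i) (lookup γ j))
  (allB⁻ (λ j → finEqᵇ (lookup γ i) (lookup γ j) ⇒ᵇ finEqᵇ i j)
    (allB⁻ (λ i → allB λ j → finEqᵇ (lookup γ i) (lookup γ j) ⇒ᵇ finEqᵇ i j)
      (proj₂ (∈-filterᵇ⁻ isPermVec {xs = allVec (allFin n) n} γ∈)) i) j)
  (≡ᵇ-true⁺ (cong toℕ eq))))

∈-permVecs⁺ : ∀ {n} {γ : Vec (Fin n) n} → (∀ {i j} → lookup γ i ≡ lookup γ j → i ≡ j) → γ ∈ permVecs n
∈-permVecs⁺ {n} {γ} inj = ∈-filterᵇ⁺ isPermVec (∈-allVec⁺ γ (λ i → ∈ₚ.∈-allFin _))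
  (allB⁺ _ λ i → allB⁺ _ λ j → ⇒ᵇ⁺ (finEqᵇ (lookup γ i) (lookup γ j))
    λ p → ≡ᵇ-true⁺ (cong toℕ (inj (Finₚ.toℕ-injective (≡ᵇ-true⁻ p)))))

actTabloid-∈⁺ : ∀ {n} (g : Permutation′ n) {c} {T : Tabloid n} → T ∈ tabloids n c → actTabloid g T ∈ tabloids n c
actTabloid-∈⁺ {n} g {c} {T} T∈ = ∈-tabloids⁺ {c = c} (actTabloid g T)
  (λ e → subst (_< length c) (≡.sym (look e)) (∈-tabloids-row {c = c} T∈ (g ⟨$⟩ˡ e)))
  λ i i< → ≡.trans (count-cong λ e → cong (_≡ᵇ i) (look e))
    (≡.trans (≡.sym (count-permute (λ e → lookup T e ≡ᵇ i) (flip g))) (∈-tabloids-size {c = c} T∈ i i<))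
  where
  look : ∀ e → lookup (actTabloid g T) e ≡ lookup T (g ⟨$⟩ˡ e)
  look = Vecₚ.lookup∘tabulate (λ e → lookup T (g ⟨$⟩ˡ e))

isImage⁻ : ∀ {n} (γ : Vec (Fin n) n) (T U : Tabloid n) → isImageTabloid γ T U ≡ true →
  ∀ e → lookup U (lookup γ e) ≡ lookup T e
isImage⁻ γ T U p e = ≡ᵇ-true⁻ (allB⁻ (λ e → lookup U (lookup γ e) ≡ᵇ lookup T e) p e)

isImage⁺ : ∀ {n} (γ : Vec (Fin n) n) (T U : Tabloid n) → (∀ e → lookup U (lookup γ e) ≡ lookup T e) →
  isImageTabloid γ T U ≡ true
isImage⁺ γ T U eq = allB⁺ _ λ e → ≡ᵇ-true⁺ (eq e)

module ColumnStabiliser {n : ℕ} (c : List ℕ) (t : Permutation′ n) where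

  record InStabiliser (γ : Vec (Fin n) n) : Set where
    field
      inj : ∀ {i j} → lookup γ i ≡ lookup γ j → i ≡ j
      col : ∀ e → boxCol c (t ⟨$⟩ˡ lookup γ e) ≡ boxCol c (t ⟨$⟩ˡ e)

    perm : Permutation′ n
    perm = permOf (lookup γ) inj

    surj : ∀ j → ∃ λ i → lookup γ i ≡ j
    surj = injective⇒surjective (lookup γ) inj

    image : Tabloid n → Tabloid n
    image = actTabloid perm

    lookup-image : ∀ T e → lookup (image T) (lookup γ e) ≡ lookup T e
    lookup-image T e = ≡.trans (Vecₚ.lookup∘tabulate (λ e → lookup T (perm ⟨$⟩ˡ e)) (lookup γ e))
      (cong (lookup T) (inverseˡ perm))

    image-unique : ∀ T U → (∀ e → lookup U (lookup γ e) ≡ lookup T e) → U ≡ image T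
    image-unique T U eq = lookup-ext λ e → let i , p = surj e in
      subst (λ e → lookup U e ≡ lookup (image T) e) p (≡.trans (eq i) (≡.sym (lookup-image T i)))

  stabiliser : List (Vec (Fin n) n)
  stabiliser = filterᵇ (inColStab c t) (permVecs n)

  stabiliser-unique : Unique stabiliser
  stabiliser-unique = filterᵇ-unique (inColStab c t) (filterᵇ-unique isPermVec (allVec-unique (Uniqueₚ.allFin⁺ n) n))

  ∈-stabiliser⁻ : ∀ {γ} → γ ∈ stabiliser → InStabiliser γ
  ∈-stabiliser⁻ {γ} γ∈ with γ∈P , st ← ∈-filterᵇ⁻ (inColStab c t) {xs = permVecs n} γ∈ = record
    { inj = ∈-permVecs⁻ γ∈P
    ; col = λ e → ≡ᵇ-true⁻ (allB⁻ (λ e → boxCol c (t ⟨$⟩ˡ lookup γ e) ≡ᵇ boxCol c (t ⟨$⟩ˡ e)) st e) }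

  ∈-stabiliser⁺ : ∀ {γ} → InStabiliser γ → γ ∈ stabiliser
  ∈-stabiliser⁺ {γ} s = ∈-filterᵇ⁺ (inColStab c t) (∈-permVecs⁺ inj) (allB⁺ _ λ e → ≡ᵇ-true⁺ (col e))
    where open InStabiliser s

  module _ {a b : Fin n} (same-col : boxCol c (t ⟨$⟩ˡ a) ≡ boxCol c (t ⟨$⟩ˡ b)) where
    open Transposition a b

    swap : Vec (Fin n) n → Vec (Fin n) n
    swap γ = Vec.tabulate λ e → lookup γ (τ e)

    lookup-swap : ∀ γ e → lookup (swap γ) e ≡ lookup γ (τ e)
    lookup-swap γ = Vecₚ.lookup∘tabulate (λ e → lookup γ (τ e))

    swap-swap : ∀ γ → swap (swap γ) ≡ γ
    swap-swap γ = lookup-ext λ e → ≡.trans (lookup-swap (swap γ) e)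
      (≡.trans (lookup-swap γ (τ e)) (cong (lookup γ) (τ-τ e)))

    col-τ : ∀ e → boxCol c (t ⟨$⟩ˡ τ e) ≡ boxCol c (t ⟨$⟩ˡ e)
    col-τ e = go (e ≟ᶠ a) (e ≟ᶠ b)
      where
      go : Dec (e ≡ a) → Dec (e ≡ b) → boxCol c (t ⟨$⟩ˡ τ e) ≡ boxCol c (t ⟨$⟩ˡ e)
      go (yes ≡.refl) _            = ≡.trans (cong (λ e → boxCol c (t ⟨$⟩ˡ e)) τ-a) (≡.sym same-col)
      go (no _)       (yes ≡.refl) = ≡.trans (cong (λ e → boxCol c (t ⟨$⟩ˡ e)) τ-b) same-col
      go (no p)       (no q)       = cong (λ e → boxCol c (t ⟨$⟩ˡ e)) (τ-other p q)

    swap-stabiliser : ∀ {γ} → InStabiliser γ → InStabiliser (swap γ)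
    swap-stabiliser {γ} s = record
      { inj = λ {i} {j} eq → τ-injective (inj (≡.trans (≡.sym (lookup-swap γ i)) (≡.trans eq (lookup-swap γ j))))
      ; col = λ e → ≡.trans (cong (λ x → boxCol c (t ⟨$⟩ˡ x)) (lookup-swap γ e)) (≡.trans (col (τ e)) (col-τ e)) }
      where open InStabiliser s

    -- The two images differ only at the entries `lookup γ a` and `lookup γ b`, which occupy rows
    -- `i` and `i + 1`.
    mgV-image-swap : ∀ i (T : Tabloid n) → lookup T a ≡ i → lookup T b ≡ suc i → ∀ {γ} (s : InStabiliser γ) (s′ : InStabiliser (swap γ)) →
      mgV i (InStabiliser.image s′ T) ≡ mgV i (InStabiliser.image s T)
    mgV-image-swap i T Ta Tb {γ} s s′ = lookup-ext λ x → let e , p = S′.surj x in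
      subst (λ x → lookup (mgV i (S′.image T)) x ≡ lookup (mgV i (S.image T)) x) p (at e)
      where
      module S = InStabiliser s
      module S′ = InStabiliser s′
      merged : mg i (lookup T a) ≡ mg i (lookup T b)
      merged = ≡.trans (cong (mg i) Ta) (≡.trans (mg-low ℕₚ.≤-refl)
        (≡.sym (≡.trans (cong (mg i) Tb) (mg-high {i} ℕₚ.≤-refl))))
      mg-τ : ∀ e → mg i (lookup T e) ≡ mg i (lookup T (τ e))
      mg-τ e = go (e ≟ᶠ a) (e ≟ᶠ b)
        where
        go : Dec (e ≡ a) → Dec (e ≡ b) → mg i (lookup T e) ≡ mg i (lookup T (τ e))
        go (yes ≡.refl) _            = ≡.trans merged (cong (mg i ∘ lookup T) (≡.sym τ-a))
        go (no _)       (yes ≡.refl) = ≡.trans (≡.sym merged) (cong (mg i ∘ lookup T) (≡.sym τ-b))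
        go (no p)       (no q)       = cong (mg i ∘ lookup T) (≡.sym (τ-other p q))
      at : ∀ e → lookup (mgV i (S′.image T)) (lookup (swap γ) e) ≡ lookup (mgV i (S.image T)) (lookup (swap γ) e)
      at e = ≡.trans (lookup-mgV i (S′.image T) (lookup (swap γ) e)) (≡.trans (cong (mg i) (S′.lookup-image T e))
        (≡.trans (mg-τ e) (≡.sym (≡.trans (lookup-mgV i (S.image T) (lookup (swap γ) e))
        (cong (mg i) (≡.trans (cong (lookup (S.image T)) (lookup-swap γ e)) (S.lookup-image T (τ e))))))))

module Polytabloids {ℓ₁ ℓ₂} (K : CommutativeRing ℓ₁ ℓ₂) (n x₀ : ℕ) (c′ : List ℕ)
  (pos : All (0 <_) (x₀ ∷ c′)) (n≡ : sum (x₀ ∷ c′) ≡ n) where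
  open CommutativeRing K
  open RingSums K
  open Complex K n x₀ c′
  open Hom K n c
  open Boxes {n} {c} n≡
  open import Algebra.Properties.Ring ring
  open import Relation.Binary.Reasoning.Setoid setoid

  sg-flip : ∀ j k → odd j ≡ not (odd k) → sg j ≈ - sg k
  sg-flip j k eq with isEvenᵇ j | isEvenᵇ k
  ... | true  | false = sym (-‿involutive 1#)
  ... | false | true  = refl

  module _ (t : Permutation′ n) where
    open ColumnStabiliser c t

    element : Fin (length stabiliser) → Vec (Fin n) n
    element = lookupL stabiliser

    stable : ∀ l → InStabiliser (element l)
    stable l = ∈-stabiliser⁻ (∈ₚ.∈-lookup l)

    image : Fin (length stabiliser) → Tabloid n
    image l = InStabiliser.image (stable l) (tabloidOf c t)

    polytabloid≈ : ∀ j → polytabloid t j ≈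
      ∑ λ l → sg (inversions (element l)) * ind (isImageTabloid (element l) (tabloidOf c t) (tabloid j))
    polytabloid≈ j = reflexive (foldr-lookup stabiliser _)

    -- Each element of the column stabiliser contributes exactly one tabloid, which again has shape
    -- `B`.
    polytabloid-pairing : ∀ (Ψ : Tabloid n → Carrier) →
      ∑ (λ j → polytabloid t j * Ψ (tabloid j)) ≈ ∑ λ l → sg (inversions (element l)) * Ψ (image l)
    polytabloid-pairing Ψ = trans (sum-cong λ j → *-congʳ (polytabloid≈ j))
      (trans (sum-exchange (sg ∘ inversions ∘ element) _ (Ψ ∘ tabloid)) (sum-cong λ l → *-congˡ (pick l)))
      where
      pick : ∀ l → ∑ (λ j → Ψ (tabloid j) * ind (isImageTabloid (element l) (tabloidOf c t) (tabloid j))) ≈ Ψ (image l)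
      pick l = trans
        (sum-ind (λ j → isImageTabloid (element l) (tabloidOf c t) (tabloid j)) (Ψ ∘ tabloid) j
          (isImage⁺ (element l) (tabloidOf c t) (tabloid j) λ e →
            ≡.trans (cong (λ U → lookup U (lookup (element l) e)) p) (InStabiliser.lookup-image (stable l) (tabloidOf c t) e))
          λ k q → tabloid-injective k j (≡.trans (InStabiliser.image-unique (stable l) (tabloidOf c t) (tabloid k)
            (isImage⁻ (element l) (tabloidOf c t) (tabloid k) q)) (≡.sym p)))
        (reflexive (cong Ψ p))
        where
        found = tabloidIndex (actTabloid-∈⁺ (InStabiliser.perm (stable l)) {c} (tabloidOf-∈ t))
        j = proj₁ found
        p : tabloid j ≡ image l
        p = proj₂ found

    -- Rows i and i+1 share a column; exchanging its two entries a and b is a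
    -- sign-reversing involution of the column stabiliser.
    polytabloid-IsZ : IsZ (length c′) (polytabloid t)
    polytabloid-IsZ i i< Ψ = trans (polytabloid-pairing (Ψ ∘ mgV i))
      (sum-involution (λ l → sg (inversions (element l)) * Ψ (mgV i (image l)))
        -- The two members of an orbit of the involution are told apart by the order of the images
        -- of `a` and `b`.
        (λ l → lt (lookup (element l) a) (lookup (element l) b)) ι ιι flips signs)
      where
      i<c = ℕₚ.m≤n⇒m≤1+n i<
      size-pos : 0 < nthD 0 c i
      size-pos = nthD-pos pos i<c
      last-p : nthD 0 c i ∸ 1 < nthD 0 c i
      last-p = ℕₚ.∸-monoʳ-< {nthD 0 c i} {1} {0} (s≤s z≤n) size-pos
      -- The last box of row `i` and the first box of row `i + 1` are the ones in the shared column.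
      boxA = box i<c last-p
      boxB = box (s≤s i<) (nthD-pos pos (s≤s i<))
      a = t ⟨$⟩ʳ boxA
      b = t ⟨$⟩ʳ boxB
      coordA : boxCoord c (t ⟨$⟩ˡ a) ≡ (i , startCol 0 c i +ℕ (nthD 0 c i ∸ 1))
      coordA = ≡.trans (cong (boxCoord c) (inverseˡ t)) (boxCoord-box i<c last-p)
      coordB : boxCoord c (t ⟨$⟩ˡ b) ≡ (suc i , startCol 0 c (suc i) +ℕ 0)
      coordB = ≡.trans (cong (boxCoord c) (inverseˡ t)) (boxCoord-box (s≤s i<) (nthD-pos pos (s≤s i<)))
      same-col : boxCol c (t ⟨$⟩ˡ a) ≡ boxCol c (t ⟨$⟩ˡ b)
      same-col = ≡.trans (cong proj₂ coordA) (≡.trans (≡.sym (≡.trans (ℕₚ.+-identityʳ _)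
        (≡.trans (startCol-suc 0 c i<c) (ℕₚ.+-∸-assoc (startCol 0 c i) size-pos)))) (≡.sym (cong proj₂ coordB)))
      T = tabloidOf c t
      Ta : lookup T a ≡ i
      Ta = ≡.trans (Vecₚ.lookup∘tabulate (λ e → boxRow c (t ⟨$⟩ˡ e)) a) (cong proj₁ coordA)
      Tb : lookup T b ≡ suc i
      Tb = ≡.trans (Vecₚ.lookup∘tabulate (λ e → boxRow c (t ⟨$⟩ˡ e)) b) (cong proj₁ coordB)
      a≢b : a ≢ b
      a≢b eq = ℕₚ.1+n≢n (≡.trans (≡.sym Tb) (≡.trans (cong (lookup T) (≡.sym eq)) Ta))
      open Transposition a b
      swapped∈ : ∀ l → swap same-col (element l) ∈ stabiliser
      swapped∈ l = ∈-stabiliser⁺ (swap-stabiliser same-col (stable l))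
      ι : Fin (length stabiliser) → Fin (length stabiliser)
      ι l = index (swapped∈ l)
      element-ι : ∀ l → element (ι l) ≡ swap same-col (element l)
      element-ι l = ≡.sym (Anyₚ.lookup-index (swapped∈ l))
      ιι : ∀ l → ι (ι l) ≡ l
      ιι l = lookup-injective stabiliser-unique (ι (ι l)) l (≡.trans (element-ι (ι l))
        (≡.trans (cong (swap same-col) (element-ι l)) (swap-swap same-col (element l))))
      at-ι : ∀ l e → lookup (element (ι l)) e ≡ lookup (element l) (τ e)
      at-ι l e = ≡.trans (cong (λ γ → lookup γ e) (element-ι l)) (lookup-swap same-col (element l) e)
      flips : ∀ l → lt (lookup (element (ι l)) a) (lookup (element (ι l)) b) ≡ not (lt (lookup (element l) a) (lookup (element l) b))
      flips l = ≡.trans (cong₂ lt (≡.trans (at-ι l a) (cong (lookup (element l)) τ-a)) (≡.trans (at-ι l b) (cong (lookup (element l)) τ-b)))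
        (lt-flip (a≢b ∘ InStabiliser.inj (stable l)))
      signs : ∀ l → sg (inversions (element (ι l))) * Ψ (mgV i (image (ι l))) ≈ - (sg (inversions (element l)) * Ψ (mgV i (image l)))
      signs l = trans (*-cong (sg-flip (inversions (element (ι l))) (inversions (element l)) odds) (reflexive (cong Ψ images)))
        (sym (-‿distribˡ-* _ _))
        where
        odds : odd (inversions (element (ι l))) ≡ not (odd (inversions (element l)))
        odds = ≡.trans (inversions-parity (element (ι l))) (≡.trans (parity-cong (at-ι l))
          (≡.trans (parity-∘transposition a≢b (lookup (element l)) (InStabiliser.inj (stable l)))
          (cong not (≡.sym (inversions-parity (element l))))))
        images : mgV i (image (ι l)) ≡ mgV i (image l)
        images = transport (element-ι l) (stable (ι l))
          where
          transport : ∀ {γ} → γ ≡ swap same-col (element l) → (s : InStabiliser γ) →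
            mgV i (InStabiliser.image s T) ≡ mgV i (image l)
          transport ≡.refl s = mgV-image-swap same-col i T Ta Tb (stable l) s

-- The order on tabloids

top-difference : ∀ {A : Set} → DecidableEquality A → ∀ {m} (v w : Vec A m) →
  v ≡ w ⊎ ∃ λ e → lookup v e ≢ lookup w e × (∀ x → toℕ e < toℕ x → lookup v x ≡ lookup w x)
top-difference _≟′_ []      []      = inj₁ ≡.refl
top-difference _≟′_ (a ∷ v) (b ∷ w) with top-difference _≟′_ v w
... | inj₂ (e , ne , above) = inj₂ (fsuc e , ne , λ { (fsuc x) (s≤s lt) → above x lt })
... | inj₁ ≡.refl with a ≟′ b
... | yes ≡.refl = inj₁ ≡.refl
... | no a≢b     = inj₂ (fzero , a≢b , λ { (fsuc x) _ → ≡.refl })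

infix 4 _≺_

_≺_ : ∀ {n} → Tabloid n → Tabloid n → Set
T ≺ U = ∃ λ e → lookup T e < lookup U e × (∀ x → toℕ e < toℕ x → lookup T x ≡ lookup U x)

-- Rows are read as digits in base `k`, the largest entry giving the most significant digit. This
-- turns `≺` into the order of natural numbers, with `k ^ n` above all codes.
code : ∀ {n} → ℕ → Tabloid n → ℕ
code k []      = 0
code k (v ∷ T) = v +ℕ k *ℕ code k T

digit-step : ∀ {k v a b} → v < k → a < b → v +ℕ k *ℕ a < k *ℕ b
digit-step {k} {v} {a} {b} v<k a<b = begin-strict
  v +ℕ k *ℕ a  <⟨ ℕₚ.+-monoˡ-< (k *ℕ a) v<k ⟩
  k +ℕ k *ℕ a  ≡⟨ ℕₚ.*-suc k a ⟨
  k *ℕ suc a   ≤⟨ ℕₚ.*-monoʳ-≤ k a<b ⟩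
  k *ℕ b       ∎
  where open ℕₚ.≤-Reasoning

code-mono : ∀ {n k} (T U : Tabloid n) → (∀ e → lookup T e < k) → T ≺ U → code k T < code k U
code-mono {k = k} (v ∷ T) (u ∷ U) T< (fzero , v<u , above)
  with ≡.refl ← lookup-ext {v = T} {U} (λ x → above (fsuc x) (s≤s z≤n)) = ℕₚ.+-monoˡ-< (k *ℕ code k T) v<u
code-mono {k = k} (v ∷ T) (u ∷ U) T< (fsuc e , lt , above) = ℕₚ.<-≤-trans
  (digit-step (T< fzero) (code-mono T U (T< ∘ fsuc) (e , lt , λ x e<x → above (fsuc x) (s≤s e<x))))
  (ℕₚ.m≤n+m _ u)

code-bound : ∀ {n k} (T : Tabloid n) → (∀ e → lookup T e < k) → code k T < k ^ n
code-bound []      T< = s≤s z≤n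
code-bound (v ∷ T) T< = digit-step (T< fzero) (code-bound T (T< ∘ fsuc))

code-injective : ∀ {n k} (T U : Tabloid n) → (∀ e → lookup T e < k) → (∀ e → lookup U e < k) →
  code k T ≡ code k U → T ≡ U
code-injective T U T< U< eq with top-difference _≟_ T U
... | inj₁ T≡U = T≡U
... | inj₂ (e , ne , above) with ℕₚ.<-cmp (lookup T e) (lookup U e)
... | tri< lt _ _ = contradiction eq (ℕₚ.<⇒≢ (code-mono T U T< (e , lt , above)))
... | tri≈ _ p _  = contradiction p ne
... | tri> _ _ gt = contradiction (≡.sym eq) (ℕₚ.<⇒≢ (code-mono U T U< (e , gt , λ x e<x → ≡.sym (above x e<x))))

mg-fibre : ∀ i u v → mg i u ≡ mg i v → u ≡ v ⊎ (u ≡ i × v ≡ suc i) ⊎ (u ≡ suc i × v ≡ i)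
mg-fibre i       zero    zero    _  = inj₁ ≡.refl
mg-fibre zero    zero    (suc v) eq = inj₂ (inj₁ (≡.refl , cong suc (≡.sym eq)))
mg-fibre zero    (suc u) zero    eq = inj₂ (inj₂ (cong suc eq , ≡.refl))
mg-fibre zero    (suc u) (suc v) eq = inj₁ (cong suc eq)
mg-fibre (suc i) (suc u) (suc v) eq with mg-fibre i u v (ℕₚ.suc-injective eq)
... | inj₁ p              = inj₁ (cong suc p)
... | inj₂ (inj₁ (p , q)) = inj₂ (inj₁ (cong suc p , cong suc q))
... | inj₂ (inj₂ (p , q)) = inj₂ (inj₂ (cong suc p , cong suc q))

Descent : ∀ {n} → Tabloid n → ℕ → Set
Descent T i = ∃ λ e → ∃ λ e′ → lookup T e ≡ i × lookup T e′ ≡ suc i × toℕ e′ < toℕ e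

descent? : ∀ {n} (T : Tabloid n) i → Dec (Descent T i)
descent? T i = Finₚ.any? λ e → Finₚ.any? λ e′ → (lookup T e ≟ i) ×-dec ((lookup T e′ ≟ suc i) ×-dec (toℕ e′ <? toℕ e))

-- Without a descent, row `i` of `T` lies entirely below row `i + 1`. If at the top difference `U`
-- had `i + 1` and `T` had `i`, then row `i + 1` of `U` would properly contain that of `T`, against
-- the equality of their sizes.
no-descent-largest : ∀ {n c i} {T U : Tabloid n} → suc i < length c → T ∈ tabloids n c → U ∈ tabloids n c → ¬ Descent T i →
  mgV i U ≡ mgV i T → U ≡ T ⊎ U ≺ T
no-descent-largest {n} {c} {i} {T} {U} i< T∈ U∈ nd eq with top-difference _≟_ U T
... | inj₁ p = inj₁ p
... | inj₂ (e , ne , above) with mg-fibre i (lookup U e) (lookup T e)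
      (≡.trans (≡.sym (lookup-mgV i U e)) (≡.trans (cong (λ V → lookup V e) eq) (lookup-mgV i T e)))
... | inj₁ p = contradiction p ne
... | inj₂ (inj₁ (Ue , Te)) = inj₂ (e , subst₂ _<_ (≡.sym Ue) (≡.sym Te) ℕₚ.≤-refl , above)
... | inj₂ (inj₂ (Ue , Te)) = contradiction
    (≡.trans (∈-tabloids-size {c = c} T∈ (suc i) i<) (≡.sym (∈-tabloids-size {c = c} U∈ (suc i) i<)))
    (ℕₚ.<⇒≢ (count-strict sub e (≡ᵇ-false⁺ (λ p → ℕₚ.1+n≢n (≡.trans (≡.sym p) Te))) (≡ᵇ-true⁺ Ue)))
  where
  sub : ∀ x → (lookup T x ≡ᵇ suc i) ≡ true → (lookup U x ≡ᵇ suc i) ≡ true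
  sub x p with ℕₚ.<-cmp (toℕ e) (toℕ x)
  ... | tri< e<x _ _ = ≡ᵇ-true⁺ (≡.trans (above x e<x) (≡ᵇ-true⁻ p))
  ... | tri≈ _ e≡x _ with ≡.refl ← Finₚ.toℕ-injective e≡x = ≡ᵇ-true⁺ Ue
  ... | tri> _ _ x<e = contradiction (e , x , Te , ≡ᵇ-true⁻ p , x<e) nd

-- The tableau with increasing rows

module SortedTableau {n x₀ : ℕ} {c′ : List ℕ} (pos : All (0 <_) (x₀ ∷ c′)) (n≡ : sum (x₀ ∷ c′) ≡ n)
  (T : Tabloid n) (T∈ : T ∈ tabloids n (x₀ ∷ c′)) (descents : ∀ i → i < length c′ → Descent T i) where

  private
    c = x₀ ∷ c′
  open Boxes {n} {c} n≡

  row : Fin n → ℕ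
  row = lookup T

  row< : ∀ e → row e < length c
  row< = ∈-tabloids-row {c = c} T∈

  before : Fin n → Fin n → Bool
  before e x = (row x ≡ᵇ row e) ∧ lt x e

  offset : Fin n → ℕ
  offset e = count (before e)

  before⁻ : ∀ e x → before e x ≡ true → row x ≡ row e × toℕ x < toℕ e
  before⁻ e x p with q , s ← ∧-true⁻ (row x ≡ᵇ row e) p = ≡ᵇ-true⁻ q , <ᵇ-true⁻ {toℕ x} s

  before⁺ : ∀ {e x} → row x ≡ row e → toℕ x < toℕ e → before e x ≡ true
  before⁺ p q = ∧-true⁺ (≡ᵇ-true⁺ p) (<ᵇ-true⁺ q)

  before-self : ∀ e → before e e ≡ false
  before-self e = ≢true⇒false λ p → ℕₚ.<-irrefl ≡.refl (proj₂ (before⁻ e e p))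

  offset< : ∀ e → offset e < nthD 0 c (row e)
  offset< e = subst (offset e <_) (∈-tabloids-size {c = c} T∈ (row e) (row< e))
    (count-strict (λ x p → ≡ᵇ-true⁺ (proj₁ (before⁻ e x p))) e (before-self e) (≡ᵇ-true⁺ {row e} ≡.refl))

  offset-strict : ∀ {e x} → row x ≡ row e → toℕ x < toℕ e → offset x < offset e
  offset-strict {e} {x} p x<e = count-strict
    (λ y q → let s , y<x = before⁻ x y q in before⁺ (≡.trans s p) (ℕₚ.<-trans y<x x<e)) x (before-self x) (before⁺ p x<e)

  offset-injective : ∀ {e x} → row x ≡ row e → offset x ≡ offset e → x ≡ e
  offset-injective {e} {x} p q with ℕₚ.<-cmp (toℕ x) (toℕ e)
  ... | tri< lt _ _ = contradiction q (ℕₚ.<⇒≢ (offset-strict p lt))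
  ... | tri≈ _ s _  = Finₚ.toℕ-injective s
  ... | tri> _ _ gt = contradiction (≡.sym q) (ℕₚ.<⇒≢ (offset-strict (≡.sym p) gt))

  boxOf : Fin n → Fin n
  boxOf e = box (row< e) (offset< e)

  coord : ∀ e → boxCoord c (boxOf e) ≡ (row e , startCol 0 c (row e) +ℕ offset e)
  coord e = boxCoord-box (row< e) (offset< e)

  boxOf-injective : ∀ {e x} → boxOf e ≡ boxOf x → e ≡ x
  boxOf-injective {e} {x} eq = offset-injective rows
    (ℕₚ.+-cancelˡ-≡ (startCol 0 c (row x)) _ _ (subst (λ z → startCol 0 c z +ℕ offset e ≡ startCol 0 c (row x) +ℕ offset x) rows
      (cong proj₂ same)))
    where
    same : (row e , startCol 0 c (row e) +ℕ offset e) ≡ (row x , startCol 0 c (row x) +ℕ offset x)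
    same = ≡.trans (≡.sym (coord e)) (≡.trans (cong (boxCoord c) eq) (coord x))
    rows : row e ≡ row x
    rows = cong proj₁ same

  tableau : Permutation′ n
  tableau = flip (permOf boxOf boxOf-injective)

  tabloidOf-tableau : tabloidOf c tableau ≡ T
  tabloidOf-tableau = lookup-ext λ e → ≡.trans (Vecₚ.lookup∘tabulate (λ e → boxRow c (boxOf e)) e) (cong proj₁ (coord e))

  col : Fin n → ℕ
  col e = startCol 0 c (row e) +ℕ offset e

  boxCol-tableau : ∀ e → boxCol c (tableau ⟨$⟩ˡ e) ≡ col e
  boxCol-tableau e = cong proj₂ (coord e)

  sc : ℕ → ℕ
  sc = startCol 0 c

  sc-suc : ∀ {ρ} → ρ < length c → suc (sc (suc ρ)) ≡ sc ρ +ℕ nthD 0 c ρ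
  sc-suc {ρ} ρ< = ≡.trans (cong suc (startCol-suc 0 c ρ<)) (ℕₚ.m+[n∸m]≡n
    (ℕₚ.≤-trans (nthD-pos pos ρ<) (ℕₚ.m≤n+m _ (sc ρ))))

  sc-mono : ∀ {ρ} d → ρ +ℕ d ≤ length c → sc ρ ≤ sc (ρ +ℕ d)
  sc-mono {ρ} zero    _  = ℕₚ.≤-reflexive (cong sc (≡.sym (ℕₚ.+-identityʳ ρ)))
  sc-mono {ρ} (suc d) le = ℕₚ.≤-trans (sc-mono d (ℕₚ.<⇒≤ next<)) (ℕₚ.≤-trans (s≤s⁻¹
      (ℕₚ.≤-trans (ℕₚ.≤-reflexive (ℕₚ.+-comm 1 _)) (ℕₚ.≤-trans (ℕₚ.+-monoʳ-≤ (sc (ρ +ℕ d)) (nthD-pos pos next<))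
        (ℕₚ.≤-reflexive (≡.sym (sc-suc next<))))))
      (ℕₚ.≤-reflexive (cong sc (≡.sym (ℕₚ.+-suc ρ d)))))
    where
    next< : ρ +ℕ d < length c
    next< = subst (_≤ length c) (ℕₚ.+-suc ρ d) le

  col≤ : ∀ e → col e ≤ sc (suc (row e))
  col≤ e = s≤s⁻¹ (ℕₚ.≤-trans (ℕₚ.≤-reflexive (≡.sym (ℕₚ.+-suc _ _)))
    (ℕₚ.≤-trans (ℕₚ.+-monoʳ-≤ (sc (row e)) (offset< e)) (ℕₚ.≤-reflexive (≡.sym (sc-suc (row< e))))))

  -- The last entry of a row exceeds the first entry of the next one, and the
  -- rows between two rows meeting a common column consist of a single box.
  column-decreasing : ∀ d {e x} → row x ≡ suc (row e +ℕ d) → col e ≡ col x → toℕ x < toℕ e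
  column-decreasing d {e} {x} rows cols
    with a , b , Ta , Tb , b<a ← descents (row e) (s≤s⁻¹ (ℕₚ.≤-trans (s≤s (s≤s (ℕₚ.m≤m+n (row e) d)))
           (subst (_< length c) rows (row< x)))) = result d rows
    where
    sc≤ : sc (suc (row e)) ≤ sc (row x)
    sc≤ = subst (λ z → sc (suc (row e)) ≤ sc z) (≡.sym rows)
      (sc-mono {suc (row e)} d (ℕₚ.<⇒≤ (subst (_< length c) rows (row< x))))
    col-e : col e ≡ sc (suc (row e))
    col-e = ℕₚ.≤-antisym (col≤ e) (ℕₚ.≤-trans sc≤ (ℕₚ.≤-trans (ℕₚ.m≤m+n (sc (row x)) (offset x)) (ℕₚ.≤-reflexive (≡.sym cols))))
    sc-x : sc (suc (row e)) ≡ sc (row x)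
    sc-x = ℕₚ.≤-antisym sc≤ (ℕₚ.≤-trans (ℕₚ.m≤m+n (sc (row x)) (offset x)) (ℕₚ.≤-reflexive (≡.trans (≡.sym cols) col-e)))
    last-e : suc (offset e) ≡ nthD 0 c (row e)
    last-e = ℕₚ.+-cancelˡ-≡ (sc (row e)) _ _ (≡.trans (ℕₚ.+-suc _ _) (≡.trans (cong suc col-e) (sc-suc (row< e))))
    first-x : offset x ≡ 0
    first-x = ℕₚ.+-cancelˡ-≡ (sc (row x)) _ _ (≡.trans (≡.sym cols) (≡.trans col-e (≡.trans sc-x (≡.sym (ℕₚ.+-identityʳ _)))))
    e-max : ∀ y → row y ≡ row e → toℕ y ≤ toℕ e
    e-max y p = ℕₚ.≮⇒≥ λ e<y → ℕₚ.<⇒≱ (subst (λ z → offset y < nthD 0 c z) p (offset< y))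
      (subst (_≤ offset y) last-e (offset-strict (≡.sym p) e<y))
    x-min : ∀ y → row y ≡ row x → toℕ x ≤ toℕ y
    x-min y p = ℕₚ.≮⇒≥ λ y<x → ℕₚ.n≮0 (subst (offset y <_) first-x (offset-strict p y<x))
    b<e : toℕ b < toℕ e
    b<e = ℕₚ.<-≤-trans b<a (e-max a Ta)
    result : ∀ d → row x ≡ suc (row e +ℕ d) → toℕ x < toℕ e
    result zero rows = ℕₚ.≤-<-trans (x-min b (≡.trans Tb (≡.trans (cong suc (≡.sym (ℕₚ.+-identityʳ (row e)))) (≡.sym rows)))) b<e
    result (suc d) rows = ℕₚ.<-trans (column-decreasing d {b} {x}
        (≡.trans rows (cong suc (≡.trans (ℕₚ.+-suc (row e) d) (cong (_+ℕ d) (≡.sym Tb)))))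
        (≡.trans col-b (≡.trans (≡.sym col-e) cols))) b<e
      where
      next : sc (suc (row b)) ≤ sc (row x)
      next = subst₂ (λ y z → sc (suc y) ≤ sc z) (≡.sym Tb) (≡.sym (≡.trans rows (cong suc (ℕₚ.+-suc (row e) d))))
        (sc-mono {suc (suc (row e))} d (ℕₚ.<⇒≤ (subst (_< length c) (≡.trans rows (cong suc (ℕₚ.+-suc (row e) d))) (row< x))))
      col-b : col b ≡ sc (suc (row e))
      col-b = ℕₚ.≤-antisym (ℕₚ.≤-trans (col≤ b) (ℕₚ.≤-trans next (ℕₚ.≤-reflexive (≡.sym sc-x))))
        (subst (λ z → sc z ≤ col b) Tb (ℕₚ.m≤m+n (sc (row b)) (offset b)))

  -- Entries of one row have different columns, and if `e` were in the higher row,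
  -- `column-decreasing` would reverse the order of the two entries.
  column⇒row : ∀ {d e} → col d ≡ col e → toℕ d < toℕ e → row e < row d
  column⇒row {d} {e} cols d<e with ℕₚ.<-cmp (row e) (row d)
  ... | tri< re<rd _ _ = re<rd
  ... | tri≈ _ p _     = contradiction (cong toℕ (offset-injective (≡.sym p) (ℕₚ.+-cancelˡ-≡ (sc (row e)) _ _
                           (≡.trans (cong (λ z → sc z +ℕ offset d) p) cols)))) (ℕₚ.<⇒≢ d<e)
  ... | tri> _ _ rd<re = contradiction d<e (ℕₚ.<⇒≯ (column-decreasing (row e ∸ suc (row d))
                           (≡.sym (ℕₚ.m+[n∸m]≡n rd<re)) cols))

odd-identity : ∀ n → odd (inversions (Vec.allFin n)) ≡ false
odd-identity n = ≡.trans (inversions-parity (Vec.allFin n))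
  (≡.trans (parity-cong {f = lookup (Vec.allFin n)} {g = id} Vecₚ.lookup-allFin) (parity-id n))

module _ {n : ℕ} (c : List ℕ) (t : Permutation′ n) where
  open ColumnStabiliser c t

  identity-stable : InStabiliser (Vec.allFin n)
  identity-stable = record
    { inj = λ {x} {y} eq → ≡.trans (≡.sym (Vecₚ.lookup-allFin x)) (≡.trans eq (Vecₚ.lookup-allFin y))
    ; col = λ e → cong (λ x → boxCol c (t ⟨$⟩ˡ x)) (Vecₚ.lookup-allFin e) }

  -- At the largest entry e moved by γ, the entry e of γ{t} comes from a
  -- smaller entry of the same column, hence from a higher row.
  image-larger : ∀ {γ} {T U : Tabloid n} → InStabiliser γ →
    (∀ {d e} → boxCol c (t ⟨$⟩ˡ d) ≡ boxCol c (t ⟨$⟩ˡ e) → toℕ d < toℕ e → lookup T e < lookup T d) →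
    (∀ e → lookup U (lookup γ e) ≡ lookup T e) → (∀ e → lookup γ e ≡ e) ⊎ T ≺ U
  image-larger {γ} {T} {U} s decreasing img with top-difference _≟ᶠ_ γ (Vec.allFin n)
  ... | inj₁ p = inj₁ λ e → ≡.trans (cong (λ γ → lookup γ e) p) (Vecₚ.lookup-allFin e)
  ... | inj₂ (e , moved , fixed) = inj₂ (e ,
      subst (lookup T e <_) (≡.trans (≡.sym (img d)) (cong (lookup U) γd))
        (decreasing (≡.trans (≡.sym (InStabiliser.col s d)) (cong (λ x → boxCol c (t ⟨$⟩ˡ x)) γd)) d<e) ,
      λ x e<x → ≡.trans (≡.sym (img x)) (cong (lookup U) (fix x e<x)))
    where
    d = proj₁ (InStabiliser.surj s e)
    γd : lookup γ d ≡ e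
    γd = proj₂ (InStabiliser.surj s e)
    fix : ∀ x → toℕ e < toℕ x → lookup γ x ≡ x
    fix x e<x = ≡.trans (fixed x e<x) (Vecₚ.lookup-allFin x)
    d≢e : d ≢ e
    d≢e d≡e = moved (≡.trans (≡.trans (cong (lookup γ) (≡.sym d≡e)) γd) (≡.sym (Vecₚ.lookup-allFin e)))
    d<e : toℕ d < toℕ e
    d<e = ℕₚ.≤∧≢⇒< (ℕₚ.≮⇒≥ λ e<d → d≢e (≡.trans (≡.sym (fix d e<d)) γd)) (d≢e ∘ Finₚ.toℕ-injective)

-- Elements killed by all merges are combinations of polytabloids

module Straightening {ℓ₁ ℓ₂} (K : CommutativeRing ℓ₁ ℓ₂) (n x₀ : ℕ) (c′ : List ℕ)
  (pos : All (0 <_) (x₀ ∷ c′)) (n≡ : sum (x₀ ∷ c′) ≡ n) where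
  open CommutativeRing K
  open RingSums K
  open Complex K n x₀ c′
  open Hom K n c
  open Polytabloids K n x₀ c′ pos n≡
  open import Algebra.Properties.Ring ring
  open import Relation.Binary.Reasoning.Setoid setoid

  r : ℕ
  r = length c′

  k : ℕ
  k = length c

  rows< : ∀ j e → lookup (tabloid j) e < k
  rows< j = ∈-tabloids-row {c = c} (∈ₚ.∈-lookup j)

  codeOf : Fin (length (tabloids n c)) → ℕ
  codeOf j = code k (tabloid j)

  codeOf-injective : ∀ i j → codeOf i ≡ codeOf j → i ≡ j
  codeOf-injective i j eq = tabloid-injective i j (code-injective (tabloid i) (tabloid j) (rows< i) (rows< j) eq)

  sg-even : ∀ i → odd i ≡ false → sg i ≈ 1#
  sg-even i eq with isEvenᵇ i
  ... | true = refl

  module Leading (j : Fin (length (tabloids n c))) (t : Permutation′ n) (t↔j : tabloidOf c t ≡ tabloid j)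
    (decreasing : ∀ {d e} → boxCol c (t ⟨$⟩ˡ d) ≡ boxCol c (t ⟨$⟩ˡ e) → toℕ d < toℕ e →
      lookup (tabloid j) e < lookup (tabloid j) d) where
    open ColumnStabiliser c t

    is-image : ∀ l i → isImageTabloid (element t l) (tabloidOf c t) (tabloid i) ≡ true →
      ∀ e → lookup (tabloid i) (lookup (element t l) e) ≡ lookup (tabloid j) e
    is-image l i p e = ≡.trans (isImage⁻ (element t l) (tabloidOf c t) (tabloid i) p e) (cong (λ V → lookup V e) t↔j)

    is-image-cases : ∀ l i → isImageTabloid (element t l) (tabloidOf c t) (tabloid i) ≡ true →
      (∀ e → lookup (element t l) e ≡ e) ⊎ codeOf j < codeOf i
    is-image-cases l i p = map₂ (code-mono (tabloid j) (tabloid i) (rows< j))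
      (image-larger c t {element t l} {tabloid j} {tabloid i} (stable t l) decreasing (is-image l i p))

    -- Only the identity of the column stabiliser fixes the tabloid of `t`; every other element
    -- gives a tabloid with larger code.
    leading-one : polytabloid t j ≈ 1#
    leading-one = trans (polytabloid≈ t j) (trans
      (sum-ind (λ l → isImageTabloid (element t l) (tabloidOf c t) (tabloid j)) (λ l → sg (inversions (element t l))) l₀
        (isImage⁺ (element t l₀) (tabloidOf c t) (tabloid j) λ e → ≡.trans
          (cong (lookup (tabloid j)) (≡.trans (cong (λ γ → lookup γ e) element-l₀) (Vecₚ.lookup-allFin e)))
          (≡.sym (cong (λ V → lookup V e) t↔j)))
        only)
      (trans (reflexive (cong (sg ∘ inversions) element-l₀)) (sg-even (inversions (Vec.allFin n)) (odd-identity n))))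
      where
      l₀ = index (∈-stabiliser⁺ (identity-stable c t))
      element-l₀ : element t l₀ ≡ Vec.allFin n
      element-l₀ = ≡.sym (Anyₚ.lookup-index (∈-stabiliser⁺ (identity-stable c t)))
      only : ∀ l → isImageTabloid (element t l) (tabloidOf c t) (tabloid j) ≡ true → l ≡ l₀
      only l p = [ (λ fixed → lookup-injective stabiliser-unique l l₀ (≡.trans
            (lookup-ext λ e → ≡.trans (fixed e) (≡.sym (Vecₚ.lookup-allFin e))) (≡.sym element-l₀)))
        , (λ j<j → contradiction j<j (ℕₚ.<-irrefl ≡.refl)) ]′ (is-image-cases l j p)

    leading-zero : ∀ i → codeOf i < codeOf j → polytabloid t i ≈ 0#
    leading-zero i i<j = trans (polytabloid≈ t i)
      (sum-ind-none (λ l → isImageTabloid (element t l) (tabloidOf c t) (tabloid i)) _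
        λ l → ≢true⇒false λ p → [ (λ fixed → ℕₚ.<⇒≢ i<j (cong (code k) (lookup-ext {v = tabloid i} {tabloid j} λ e →
            ≡.trans (cong (lookup (tabloid i)) (≡.sym (fixed e))) (is-image l i p e))))
        , ℕₚ.<-asym i<j ]′ (is-image-cases l i p))

  -- `IsZ` is tested with the indicator of the merge of tabloid `j`. All other tabloids with this
  -- merge are smaller by `no-descent-largest`, so their coefficients already vanish.
  no-descent-zero : ∀ y → IsZ r y → ∀ j i → i < r → ¬ Descent (tabloid j) i →
    (∀ l → codeOf l < codeOf j → y l ≈ 0#) → y j ≈ 0#
  no-descent-zero y yZ j i i<r nd below = begin
    y j
      ≈⟨ *-ind-true (y j) (tabloidEqᵇ⁺ {T = mgV i (tabloid j)} ≡.refl) ⟨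
    y j * ind (tabloidEqᵇ (mgV i (tabloid j)) (mgV i (tabloid j)))
      ≈⟨ sum-single j others ⟨
    ∑ (λ l → y l * ind (tabloidEqᵇ (mgV i (tabloid l)) (mgV i (tabloid j))))
      ≈⟨ yZ i i<r (λ V → ind (tabloidEqᵇ V (mgV i (tabloid j)))) ⟩
    0# ∎
    where
    others : ∀ l → l ≢ j → y l * ind (tabloidEqᵇ (mgV i (tabloid l)) (mgV i (tabloid j))) ≈ 0#
    others l l≢j = bool-cases (tabloidEqᵇ (mgV i (tabloid l)) (mgV i (tabloid j)))
      (λ eq → trans (*-congʳ ([ (λ p → contradiction (tabloid-injective l j p) l≢j)
                              , (λ p → below l (code-mono (tabloid l) (tabloid j) (rows< l) p)) ]′
        (no-descent-largest {c = c} (s≤s i<r) (∈ₚ.∈-lookup j) (∈ₚ.∈-lookup l) nd (tabloidEqᵇ⁻ _ _ eq)))) (zeroˡ _))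
      (*-ind-false _)

  IsZ-cong : ∀ {y z} → (∀ j → y j ≈ z j) → IsZ r z → IsZ r y
  IsZ-cong y≈z zZ i i< Ψ = trans (sum-cong λ j → *-congʳ (y≈z j)) (zZ i i< Ψ)

  IsZ-+ : ∀ {y z} → IsZ r y → IsZ r z → IsZ r (λ j → y j + z j)
  IsZ-+ {y} {z} yZ zZ i i< Ψ = trans (sum-cong λ j → distribʳ _ _ _)
    (trans (sum-+ (λ j → y j * Ψ (mgV i (tabloid j))) (λ j → z j * Ψ (mgV i (tabloid j))))
    (trans (+-cong (yZ i i< Ψ) (zZ i i< Ψ)) (+-identityˡ 0#)))

  IsZ-* : ∀ s {y} → IsZ r y → IsZ r (λ j → s * y j)
  IsZ-* s {y} yZ i i< Ψ = trans (sum-cong λ j → *-assoc _ _ _)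
    (trans (sym (*-distribˡ-sum s (λ j → y j * Ψ (mgV i (tabloid j))))) (trans (*-congˡ (yZ i i< Ψ)) (zeroʳ s)))

  specht-IsZ : ∀ y → InSpecht y → IsZ r y
  specht-IsZ y (ts , y≈) = IsZ-cong y≈ (span ts)
    where
    span : ∀ ts → IsZ r (λ j → sumL ts (λ at → proj₁ at * polytabloid (proj₂ at) j))
    span []             i i< Ψ = sum-zero λ j → zeroˡ _
    span ((s , t) ∷ ts) = IsZ-+ (IsZ-* s (polytabloid-IsZ t)) (span ts)

  leading : ∀ j → (∀ i → i < r → Descent (tabloid j) i) →
    ∃ λ t → polytabloid t j ≈ 1# × (∀ i → codeOf i < codeOf j → polytabloid t i ≈ 0#)
  leading j descents = tableau , leading-one , leading-zero
    where
    open SortedTableau {n} {x₀} {c′} pos n≡ (tabloid j) (∈ₚ.∈-lookup j) descents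
    decreasing : ∀ {d e} → boxCol c (tableau ⟨$⟩ˡ d) ≡ boxCol c (tableau ⟨$⟩ˡ e) → toℕ d < toℕ e →
      lookup (tabloid j) e < lookup (tabloid j) d
    decreasing {d} {e} cols = column⇒row (≡.trans (≡.sym (boxCol-tableau d)) (≡.trans cols (boxCol-tableau e)))
    open Leading j tableau tabloidOf-tableau decreasing

  below-suc : ∀ (y : Mᴮ) j → (∀ l → codeOf l < codeOf j → y l ≈ 0#) → y j ≈ 0# → ∀ l → codeOf l < suc (codeOf j) → y l ≈ 0#
  below-suc y j below y≈0 l l≤j = [ below l , (λ eq → subst (λ l → y l ≈ 0#) (codeOf-injective j l (≡.sym eq)) y≈0) ]′
    (ℕₚ.m≤n⇒m<n∨m≡n (s≤s⁻¹ l≤j))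

  specht-restore : ∀ (y : Mᴮ) s t → InSpecht (λ l → y l + - s * polytabloid t l) → InSpecht y
  specht-restore y s t (ts , z≈) = (s , t) ∷ ts , λ l → trans (restore (y l) (polytabloid t l)) (+-congˡ (z≈ l))
    where
    restore : ∀ v e → v ≈ s * e + (v + - s * e)
    restore v e = sym (begin
      s * e + (v + - s * e)  ≈⟨ +-comm _ _ ⟩
      v + - s * e + s * e    ≈⟨ +-assoc _ _ _ ⟩
      v + (- s * e + s * e)  ≈⟨ +-congˡ (trans (sym (distribʳ e (- s) s)) (trans (*-congʳ (-‿inverseˡ s)) (zeroˡ e))) ⟩
      v + 0#                 ≈⟨ +-identityʳ _ ⟩
      v                      ∎)

  -- `N` climbs through the codes while the coefficients below it are zero; `fuel` bounds the way
  -- left to `k ^ n`. Subtracting a multiple of a leading polytabloid clears the coefficient at `N`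
  -- and disturbs none below.
  straighten : ∀ fuel N y → k ^ n ≤ N +ℕ fuel → IsZ r y → (∀ j → codeOf j < N → y j ≈ 0#) → InSpecht y
  straighten zero N y bound yZ below = [] , λ j → below j (ℕₚ.<-≤-trans (code-bound (tabloid j) (rows< j))
    (ℕₚ.≤-trans bound (ℕₚ.≤-reflexive (ℕₚ.+-identityʳ N))))
  straighten (suc fuel) N y bound yZ below = at (Finₚ.any? λ j → codeOf j ≟ N)
    where
    bound′ : k ^ n ≤ suc N +ℕ fuel
    bound′ = ℕₚ.≤-trans bound (ℕₚ.≤-reflexive (ℕₚ.+-suc N fuel))
    at-tabloid : ∀ j → codeOf j ≡ N → Dec (∀ (i : Fin r) → Descent (tabloid j) (toℕ i)) → InSpecht y
    at-tabloid j ≡.refl (no ¬all) = straighten fuel (suc N) y bound′ yZ (below-suc y j below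
      (let i , nd = Finₚ.¬∀⟶∃¬ r (λ i → Descent (tabloid j) (toℕ i)) (λ i → descent? (tabloid j) (toℕ i)) ¬all in
       no-descent-zero y yZ j (toℕ i) (Finₚ.toℕ<n i) nd below))
    at-tabloid j ≡.refl (yes all) = specht-restore y (y j) t
      (straighten fuel (suc N) z bound′ (IsZ-+ yZ (IsZ-* (- y j) (polytabloid-IsZ t)))
        (below-suc z j (λ l l<j → trans (+-cong (below l l<j) (trans (*-congˡ (zeros l l<j)) (zeroʳ _))) (+-identityˡ 0#))
          (trans (+-congˡ (trans (*-congˡ one) (*-identityʳ _))) (-‿inverseʳ (y j)))))
      where
      lead = leading j λ i i<r → subst (Descent (tabloid j)) (Finₚ.toℕ-fromℕ< i<r) (all (fromℕ< i<r))
      t = proj₁ lead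
      one = proj₁ (proj₂ lead)
      zeros = proj₂ (proj₂ lead)
      z : Mᴮ
      z l = y l + - y j * polytabloid t l
    at : Dec (∃ λ j → codeOf j ≡ N) → InSpecht y
    at (no none)       = straighten fuel (suc N) y bound′ yZ
      λ j j≤N → below j (ℕₚ.≤∧≢⇒< (s≤s⁻¹ j≤N) λ eq → none (j , eq))
    at (yes (j , eq)) = at-tabloid j eq (Finₚ.all? λ i → descent? (tabloid j) (toℕ i))

  IsZ-specht : ∀ y → IsZ r y → InSpecht y
  IsZ-specht y yZ = straighten (k ^ n) 0 y ℕₚ.≤-refl yZ λ _ ()

theorem7p4 : ∀ {a ℓ} (K : CommutativeRing a ℓ) → IsField K →
    (n : ℕ) (c : List ℕ) → c ≢ [] → All (0 <_) c → sum c ≡ n →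
    Hom.TopHomologyIsoSpecht K n c (length c ∸ 1)
theorem7p4 K _ n []        c≢[] pos n≡ = contradiction ≡.refl c≢[]
theorem7p4 K _ n (x₀ ∷ c′) _    pos n≡ = record
  { f          = f r
  ; f-cong     = f-cong
  ; f-+        = f-+
  ; f-*        = f-*
  ; f-equivar  = λ g y _ → f-equivariant r g y
  ; f-into     = λ y cycle → IsZ-specht (f r y) (f-IsZ y cycle)
  ; f-onto     = λ y y∈ → subdivide r y , subdivide-cycle r good y (specht-IsZ y y∈) , f-subdivide r good y
  -- The cycle itself is zero by injectivity, and so it bounds the zero chain.
  ; f-kernel   = λ y cycle fy≈0 → zero-boundary y (f-injective y cycle fy≈0)
  ; f-boundary = λ y bd → f-zero y (boundary-zero y bd)
  }
  where
  open Complex K n x₀ c′ using (f; c)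
  open Comparison K n x₀ c′ pos n≡
  open Equivariance K n x₀ c′
  open Subdivision K n x₀ c′
  open Straightening K n x₀ c′ pos n≡ using (IsZ-specht; specht-IsZ)
  open Hom K n c using (tabloid)
  good : ∀ j → Good c r (tabloid j)
  good j = tabloid-good pos (∈ₚ.∈-lookup j)
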